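{- Let $n\ge 1$ and let $X$ be a finite pure $n$-dimensional simplicial complex with connected links. Assume that $X$ is $(n+1)$-partite with sides $S_0,\dots,S_n$, and partite-regular in the following sense: for every $0\le i\le n$ there is a constant $K_i$ such that every vertex $\{v\}$ with $v\in S_i$ is contained in exactly $K_i$ $n$-dimensional simplices of $X$. Assume that there is a constant $0<\lambda<1$ such that for every $\tau\in\bigcup_{k=-1}^{n-2}X(k)$ the spectrum of the weighted random walk operator $(M')^+_{\tau,0}$ on the one-skeleton of $X_\tau$ (with weights induced by the homogeneous weight function of $X$) is contained in $[-1,\lambda]\cup\{1\}$. Then for all sets $U_0\subseteq S_0,\dots,U_n\subseteq S_n$, $$\left|\frac{|X(U_0,\dots,U_n)|}{|X(n)|}-\frac{|U_0|\cdots|U_n|}{|S_0|\cdots|S_n|}\right|\le C_n\lambda\min_{0\le i<j\le n}\sqrt{\frac{|U_i||U_j|}{|S_i||S_j|}},$$ where $$C_n=\sum_{k=0}^{n-1}n!\,\frac{(n+1-k)^{n-k}}{(n-k-1)!}\left((k+1)(k+2)^{n-k}-(k+1)^{n-k+1}\right).$$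
   Context: $X(k)$ denotes the set of simplices of $X$ with $k+1$ vertices, $X(-1)=\{\emptyset\}$; a vertex $v$ is identified with $\{v\}\in X(0)$. $X$ is pure $n$-dimensional if every simplex is contained in a simplex of $X(n)$. For $\tau\in X(k)$ the link $X_\tau$ is the complex with $\eta\in X_\tau(l)$ iff $\eta\in X(l)$ and $\tau\cup\eta\in X(k+l+1)$; $X_\emptyset=X$. "Connected links" means that for every $-1\le k\le n-2$ and every $\tau\in X(k)$ the one-skeleton of $X_\tau$ (the graph with vertices $X_\tau(0)$ and edges $X_\tau(1)$) is connected; in particular the one-skeleton of $X$ is connected. $X$ is $(n+1)$-partite with sides $S_0,\dots,S_n\subseteq X(0)$ if the $S_i$ are disjoint, $X(0)=\bigcup_i S_i$, and $|\sigma\cap S_i|=1$ for every $\sigma\in X(n)$ and every $0\le i\le n$. Homogeneous weight: for $-1\le k\le n$ and $\tau\in X(k)$, $m(\tau)=(n-k)!\,|\{\sigma\in X(n):\tau\subseteq\sigma\}|$. On the link, $m_\tau(\eta)=m(\tau\cup\eta)$. The weighted random walk operator $(M')^+_{\tau,0}$ acts on functions $\phi:X_\tau(0)\to\mathbb{R}$ by $$(M')^+_{\tau,0}\phi(v)=\sum_{u:\{u,v\}\in X_\tau(1)}\frac{m_\tau(\{u,v\})}{m_\tau(\{v\})}\phi(u).$$ For pairwise disjoint $U_0,\dots,U_n\subseteq X(0)$, $X(U_0,\dots,U_n)=\{\sigma\in X(n):|\sigma\cap U_i|=1\text{ for all }0\le i\le n\}$. -}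

module Defs where

open import Algebra.Apartness.Bundles using (HeytingField)
open import Algebra.Bundles using (CommutativeRing)
open import Data.Bool.Base using (if_then_else_)
open import Data.Fin.Base as Fin using (Fin; toℕ)
open import Data.Fin.Patterns using (0F; 1F)
import Data.Fin.Properties as Fin
open import Data.Fin.Subset
  using (Subset; inside; outside; _∈_; _⊆_; ⊥; ⁅_⁆; _∪_; _∩_; ∣_∣; Empty)
open import Data.Fin.Subset.Properties using (_⊆?_)
open import Data.List.Base as List
  using (List; []; _∷_; _++_; allFin; cartesianProduct; filter; foldr; length)
open import Data.Nat.Base as ℕ
  using (ℕ; zero; suc; NonZero; _∸_; _^_; _!) renaming (_+_ to _ℕ+_; _*_ to _ℕ*_)
import Data.Nat.Properties as ℕ
open import Data.Nat.ListAction using (product)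
open import Data.Product.Base using (_×_; _,_; proj₁; ∃-syntax; uncurry)
open import Data.Sum.Base using (_⊎_; inj₁; inj₂)
import Data.Vec.Base as Vec
open import Level using (Level; 0ℓ) renaming (_⊔_ to _⊔ℓ_; suc to sucℓ)
open import Relation.Binary.Construct.Closure.ReflexiveTransitive using (Star)
open import Relation.Binary.Core using (Rel)
open import Relation.Binary.Lattice.Definitions using (Supremum; Infimum)
open import Relation.Binary.PropositionalEquality.Core using (_≡_; _≢_)
open import Relation.Binary.Structures using (IsStrictPartialOrder)
open import Relation.Nullary.Decidable.Core using (does; _×-dec_)
open import Relation.Nullary.Negation.Core using (¬_)
open import Relation.Unary using (Pred; Decidable)

-- Ordered fields, constructively: the order is given by its strict part, with
-- apartness in place of inequality.  Binary suprema and infima are included as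
-- operations because they need not be computable in a bare ordered field.

record OrderedField (c ℓ₁ ℓ₂ : Level) : Set (sucℓ (c ⊔ℓ ℓ₁ ⊔ℓ ℓ₂)) where
  infix 4 _<_ _≤_
  infixl 6 _⊔_ _⊓_

  field
    heytingField : HeytingField c ℓ₁ ℓ₂

  open HeytingField heytingField public

  field
    _<_                  : Rel Carrier ℓ₂
    isStrictPartialOrder : IsStrictPartialOrder _≈_ _<_
    #⇒<⊎>                : ∀ {x y} → x # y → x < y ⊎ y < x
    <⇒#                  : ∀ {x y} → x < y → x # y
    +-monoˡ-<            : ∀ {x y} z → x < y → x + z < y + z
    *-pos                : ∀ {x y} → 0# < x → 0# < y → 0# < x * y

  _≤_ : Rel Carrier ℓ₂
  x ≤ y = ¬ (y < x)

  field
    _⊔_ _⊓_    : Carrier → Carrier → Carrier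
    ⊔-supremum : Supremum _≤_ _⊔_
    ⊓-infimum  : Infimum _≤_ _⊓_

  commutativeRing : CommutativeRing c ℓ₁
  commutativeRing = record { isCommutativeRing = isCommutativeRing }

  open CommutativeRing commutativeRing public using (ring; +-rawMonoid)
  open import Algebra.Definitions.RawMonoid +-rawMonoid public
    using (sum) renaming (_×_ to _·_)
  open import Algebra.Properties.Ring ring
    using (-1*x≈-x; -‿involutive; -0#≈0#)

  private module < = IsStrictPartialOrder isStrictPartialOrder

  abs : Carrier → Carrier
  abs x = x ⊔ (- x)

  fromℕ : ℕ → Carrier
  fromℕ n = n · 1#

  x<0⇒0<-x : ∀ {x} → x < 0# → 0# < - x
  x<0⇒0<-x {x} x<0 =
    <.<-respʳ-≈ (+-identityˡ (- x)) (<.<-respˡ-≈ (-‿inverseʳ x) (+-monoˡ-< (- x) x<0))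

  1#0 : 1# # 0#
  1#0 = invertible⇒# (1# , trans (*-identityˡ (1# - 0#)) 1-0≈1
                         , trans (*-identityʳ (1# - 0#)) 1-0≈1)
    where
    1-0≈1 : 1# - 0# ≈ 1#
    1-0≈1 = trans (+-cong refl -0#≈0#) (+-identityʳ 1#)

  0<1 : 0# < 1#
  0<1 with #⇒<⊎> 1#0
  ... | inj₂ 0<1 = 0<1
  ... | inj₁ 1<0 =
    <.<-respʳ-≈ (trans (-1*x≈-x (- 1#)) (-‿involutive 1#))
      (*-pos (x<0⇒0<-x 1<0) (x<0⇒0<-x 1<0))

  fromℕ-pos : ∀ n → 0# < fromℕ (suc n)
  fromℕ-pos zero    = <.<-respʳ-≈ (sym (+-identityʳ 1#)) 0<1
  fromℕ-pos (suc n) = <.trans (fromℕ-pos n)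
    (<.<-respˡ-≈ (+-identityˡ (fromℕ (suc n))) (+-monoˡ-< (fromℕ (suc n)) 0<1))

  infixl 7 _/ℕ_

  -- Division by 0 has the junk value 0.
  _/ℕ_ : Carrier → ℕ → Carrier
  x /ℕ zero  = 0#
  x /ℕ suc d = x * proj₁ (#⇒invertible (#-sym (<⇒# (fromℕ-pos d))))

-- The real numbers, axiomatised as an Archimedean, Cauchy complete ordered
-- field.  Under classical logic these axioms determine ℝ up to unique
-- isomorphism.  The square roots of nonnegative numbers are determined by the
-- other fields and could be constructed from them.

record Reals (c ℓ₁ ℓ₂ : Level) : Set (sucℓ (c ⊔ℓ ℓ₁ ⊔ℓ ℓ₂)) where
  infix 8 √_

  field
    orderedField : OrderedField c ℓ₁ ℓ₂

  open OrderedField orderedField public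

  field
    archimedean : ∀ x → ∃[ n ] x < fromℕ n
    complete    :
      (a : ℕ → Carrier) →
      (∀ ε → 0# < ε → ∃[ K ] ∀ m n → K ℕ.≤ m → K ℕ.≤ n → abs (a m - a n) < ε) →
      ∃[ x ] ∀ ε → 0# < ε → ∃[ K ] ∀ n → K ℕ.≤ n → abs (a n - x) < ε

    -- Only the values on nonnegative arguments are specified.
    √_    : Carrier → Carrier
    √-≥0  : ∀ {x} → 0# ≤ x → 0# ≤ √ x
    √-*-√ : ∀ {x} → 0# ≤ x → √ x * √ x ≈ x

-- Finite simplicial complexes; the ambient set Fin N may contain points which
-- are not vertices.

record Complex (N : ℕ) : Set₁ where
  field
    Simplex  : Pred (Subset N) 0ℓ
    simplex? : Decidable Simplex
    ∅-simplex : Simplex ⊥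
    ⊆-closed : ∀ {τ σ} → τ ⊆ σ → Simplex σ → Simplex τ

open Complex public

subsets : ∀ N → List (Subset N)
subsets zero    = Vec.[] ∷ []
subsets (suc N) = List.map (inside Vec.∷_) (subsets N) ++ List.map (outside Vec.∷_) (subsets N)

count : ∀ {N} {P : Pred (Subset N) 0ℓ} → Decidable P → ℕ
count {N} P? = length (filter P? (subsets N))

module _ {N : ℕ} (X : Complex N) where

  -- Simplices are indexed by their number of vertices, which may be 0:
  -- X(k) is Sized (k + 1).
  Sized : ℕ → Pred (Subset N) 0ℓ
  Sized s σ = Simplex X σ × ∣ σ ∣ ≡ s

  sized? : ∀ s → Decidable (Sized s)
  sized? s σ = simplex? X σ ×-dec (∣ σ ∣ ℕ.≟ s)

  -- The size condition on τ ∪ η makes τ and η disjoint.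
  Link : Subset N → ℕ → Pred (Subset N) 0ℓ
  Link τ s η = Sized s η × Sized (∣ τ ∣ ℕ+ s) (τ ∪ η)

  link? : ∀ τ s → Decidable (Link τ s)
  link? τ s η = sized? s η ×-dec sized? (∣ τ ∣ ℕ+ s) (τ ∪ η)

  LinkVertex : Subset N → Pred (Fin N) 0ℓ
  LinkVertex τ v = Link τ 1 ⁅ v ⁆

  LinkEdge : Subset N → Rel (Fin N) 0ℓ
  LinkEdge τ u v = Link τ 2 (⁅ u ⁆ ∪ ⁅ v ⁆)

  Vertex : Pred (Fin N) 0ℓ
  Vertex v = Sized 1 ⁅ v ⁆

  Pure : ℕ → Set
  Pure n = ∀ τ → Simplex X τ → ∃[ σ ] Sized (suc n) σ × τ ⊆ σ

  -- dim τ ≤ n - 2 means that τ has fewer than n vertices.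
  ConnectedLinks : ℕ → Set
  ConnectedLinks n =
    ∀ τ → Simplex X τ → ∣ τ ∣ ℕ.< n →
    ∀ u v → LinkVertex τ u → LinkVertex τ v → Star (LinkEdge τ) u v

  topDegree : ℕ → Subset N → ℕ
  topDegree n τ = count (λ σ → sized? (suc n) σ ×-dec (τ ⊆? σ))

  -- The homogeneous weight: for dim τ = k, n - k = n + 1 - ∣ τ ∣.
  weight : ℕ → Subset N → ℕ
  weight n τ = (suc n ∸ ∣ τ ∣) ! ℕ* topDegree n τ

  record Partite (n : ℕ) (S : Fin (suc n) → Subset N) : Set where
    field
      sides-⊆       : ∀ i v → v ∈ S i → Vertex v
      sides-disjoint : ∀ i j → i ≢ j → Empty (S i ∩ S j)
      sides-cover   : ∀ v → Vertex v → ∃[ i ] v ∈ S i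
      transversal   : ∀ σ → Sized (suc n) σ → ∀ i → ∣ σ ∩ S i ∣ ≡ 1

  PartiteRegular : (n : ℕ) → (Fin (suc n) → Subset N) → Set
  PartiteRegular n S = ∀ i → ∃[ K ] ∀ v → v ∈ S i → topDegree n ⁅ v ⁆ ≡ K

  topCount : ℕ → ℕ
  topCount n = count (sized? (suc n))

  -- ∣X(U₀,…,Uₙ)∣
  transversalCount : (n : ℕ) → (Fin (suc n) → Subset N) → ℕ
  transversalCount n U =
    count (λ σ → sized? (suc n) σ ×-dec Fin.all? (λ i → ∣ σ ∩ U i ∣ ℕ.≟ 1))

∏∣_∣ : ∀ {N m} → (Fin m → Subset N) → ℕ
∏∣ U ∣ = product (List.tabulate (λ i → ∣ U i ∣))

module _ {c ℓ₁ ℓ₂} (ℝ : Reals c ℓ₁ ℓ₂) where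
  open Reals ℝ

  module _ {N : ℕ} (X : Complex N) (n : ℕ) (τ : Subset N) where

    -- (M')⁺_{τ,0}.  A function on the vertices of the link of τ is represented
    -- by a function on Fin N, of which only the values at these vertices matter.
    -- The denominator is positive when v is such a vertex and X is pure.
    walk : (Fin N → Carrier) → Fin N → Carrier
    walk φ v = sum λ u →
      if does (link? X τ 2 (⁅ u ⁆ ∪ ⁅ v ⁆))
      then fromℕ (weight X n (τ ∪ (⁅ u ⁆ ∪ ⁅ v ⁆))) /ℕ weight X n (τ ∪ ⁅ v ⁆) * φ u
      else 0#

    Spectrum : Pred Carrier (c ⊔ℓ ℓ₁ ⊔ℓ ℓ₂)
    Spectrum μ = ∃[ φ ]
      (∃[ v ] LinkVertex X τ v × φ v # 0#) ×
      (∀ v → LinkVertex X τ v → walk φ v ≈ μ * φ v)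

  LocalSpectralBound : ∀ {N} → Complex N → ℕ → Carrier → Set (c ⊔ℓ ℓ₁ ⊔ℓ ℓ₂)
  LocalSpectralBound X n λ′ =
    ∀ τ → Simplex X τ → ∣ τ ∣ ℕ.< n →
    ∀ μ → Spectrum X n τ μ → ((- 1# ≤ μ) × (μ ≤ λ′)) ⊎ μ ≈ 1#

  -- All truncated subtractions are exact, since k < n.
  mixingConstant : ℕ → Carrier
  mixingConstant n = sum {n} λ i → let k = toℕ i in
    fromℕ (n !)
    * (fromℕ ((suc n ∸ k) ^ (n ∸ k)) /ℕ ((n ∸ suc k) !))
    * (fromℕ (suc k ℕ* (suc (suc k)) ^ (n ∸ k)) - fromℕ (suc k ^ suc (n ∸ k)))

  -- The minimum of f i j over 0 ≤ i < j ≤ n.  The fold starts from the value at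
  -- (0 , 1), which is one of these pairs.
  minPairs : ∀ n → .{{_ : NonZero n}} → (Fin (suc n) → Fin (suc n) → Carrier) → Carrier
  minPairs n@(suc _) f = foldr _⊓_ (f 0F 1F)
    (List.map (uncurry f)
      (filter (λ (i , j) → i Fin.<? j) (cartesianProduct (allFin (suc n)) (allFin (suc n)))))

{-# OPTIONS --safe #-}

-- Write E for the average over the top simplices and u k for the indicator function of
-- U k on the vertex x k of side k.  Partite regularity makes x k uniform on S k, so the
-- claim compares E[∏ u k] with ∏ E[u k]; the product is split off one factor at a time,
-- starting with side i and ending with side j for the bound by √(p i * p j).
--
-- The error of one step is the correlation of a centred function of x k with a function
-- of the remaining vertices.  Conditioning on these one after another, it becomes a sum
-- of at most n correlations between functions of two vertices in links.  A function on
-- two sides of a link of dimension d, centred on both, is orthogonal to the constants,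
-- and its quadratic form under the walk is the correlation of its two parts divided
-- by d; so the spectral gap bounds that correlation by d λ ≤ n λ.  The total is n³ λ,
-- and n³ is below the term k = 0 of the mixing constant.
--
-- The hypothesis concerns eigenvalues, whereas the argument uses quadratic forms.  The
-- forms s D + C in question have integer D and C, so Gaussian elimination decides for
-- rational s whether they are positive semidefinite.  This makes the critical value of s
-- a limit of a computable sequence, and the form at that value has a null vector, which
-- is an eigenvector.  Order being defined by negation, classical reasoning is available
-- in each of the finitely many sign decisions this last step takes.

module Submission where

open import Defs
open import Algebra.Bundles using (CommutativeRing)
open import Algebra.Solver.Ring.AlmostCommutativeRing
  using (fromCommutativeRing; _-Raw-AlmostCommutative⟶_)
import Algebra.Solver.Ring
open import Data.Bool.Base using (true; false; if_then_else_)
open import Data.Unit.Base using (⊤; tt)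
open import Data.Empty using (⊥; ⊥-elim)
open import Data.Fin.Base as Fin using (Fin; zero; suc; toℕ)
import Data.Fin.Properties as Fin
open import Data.Fin.Subset as Subset using (Subset; _∈_; _∉_; _⊆_; ∣_∣; ⁅_⁆; _∪_; _∩_)
import Data.Fin.Subset.Properties as Subset
open import Data.Integer.Base as ℤ using (ℤ; +_; -[1+_])
import Data.Integer.Properties as ℤ
open import Data.List.Base as List using (List; []; _∷_; _++_; length; filter)
import Data.List.Properties as List
import Data.List.Membership.Propositional as List
import Data.List.Membership.Propositional.Properties as List
import Data.List.Relation.Unary.All as All
import Data.List.Relation.Unary.All.Properties as List
open import Data.List.Relation.Binary.Permutation.Propositional as ↭ using (_↭_)
import Data.List.Relation.Binary.Permutation.Propositional.Properties as ↭
import Data.List.Relation.Binary.Permutation.Setoid.Properties as SetoidPermutation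
open import Data.List.Relation.Unary.Unique.Propositional using (Unique)
import Data.List.Relation.Unary.AllPairs as AllPairs
open import Data.List.Relation.Unary.Any as Any using (here; there)
open import Data.Maybe.Base using (Maybe; just; nothing)
open import Data.Nat.ListAction using (product)
open import Data.Nat.Base as ℕ using (ℕ; zero; suc; NonZero; _!)
import Data.Nat.Properties as ℕ
open import Data.Product.Base using (_×_; _,_; proj₁; proj₂; ∃-syntax)
open import Data.Sum.Base using (_⊎_; inj₁; inj₂; [_,_]′)
import Data.List.Relation.Unary.Any.Properties as Any
import Data.List.Relation.Unary.Unique.Propositional.Properties as Unique
import Data.Vec.Base as Vec
open import Function.Base using (_∘_; case_of_)
open import Level using (0ℓ; Lift; lift) renaming (_⊔_ to _⊔ℓ_)
open import Relation.Binary.Construct.Closure.ReflexiveTransitive as Star using (Star)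
open import Relation.Binary.Bundles using (Poset)
import Relation.Binary.Reasoning.PartialOrder
import Relation.Binary.Reasoning.Setoid
open import Relation.Binary.PropositionalEquality as ≡ using (_≡_; _≢_)
open import Relation.Binary.Structures using (IsStrictPartialOrder)
open import Relation.Nullary.Decidable using (Dec; yes; no; does; _×-dec_; ¬?)
open import Relation.Nullary.Negation using (¬_; contradiction)

-- Constructively the sign of a real cannot be decided, so diagonalising the walk is not an option.
-- But the gap is an inequality, that is a negation: it is enough to refute its failure at one
-- function, and a single eigenvector does that.
--
-- Correlations are bounded in the shape 2⟨HG⟩ ≤ C(⟨H²⟩ + ⟨G²⟩) rather than as in Cauchy-Schwarz.
-- This shape adds up over the vertices on which one conditions, and centring a function or
-- replacing it by a conditional mean can only lower its right side. Products of norms return at the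
-- very end, by scaling H and G; since the scalars may have either sign, an upper bound on the
-- spectrum controls the correlation in both directions.
--
-- The order of the sides produces √(p i * p j). The first step removes `u i`, whose variance is at
-- most `p i`, from a product of indicators that is at most its last factor `u j`. Every later error
-- still contains `u j` and is multiplied by `p i`, which is at most √(p i).

-- Ordered fields: order, finite sums, integers, products

module OrderedFieldProperties {c ℓ₁ ℓ₂} (F : OrderedField c ℓ₁ ℓ₂) where
  open OrderedField F public hiding (zero)
  open CommutativeRing commutativeRing public using (semiring)
  open import Algebra.Apartness.Properties.HeytingCommutativeRing heytingCommutativeRing public
    using (x-0≈x)
  open import Algebra.Properties.Ring ring public using (-‿distribˡ-*; -‿distribʳ-*)
  open import Algebra.Properties.AbelianGroup
    (CommutativeRing.+-abelianGroup commutativeRing) public using (⁻¹-∙-comm)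
  open import Algebra.Properties.Semiring.Mult semiring
    using (×-homo-+; ×1-homo-*)
  open import Algebra.Properties.Semiring.Sum semiring public
    using (sum-replicate-zero; ∑-distrib-+; ∑-comm; *-distribˡ-sum; *-distribʳ-sum)

  module ≈-Reasoning = Relation.Binary.Reasoning.Setoid setoid

  private module < = IsStrictPartialOrder isStrictPartialOrder

  infix 4 _≥0
  _≥0 : Carrier → Set _
  x ≥0 = 0# ≤ x

  fromℕ-+ : ∀ m n → fromℕ (m ℕ.+ n) ≈ fromℕ m + fromℕ n
  fromℕ-+ = ×-homo-+ 1#

  fromℕ-* : ∀ m n → fromℕ (m ℕ.* n) ≈ fromℕ m * fromℕ n
  fromℕ-* = ×1-homo-*

  fromℤ : ℤ → Carrier
  fromℤ (+ n)    = fromℕ n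
  fromℤ -[1+ n ] = - fromℕ (suc n)

  -- Agrees with fromℤ, but sends 1 to 1# itself, so that 1# can be written as a
  -- constant in the ring solver.
  ⟦_⟧ℤ : ℤ → Carrier
  ⟦ + 1 ⟧ℤ      = 1#
  ⟦ -[1+ 0 ] ⟧ℤ = - 1#
  ⟦ z ⟧ℤ        = fromℤ z

  private
    1≈ : 1# ≈ fromℕ 1
    1≈ = sym (+-identityʳ 1#)

  ⟦⟧≈fromℤ : ∀ z → ⟦ z ⟧ℤ ≈ fromℤ z
  ⟦⟧≈fromℤ (+ 0)           = refl
  ⟦⟧≈fromℤ (+ 1)           = 1≈
  ⟦⟧≈fromℤ (+ suc (suc n)) = refl
  ⟦⟧≈fromℤ -[1+ 0 ]        = -‿cong 1≈
  ⟦⟧≈fromℤ -[1+ suc n ]    = refl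

  module _ where
    open ≈-Reasoning
    open import Algebra.Properties.AbelianGroup
      (CommutativeRing.+-abelianGroup commutativeRing) using (ε⁻¹≈ε; ⁻¹-involutive)

    fromℤ-⊖ : ∀ m n → fromℤ (m ℤ.⊖ n) ≈ fromℕ m - fromℕ n
    fromℤ-⊖ m zero = sym (x-0≈x (fromℕ m))
    fromℤ-⊖ zero (suc n) = sym (+-identityˡ _)
    fromℤ-⊖ (suc m) (suc n) = begin
      fromℤ (suc m ℤ.⊖ suc n)          ≡⟨ ≡.cong fromℤ (ℤ.[1+m]⊖[1+n]≡m⊖n m n) ⟩
      fromℤ (m ℤ.⊖ n)                  ≈⟨ fromℤ-⊖ m n ⟩
      fromℕ m - fromℕ n                ≈⟨ +-congʳ (+-identityˡ _) ⟨
      0# + fromℕ m - fromℕ n           ≈⟨ +-congʳ (+-congʳ (-‿inverseʳ 1#)) ⟨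
      1# - 1# + fromℕ m - fromℕ n      ≈⟨ +-congʳ (+-assoc _ _ _) ⟩
      1# + (- 1# + fromℕ m) - fromℕ n  ≈⟨ +-congʳ (+-congˡ (+-comm _ _)) ⟩
      1# + (fromℕ m - 1#) - fromℕ n    ≈⟨ +-congʳ (+-assoc _ _ _) ⟨
      1# + fromℕ m - 1# - fromℕ n      ≈⟨ +-assoc _ _ _ ⟩
      1# + fromℕ m + (- 1# - fromℕ n)  ≈⟨ +-congˡ (⁻¹-∙-comm _ _) ⟩
      fromℕ (suc m) - fromℕ (suc n)    ∎

    fromℤ-+ : ∀ i j → fromℤ (i ℤ.+ j) ≈ fromℤ i + fromℤ j
    fromℤ-+ (+ m) (+ n) = fromℕ-+ m n
    fromℤ-+ (+ m) -[1+ n ] = fromℤ-⊖ m (suc n)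
    fromℤ-+ -[1+ m ] (+ n) = trans (fromℤ-⊖ n (suc m)) (+-comm _ _)
    fromℤ-+ -[1+ m ] -[1+ n ] = begin
      - fromℕ (suc (suc (m ℕ.+ n)))    ≡⟨ ≡.cong (λ k → - fromℕ (suc k)) (≡.sym (ℕ.+-suc m n)) ⟩
      - fromℕ (suc m ℕ.+ suc n)        ≈⟨ -‿cong (fromℕ-+ (suc m) (suc n)) ⟩
      - (fromℕ (suc m) + fromℕ (suc n)) ≈⟨ ⁻¹-∙-comm _ _ ⟨
      - fromℕ (suc m) - fromℕ (suc n)  ∎

    fromℤ-neg : ∀ i → fromℤ (ℤ.- i) ≈ - fromℤ i
    fromℤ-neg (+ 0)       = sym ε⁻¹≈ε
    fromℤ-neg (+ suc n)   = refl
    fromℤ-neg -[1+ n ]    = sym (⁻¹-involutive _)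

    private
      fromℤ-neg-+* : ∀ m n → fromℤ (ℤ.- (+ m) ℤ.* + n) ≈ - fromℕ m * fromℕ n
      fromℤ-neg-+* m n = begin
        fromℤ (ℤ.- (+ m) ℤ.* + n)      ≡⟨ ≡.cong fromℤ (ℤ.neg-distribˡ-* (+ m) (+ n)) ⟨
        fromℤ (ℤ.- (+ m ℤ.* + n))      ≈⟨ fromℤ-neg (+ m ℤ.* + n) ⟩
        - fromℤ (+ m ℤ.* + n)          ≡⟨ ≡.cong (λ z → - fromℤ z) (ℤ.pos-* m n) ⟨
        - fromℕ (m ℕ.* n)              ≈⟨ -‿cong (fromℕ-* m n) ⟩
        - (fromℕ m * fromℕ n)          ≈⟨ -‿distribˡ-* _ _ ⟩
        - fromℕ m * fromℕ n            ∎

    fromℤ-* : ∀ i j → fromℤ (i ℤ.* j) ≈ fromℤ i * fromℤ j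
    fromℤ-* (+ m) (+ n) = trans (reflexive (≡.cong fromℤ (≡.sym (ℤ.pos-* m n)))) (fromℕ-* m n)
    fromℤ-* -[1+ m ] (+ n) = fromℤ-neg-+* (suc m) n
    fromℤ-* (+ m) -[1+ n ] = begin
      fromℤ (+ m ℤ.* -[1+ n ])  ≡⟨ ≡.cong fromℤ (ℤ.*-comm (+ m) -[1+ n ]) ⟩
      fromℤ (-[1+ n ] ℤ.* + m)  ≈⟨ fromℤ-neg-+* (suc n) m ⟩
      - fromℕ (suc n) * fromℕ m ≈⟨ *-comm _ _ ⟩
      fromℕ m * - fromℕ (suc n) ∎
    fromℤ-* -[1+ m ] -[1+ n ] = begin
      fromℕ (suc m ℕ.* suc n)            ≈⟨ fromℕ-* (suc m) (suc n) ⟩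
      fromℕ (suc m) * fromℕ (suc n)      ≈⟨ ⁻¹-involutive _ ⟨
      - (- (fromℕ (suc m) * fromℕ (suc n))) ≈⟨ -‿cong (-‿distribʳ-* _ _) ⟩
      - (fromℕ (suc m) * - fromℕ (suc n)) ≈⟨ -‿distribˡ-* _ _ ⟩
      - fromℕ (suc m) * - fromℕ (suc n)  ∎

  private
    almostCommutativeRing = fromCommutativeRing commutativeRing

    -- Integer coefficients have decidable equality, which lets the ring solver cancel terms;
    -- equality in the field itself is not decidable.
    ℤ⟶F : ℤ.+-*-rawRing -Raw-AlmostCommutative⟶ almostCommutativeRing
    ℤ⟶F = record
      { ⟦_⟧    = ⟦_⟧ℤ
      ; +-homo = λ i j → trans (⟦⟧≈fromℤ (i ℤ.+ j)) (trans (fromℤ-+ i j)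
                   (sym (+-cong (⟦⟧≈fromℤ i) (⟦⟧≈fromℤ j))))
      ; *-homo = λ i j → trans (⟦⟧≈fromℤ (i ℤ.* j)) (trans (fromℤ-* i j)
                   (sym (*-cong (⟦⟧≈fromℤ i) (⟦⟧≈fromℤ j))))
      ; -‿homo = λ i → trans (⟦⟧≈fromℤ (ℤ.- i)) (trans (fromℤ-neg i)
                   (sym (-‿cong (⟦⟧≈fromℤ i))))
      ; 0-homo = refl
      ; 1-homo = refl
      }

    coefficient≟ : ∀ i j → Maybe (⟦ i ⟧ℤ ≈ ⟦ j ⟧ℤ)
    coefficient≟ i j with i ℤ.≟ j
    ... | yes i≡j = just (reflexive (≡.cong ⟦_⟧ℤ i≡j))
    ... | no _    = nothing

  open Algebra.Solver.Ring ℤ.+-*-rawRing almostCommutativeRing ℤ⟶F coefficient≟ public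
    using (solve; _:=_; _:+_; _:*_; _:-_; :-_; con)

  -- Order

  ≤-refl : ∀ {x} → x ≤ x
  ≤-refl x<x = <.irrefl refl x<x

  <-trans : ∀ {x y z} → x < y → y < z → x < z
  <-trans = <.trans

  <-respʳ : ∀ {x y z} → y ≈ z → x < y → x < z
  <-respʳ = <.<-respʳ-≈

  <-respˡ : ∀ {x y z} → x ≈ y → x < z → y < z
  <-respˡ = <.<-respˡ-≈

  ≤-reflexive : ∀ {x y} → x ≈ y → x ≤ y
  ≤-reflexive x≈y y<x = <.irrefl (sym x≈y) y<x

  <⇒≤ : ∀ {x y} → x < y → x ≤ y
  <⇒≤ x<y y<x = ≤-refl (<-trans x<y y<x)

  -- The constructive substitute for a total order: apartness is cotransitive, and each apartness
  -- resolves into one of two strict inequalities.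
  <-cotrans : ∀ {x y} → x < y → ∀ z → x < z ⊎ z < y
  <-cotrans x<y z with #-cotrans (<⇒# x<y) z
  ... | inj₁ x#z with #⇒<⊎> x#z
  ...   | inj₁ x<z = inj₁ x<z
  ...   | inj₂ z<x = inj₂ (<-trans z<x x<y)
  <-cotrans x<y z | inj₂ z#y with #⇒<⊎> z#y
  ...   | inj₁ z<y = inj₂ z<y
  ...   | inj₂ y<z = inj₁ (<-trans x<y y<z)

  <-≤-trans : ∀ {x y z} → x < y → y ≤ z → x < z
  <-≤-trans {z = z} x<y y≤z with <-cotrans x<y z
  ... | inj₁ x<z = x<z
  ... | inj₂ z<y = contradiction z<y y≤z

  ≤-<-trans : ∀ {x y z} → x ≤ y → y < z → x < z
  ≤-<-trans {x} x≤y y<z with <-cotrans y<z x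
  ... | inj₁ y<x = contradiction y<x x≤y
  ... | inj₂ x<z = x<z

  ≤-trans : ∀ {x y z} → x ≤ y → y ≤ z → x ≤ z
  ≤-trans x≤y y≤z z<x = y≤z (<-≤-trans z<x x≤y)

  ≤-antisym : ∀ {x y} → x ≤ y → y ≤ x → x ≈ y
  ≤-antisym {x} {y} x≤y y≤x = proj₁ (tight x y) λ x#y → case #⇒<⊎> x#y of λ where
    (inj₁ x<y) → y≤x x<y
    (inj₂ y<x) → x≤y y<x

  poset : Poset _ _ _
  poset = record
    { isPartialOrder = record
        { isPreorder = record
            { isEquivalence = isEquivalence
            ; reflexive     = ≤-reflexive
            ; trans         = ≤-trans
            }
        ; antisym = ≤-antisym
        }
    }

  module ≤-Reasoning = Relation.Binary.Reasoning.PartialOrder poset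

  -- Every inequality x ≤ y is a negation, so it may be proved by this case distinction.
  trichotomy : ∀ x y → ¬ ¬ (x < y ⊎ x ≈ y ⊎ y < x)
  trichotomy x y k =
    k (inj₂ (inj₁ (≤-antisym (k ∘ inj₂ ∘ inj₂) (k ∘ inj₁))))

  x-y≥0⇒y≤x : ∀ {x y} → x - y ≥0 → y ≤ x
  x-y≥0⇒y≤x {x} {y} p x<y =
    p (<-respʳ (-‿inverseʳ y) (+-monoˡ-< (- y) x<y))

  y≤x⇒x-y≥0 : ∀ {x y} → y ≤ x → x - y ≥0
  y≤x⇒x-y≥0 {x} {y} y≤x p = y≤x (<-respˡ
    (solve 2 (λ x y → x :- y :+ y := x) refl x y) (<-respʳ (+-identityˡ y) (+-monoˡ-< y p)))

  y<x⇒0<x-y : ∀ {x y} → y < x → 0# < x - y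
  y<x⇒0<x-y {x} {y} y<x = <-respˡ (-‿inverseʳ y) (+-monoˡ-< (- y) y<x)

  0<x-y⇒y<x : ∀ {x y} → 0# < x - y → y < x
  0<x-y⇒y<x {x} {y} p = <-respʳ
    (solve 2 (λ x y → x :- y :+ y := x) refl x y) (<-respˡ (+-identityˡ y) (+-monoˡ-< y p))

  +-mono-< : ∀ {x y u v} → x < y → u < v → x + u < y + v
  +-mono-< {x} {y} {u} {v} x<y u<v = <-trans (+-monoˡ-< u x<y)
    (<-respˡ (+-comm u y) (<-respʳ (+-comm v y) (+-monoˡ-< y u<v)))

  +-≥0 : ∀ {x y} → x ≥0 → y ≥0 → x + y ≥0
  +-≥0 {x} {y} x≥0 y≥0 x+y<0 = y≥0 (≤-<-trans
    (x-y≥0⇒y≤x (≤-trans x≥0 (≤-reflexive (solve 2 (λ x y → x := x :+ y :- y) refl x y)))) x+y<0)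

  +-mono-≤ : ∀ {x y u v} → x ≤ y → u ≤ v → x + u ≤ y + v
  +-mono-≤ {x} {y} {u} {v} x≤y u≤v = x-y≥0⇒y≤x (≤-trans
    (+-≥0 (y≤x⇒x-y≥0 x≤y) (y≤x⇒x-y≥0 u≤v))
    (≤-reflexive (solve 4 (λ x y u v → y :- x :+ (v :- u) := y :+ v :- (x :+ u)) refl x y u v)))

  0<⇒# : ∀ {x} → 0# < x → x # 0#
  0<⇒# 0<x = #-sym (<⇒# 0<x)

  reciprocal : ∀ {x} → x # 0# → ∃[ y ] x * y ≈ 1#
  reciprocal {x} x#0 with #⇒invertible x#0
  ... | y , _ , p = y , trans (*-congʳ (sym (x-0≈x x))) p

  *-≥0 : ∀ {x y} → x ≥0 → y ≥0 → x * y ≥0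
  *-≥0 {x} {y} x≥0 y≥0 xy<0 = trichotomy 0# x λ where
    (inj₂ (inj₂ x<0)) → x≥0 x<0
    (inj₂ (inj₁ 0≈x)) → <.irrefl (trans (*-congʳ (sym 0≈x)) (zeroˡ y)) xy<0
    (inj₁ 0<x) → trichotomy 0# y λ where
      (inj₂ (inj₂ y<0)) → y≥0 y<0
      (inj₂ (inj₁ 0≈y)) → <.irrefl (trans (*-congˡ (sym 0≈y)) (zeroʳ x)) xy<0
      (inj₁ 0<y) → <.asym (*-pos 0<x 0<y) xy<0

  square-≥0 : ∀ x → x * x ≥0
  square-≥0 x xx<0 = trichotomy 0# x λ where
    (inj₁ 0<x) → *-≥0 (<⇒≤ 0<x) (<⇒≤ 0<x) xx<0
    (inj₂ (inj₁ 0≈x)) → <.irrefl (trans (*-congʳ (sym 0≈x)) (zeroˡ x)) xx<0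
    (inj₂ (inj₂ x<0)) → <.asym (*-pos (x<0⇒0<-x x<0) (x<0⇒0<-x x<0))
      (<-respˡ (solve 1 (λ x → x :* x := :- x :* :- x) refl x) xx<0)

  #0⇒0<square : ∀ {x} → x # 0# → 0# < x * x
  #0⇒0<square {x} x#0 with #⇒<⊎> x#0
  ... | inj₂ 0<x = *-pos 0<x 0<x
  ... | inj₁ x<0 = <-respʳ (solve 1 (λ x → :- x :* :- x := x :* x) refl x)
    (*-pos (x<0⇒0<-x x<0) (x<0⇒0<-x x<0))

  *-monoˡ-≤ : ∀ {z} → z ≥0 → ∀ {x y} → x ≤ y → z * x ≤ z * y
  *-monoˡ-≤ {z} z≥0 {x} {y} x≤y = x-y≥0⇒y≤x (≤-trans (*-≥0 z≥0 (y≤x⇒x-y≥0 x≤y))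
    (≤-reflexive (solve 3 (λ x y z → z :* (y :- x) := z :* y :- z :* x) refl x y z)))

  *-monoʳ-≤ : ∀ {z} → z ≥0 → ∀ {x y} → x ≤ y → x * z ≤ y * z
  *-monoʳ-≤ {z} z≥0 {x} {y} x≤y = ≤-trans (≤-reflexive (*-comm x z))
    (≤-trans (*-monoˡ-≤ z≥0 x≤y) (≤-reflexive (*-comm z y)))

  *-monoˡ-< : ∀ {z} → 0# < z → ∀ {x y} → x < y → z * x < z * y
  *-monoˡ-< {z} 0<z {x} {y} x<y = 0<x-y⇒y<x (<-respʳ
    (solve 3 (λ x y z → z :* (y :- x) := z :* y :- z :* x) refl x y z)
    (*-pos 0<z (y<x⇒0<x-y x<y)))

  *-cancelˡ-≤ : ∀ {z x y} → 0# < z → z * x ≤ z * y → x ≤ y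
  *-cancelˡ-≤ 0<z zx≤zy y<x = zx≤zy (*-monoˡ-< 0<z y<x)

  *-cancelˡ-≈ : ∀ {z x y} → 0# < z → z * x ≈ z * y → x ≈ y
  *-cancelˡ-≈ 0<z e =
    ≤-antisym (*-cancelˡ-≤ 0<z (≤-reflexive e)) (*-cancelˡ-≤ 0<z (≤-reflexive (sym e)))

  -- A positive product is invertible, and `x` times its inverse inverts `y`. So `y` is apart from
  -- zero, and a negative `y` would make the product nonpositive.
  *-cancelˡ-pos : ∀ {x y} → x ≥0 → 0# < x * y → 0# < y
  *-cancelˡ-pos {x} {y} x≥0 0<xy with #⇒<⊎> y#0
    where
    y#0 : y # 0#
    y#0 with #⇒invertible (0<⇒# 0<xy)
    ... | w , _ , p = invertible⇒# (x * w , trans (*-comm _ _) eq , eq)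
      where
      eq : (y - 0#) * (x * w) ≈ 1#
      eq = trans (solve 3 (λ x y w → (y :- con (+ 0)) :* (x :* w) := (x :* y :- con (+ 0)) :* w)
                   refl x y w) p
  ... | inj₂ 0<y = 0<y
  ... | inj₁ y<0 = contradiction 0<xy (x-y≥0⇒y≤x (≤-trans
    (*-≥0 x≥0 (<⇒≤ (x<0⇒0<-x y<0)))
    (≤-reflexive (solve 2 (λ x y → x :* :- y := con (+ 0) :- x :* y) refl x y))))

  reciprocal-pos : ∀ {x} → 0# < x → ∃[ y ] 0# < y × x * y ≈ 1#
  reciprocal-pos 0<x with reciprocal (0<⇒# 0<x)
  ... | y , xy≈1 = y , *-cancelˡ-pos (<⇒≤ 0<x) (<-respʳ (sym xy≈1) 0<1) , xy≈1

  0≤1 : 0# ≤ 1#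
  0≤1 = <⇒≤ 0<1

  fromℕ-≥0 : ∀ n → fromℕ n ≥0
  fromℕ-≥0 zero    = ≤-refl
  fromℕ-≥0 (suc n) = <⇒≤ (fromℕ-pos n)

  fromℕ-mono-≤ : ∀ {m n} → m ℕ.≤ n → fromℕ m ≤ fromℕ n
  fromℕ-mono-≤ {n = n} ℕ.z≤n = fromℕ-≥0 n
  fromℕ-mono-≤ (ℕ.s≤s m≤n)   = +-mono-≤ ≤-refl (fromℕ-mono-≤ m≤n)

  fromℕ-cong : ∀ {m n} → m ≡ n → fromℕ m ≈ fromℕ n
  fromℕ-cong = reflexive ∘ ≡.cong fromℕ

  recipℕ : (d : ℕ) → .{{NonZero d}} → Carrier
  recipℕ (suc d) = 1# /ℕ suc d

  /ℕ≈*recip : ∀ x d .{{_ : NonZero d}} → x /ℕ d ≈ x * recipℕ d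
  /ℕ≈*recip x (suc d) = *-congˡ (sym (*-identityˡ _))

  *-recipℕ : ∀ d .{{_ : NonZero d}} → fromℕ d * recipℕ d ≈ 1#
  *-recipℕ (suc d) with #⇒invertible (#-sym (<⇒# (fromℕ-pos d)))
  ... | w , _ , p = trans (*-cong (sym (x-0≈x _)) (*-identityˡ w)) p

  fromℕ-pos′ : ∀ d .{{_ : NonZero d}} → 0# < fromℕ d
  fromℕ-pos′ (suc d) = fromℕ-pos d

  recipℕ-pos : ∀ d .{{_ : NonZero d}} → 0# < recipℕ d
  recipℕ-pos d = *-cancelˡ-pos (fromℕ-≥0 d) (<-respʳ (sym (*-recipℕ d)) 0<1)

  /ℕ-*-cancel : ∀ x d .{{_ : NonZero d}} → fromℕ d * (x /ℕ d) ≈ x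
  /ℕ-*-cancel x d = trans (*-congˡ (/ℕ≈*recip x d)) (trans
    (solve 3 (λ d x r → d :* (x :* r) := x :* (d :* r)) refl (fromℕ d) x (recipℕ d))
    (trans (*-congˡ (*-recipℕ d)) (*-identityʳ x)))

  /ℕ-unique : ∀ {x y} d .{{_ : NonZero d}} → fromℕ d * y ≈ x → x /ℕ d ≈ y
  /ℕ-unique {x} d e = *-cancelˡ-≈ (fromℕ-pos′ d) (trans (/ℕ-*-cancel x d) (sym e))

  /ℕ-≥0 : ∀ {x} d → x ≥0 → x /ℕ d ≥0
  /ℕ-≥0 zero    x≥0 = ≤-refl
  /ℕ-≥0 {x} (suc d) x≥0 =
    ≤-trans (*-≥0 x≥0 (<⇒≤ (recipℕ-pos (suc d)))) (≤-reflexive (sym (/ℕ≈*recip x (suc d))))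

  abs-≤ : ∀ {x y} → x ≤ y → - x ≤ y → abs x ≤ y
  abs-≤ {x} {y} = proj₂ (proj₂ (⊔-supremum x (- x))) y

  x≤abs : ∀ x → x ≤ abs x
  x≤abs x = proj₁ (⊔-supremum x (- x))

  -x≤abs : ∀ x → - x ≤ abs x
  -x≤abs x = proj₁ (proj₂ (⊔-supremum x (- x)))

  square-cancel-≤ : ∀ {x y} → y ≥0 → x * x ≤ y * y → x ≤ y
  square-cancel-≤ {x} {y} y≥0 xx≤yy y<x = xx≤yy (≤-<-trans
    (*-monoˡ-≤ y≥0 (<⇒≤ y<x))
    (<-respˡ (*-comm x y) (*-monoˡ-< (≤-<-trans y≥0 y<x) y<x)))

  2≈ : fromℕ 2 ≈ 1# + 1#
  2≈ = +-congˡ (+-identityʳ 1#)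

  -- Finite sums

  sum-cong : ∀ {n} {f g : Fin n → Carrier} → (∀ i → f i ≈ g i) → sum f ≈ sum g
  sum-cong {zero}  e = refl
  sum-cong {suc n} e = +-cong (e zero) (sum-cong (e ∘ suc))

  sum-zero : ∀ {n} {f : Fin n → Carrier} → (∀ i → f i ≈ 0#) → sum f ≈ 0#
  sum-zero {n} e = trans (sum-cong e) (sum-replicate-zero n)

  sum-≥0 : ∀ {n} {f : Fin n → Carrier} → (∀ i → f i ≥0) → sum f ≥0
  sum-≥0 {zero}  p = ≤-refl
  sum-≥0 {suc n} p = +-≥0 (p zero) (sum-≥0 (p ∘ suc))

  sum-mono-≤ : ∀ {n} {f g : Fin n → Carrier} → (∀ i → f i ≤ g i) → sum f ≤ sum g
  sum-mono-≤ {zero}  p = ≤-refl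
  sum-mono-≤ {suc n} p = +-mono-≤ (p zero) (sum-mono-≤ (p ∘ suc))

  term≤sum : ∀ {n} {f : Fin n → Carrier} → (∀ i → f i ≥0) → ∀ i → f i ≤ sum f
  term≤sum {suc n} {f} p zero = ≤-trans (≤-reflexive (sym (+-identityʳ _)))
    (+-mono-≤ ≤-refl (sum-≥0 (p ∘ suc)))
  term≤sum {suc n} {f} p (suc i) = ≤-trans (≤-reflexive (sym (+-identityˡ _)))
    (+-mono-≤ (p zero) (term≤sum (p ∘ suc) i))

  sum-+ : ∀ {n} (f g : Fin n → Carrier) → sum (λ i → f i + g i) ≈ sum f + sum g
  sum-+ = ∑-distrib-+

  *-sum : ∀ {n} x (f : Fin n → Carrier) → x * sum f ≈ sum (λ i → x * f i)
  *-sum = *-distribˡ-sum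

  sum-* : ∀ {n} x (f : Fin n → Carrier) → sum f * x ≈ sum (λ i → f i * x)
  sum-* = *-distribʳ-sum

  sum-neg : ∀ {n} (f : Fin n → Carrier) → sum (λ i → - f i) ≈ - sum f
  sum-neg f = trans (sum-cong λ i → solve 1 (λ x → :- x := :- con (+ 1) :* x) refl (f i))
    (trans (sym (*-sum (- 1#) f)) (solve 1 (λ x → :- con (+ 1) :* x := :- x) refl (sum f)))

  -- Integers in F

  -- Carrying the integer as a witness makes the sign of such an element decidable; elimination at
  -- rational parameters relies on this.
  IsInteger : Carrier → Set _
  IsInteger x = ∃[ z ] x ≈ fromℤ z

  integer-0 : IsInteger 0#
  integer-0 = + 0 , refl

  integer-1 : IsInteger 1#
  integer-1 = + 1 , 1≈

  integer-fromℕ : ∀ n → IsInteger (fromℕ n)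
  integer-fromℕ n = + n , refl

  integer-+ : ∀ {x y} → IsInteger x → IsInteger y → IsInteger (x + y)
  integer-+ (i , p) (j , q) = i ℤ.+ j , trans (+-cong p q) (sym (fromℤ-+ i j))

  integer-* : ∀ {x y} → IsInteger x → IsInteger y → IsInteger (x * y)
  integer-* (i , p) (j , q) = i ℤ.* j , trans (*-cong p q) (sym (fromℤ-* i j))

  integer-neg : ∀ {x} → IsInteger x → IsInteger (- x)
  integer-neg (i , p) = ℤ.- i , trans (-‿cong p) (sym (fromℤ-neg i))

  integer-sum : ∀ {n} {f : Fin n → Carrier} → (∀ i → IsInteger (f i)) → IsInteger (sum f)
  integer-sum {zero}  p = integer-0
  integer-sum {suc n} p = integer-+ (p zero) (integer-sum (p ∘ suc))

  Trichotomy : Carrier → Set _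
  Trichotomy x = x < 0# ⊎ x ≈ 0# ⊎ 0# < x

  integer-sign : ∀ {x} → IsInteger x → Trichotomy x
  integer-sign (+ 0     , p) = inj₂ (inj₁ p)
  integer-sign (+ suc n , p) = inj₂ (inj₂ (<-respʳ (sym p) (fromℕ-pos n)))
  integer-sign (-[1+ n ] , p) = inj₁ (<-respˡ (sym p) (0<x-y⇒y<x
    (<-respʳ (solve 1 (λ x → x := con (+ 0) :- :- x) refl _) (fromℕ-pos n))))

  ind : ∀ {p} {P : Set p} → Dec P → Carrier
  ind d = if does d then 1# else 0#

  δ : ∀ {n} → Fin n → Fin n → Carrier
  δ i j = ind (i Fin.≟ j)

  sum-δ : ∀ {n} (i : Fin n) (f : Fin n → Carrier) → sum (λ j → δ i j * f j) ≈ f i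
  sum-δ zero    f = trans (+-cong (*-identityˡ _) (sum-zero λ j → zeroˡ (f (suc j)))) (+-identityʳ _)
  sum-δ (suc i) f = trans (+-cong (zeroˡ _) (sum-δ i (f ∘ suc))) (+-identityˡ _)

  integer-≥1 : ∀ {x} → IsInteger x → 0# < x → 1# ≤ x
  integer-≥1 (+ 0     , p) 0<x = contradiction 0<x (≤-reflexive p)
  integer-≥1 (+ suc n , p) 0<x = ≤-trans (≤-reflexive 1≈)
    (≤-trans (fromℕ-mono-≤ {1} {suc n} (ℕ.s≤s ℕ.z≤n)) (≤-reflexive (sym p)))
  integer-≥1 (-[1+ n ] , p) 0<x = contradiction 0<x (≤-trans (≤-reflexive p)
    (x-y≥0⇒y≤x (≤-trans (fromℕ-≥0 (suc n)) (≤-reflexive (solve 1 (λ x → x := con (+ 0) :- :- x) refl _)))))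

  ≤0⇒≈0 : ∀ {x} → x ≥0 → x ≤ 0# → x ≈ 0#
  ≤0⇒≈0 x≥0 x≤0 = ≤-antisym x≤0 x≥0

  square≈0⇒≈0 : ∀ {x} → x * x ≈ 0# → x ≈ 0#
  square≈0⇒≈0 {x} xx≈0 = proj₁ (tight x 0#) λ x#0 → ≤-reflexive xx≈0 (#0⇒0<square x#0)

  δ-subst : ∀ {n} (i j : Fin n) (f : Fin n → Carrier) → δ i j * f i ≈ δ j i * f j
  δ-subst i j f with i Fin.≟ j | j Fin.≟ i
  ... | yes ≡.refl | yes _   = refl
  ... | yes i≡j    | no j≢i  = contradiction (≡.sym i≡j) j≢i
  ... | no i≢j     | yes j≡i = contradiction (≡.sym j≡i) i≢j
  ... | no _       | no _    = trans (zeroˡ _) (sym (zeroˡ _))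

  integer-ind : ∀ {p} {P : Set p} (P? : Dec P) → IsInteger (ind P?)
  integer-ind P? with does P?
  ... | true  = integer-1
  ... | false = integer-0

  ind-yes : ∀ {p} {P : Set p} (P? : Dec P) → P → ind P? ≈ 1#
  ind-yes (yes _) p = refl
  ind-yes (no ¬p) p = contradiction p ¬p

  ind-no : ∀ {p} {P : Set p} (P? : Dec P) → ¬ P → ind P? ≈ 0#
  ind-no (yes p) ¬p = contradiction p ¬p
  ind-no (no _)  ¬p = refl

  ind-≥0 : ∀ {p} {P : Set p} (P? : Dec P) → ind P? ≥0
  ind-≥0 P? with does P?
  ... | true  = 0≤1
  ... | false = ≤-refl

  ind-idem : ∀ {p} {P : Set p} (P? : Dec P) → ind P? * ind P? ≈ ind P?
  ind-idem P? with does P?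
  ... | true  = *-identityˡ 1#
  ... | false = zeroˡ 0#

  ind-cong : ∀ {p q} {P : Set p} {Q : Set q} (P? : Dec P) (Q? : Dec Q) →
             (P → Q) → (Q → P) → ind P? ≈ ind Q?
  ind-cong (yes p) Q? f g = sym (ind-yes Q? (f p))
  ind-cong (no ¬p) Q? f g = sym (ind-no Q? (¬p ∘ g))

  ind-× : ∀ {p q} {P : Set p} {Q : Set q} (P? : Dec P) (Q? : Dec Q) →
          ind (P? ×-dec Q?) ≈ ind P? * ind Q?
  ind-× P? Q? with does P? | does Q?
  ... | true  | true  = sym (*-identityˡ 1#)
  ... | true  | false = sym (zeroʳ 1#)
  ... | false | true  = sym (zeroˡ 1#)
  ... | false | false = sym (zeroˡ 0#)

  -- Products over lists

  prod : ∀ {a} {A : Set a} → (A → Carrier) → List A → Carrier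
  prod g = List.foldr (λ x y → g x * y) 1#

  module _ {a} {A : Set a} where
    prod-cong : ∀ {g h : A → Carrier} → (∀ x → g x ≈ h x) → ∀ xs → prod g xs ≈ prod h xs
    prod-cong e []       = refl
    prod-cong e (x ∷ xs) = *-cong (e x) (prod-cong e xs)

    prod-* : ∀ (g h : A → Carrier) xs → prod (λ x → g x * h x) xs ≈ prod g xs * prod h xs
    prod-* g h []       = sym (*-identityˡ 1#)
    prod-* g h (x ∷ xs) = trans (*-congˡ (prod-* g h xs))
      (solve 4 (λ a b c d → a :* b :* (c :* d) := a :* c :* (b :* d)) refl (g x) (h x) (prod g xs) (prod h xs))

    prod-↭ : ∀ (g : A → Carrier) {xs ys} → xs ↭ ys → prod g xs ≈ prod g ys
    prod-↭ g ↭.refl         = refl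
    prod-↭ g (↭.prep x p)   = *-congˡ (prod-↭ g p)
    prod-↭ g (↭.swap x y p) = trans (*-congˡ (*-congˡ (prod-↭ g p)))
      (solve 3 (λ a b c → a :* (b :* c) := b :* (a :* c)) refl (g x) (g y) _)
    prod-↭ g (↭.trans p q)  = trans (prod-↭ g p) (prod-↭ g q)

    prod-one : ∀ {g : A → Carrier} → (∀ x → g x ≈ 1#) → ∀ xs → prod g xs ≈ 1#
    prod-one e []       = refl
    prod-one e (x ∷ xs) = trans (*-cong (e x) (prod-one e xs)) (*-identityˡ 1#)

    prod-zero : ∀ {g : A → Carrier} {x xs} → x List.∈ xs → g x ≈ 0# → prod g xs ≈ 0#
    prod-zero (here ≡.refl) gx≈0 = trans (*-congʳ gx≈0) (zeroˡ _)
    prod-zero (there x∈xs)  gx≈0 = trans (*-congˡ (prod-zero x∈xs gx≈0)) (zeroʳ _)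

    prod-pos : ∀ {g : A → Carrier} → (∀ x → 0# < g x) → ∀ xs → 0# < prod g xs
    prod-pos p []       = 0<1
    prod-pos p (x ∷ xs) = *-pos (p x) (prod-pos p xs)

    prod-≥0 : ∀ {g : A → Carrier} → (∀ x → g x ≥0) → ∀ xs → prod g xs ≥0
    prod-≥0 p []       = 0≤1
    prod-≥0 p (x ∷ xs) = *-≥0 (p x) (prod-≥0 p xs)

    prod-≤1 : ∀ {g : A → Carrier} → (∀ x → g x ≥0) → (∀ x → g x ≤ 1#) → ∀ xs → prod g xs ≤ 1#
    prod-≤1 p q []       = ≤-refl
    prod-≤1 p q (x ∷ xs) = ≤-trans (*-monoˡ-≤ (p x) (prod-≤1 p q xs)) (≤-trans (≤-reflexive (*-identityʳ _)) (q x))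

    -- For indicators this bounds the mean of a product by the mean of its last factor, which is how
    -- the density of the last side enters the estimate.
    prod-∷ʳ-≤ : ∀ {g : A → Carrier} → (∀ x → g x ≥0) → (∀ x → g x ≤ 1#) → ∀ xs y → prod g (xs ++ y ∷ []) ≤ g y
    prod-∷ʳ-≤ {g} p q []       y = ≤-reflexive (*-identityʳ (g y))
    prod-∷ʳ-≤ {g} p q (x ∷ xs) y = ≤-trans (*-monoʳ-≤ (prod-≥0 p (xs ++ y ∷ [])) (q x))
      (≤-trans (≤-reflexive (*-identityˡ _)) (prod-∷ʳ-≤ p q xs y))

  prod-ind : ∀ {m p} {P : Fin m → Set p} (P? : ∀ k → Dec (P k)) →
             ind (Fin.all? P?) ≈ prod (λ k → ind (P? k)) (List.allFin m)
  prod-ind {m} {P = P} P? = by-cases (Fin.all? P?)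
    where
    by-cases : (d : Dec (∀ k → P k)) → ind d ≈ prod (λ k → ind (P? k)) (List.allFin m)
    by-cases (yes ∀P) = sym (prod-one (λ k → ind-yes (P? k) (∀P k)) (List.allFin m))
    by-cases (no ¬∀P) with Fin.¬∀⟶∃¬ m P P? ¬∀P
    ... | k , ¬Pk = sym (prod-zero (List.∈-allFin k) (ind-no (P? k) ¬Pk))

  fromℕ-product : ∀ {a} {A : Set a} (g : A → ℕ) {m} (h : Fin m → A) →
                  fromℕ (product (List.tabulate (λ k → g (h k)))) ≈ prod (λ x → fromℕ (g x)) (List.tabulate h)
  fromℕ-product g {zero}  h = +-identityʳ 1#
  fromℕ-product g {suc m} h = trans (fromℕ-* (g (h zero)) _) (*-congˡ (fromℕ-product g (h ∘ suc)))

  -- Stands in for taking square roots of P and R to optimise over a and b.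
  amgm⇒square-bound : ∀ {D P R} → P ≥0 → R ≥0 →
                      (∀ a b → (a * b + a * b) * D ≤ a * a * P + b * b * R) → D * D ≤ P * R
  amgm⇒square-bound {D} {P} {R} P≥0 R≥0 p PR<DD = trichotomy 0# P λ where
      (inj₁ 0<P)        → *-cancelˡ-≤ 0<P (x-y≥0⇒y≤x (≤-trans (y≤x⇒x-y≥0 (p D P))
        (≤-reflexive (solve 3 (λ D P R → D :* D :* P :+ P :* P :* R :- (D :* P :+ D :* P) :* D
              := P :* (P :* R) :- P :* (D :* D)) refl D P R)))) PR<DD
      (inj₂ (inj₁ 0≈P)) → ≤-trans (DD≤0 (sym 0≈P)) (*-≥0 P≥0 R≥0) PR<DD
      (inj₂ (inj₂ P<0)) → P≥0 P<0
    where
    -- When `P` vanishes, the choice a = R + 1, b = D leaves (R + 2) D² ≤ 0, and `R` is nonnegative.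
    DD≤0 : P ≈ 0# → D * D ≤ 0#
    DD≤0 P≈0 = ≤-trans
      (x-y≥0⇒y≤x (≤-trans (+-≥0 (square-≥0 D) (*-≥0 (square-≥0 D) R≥0))
        (≤-reflexive (solve 2 (λ D R → D :* D :+ D :* D :* R
          := ((R :+ con (+ 1)) :* D :+ (R :+ con (+ 1)) :* D) :* D :- D :* D :* R :- D :* D) refl D R))))
      (≤-trans (+-mono-≤ (p (R + 1#) D) ≤-refl) (≤-reflexive (trans (+-congʳ (+-congʳ (*-congˡ P≈0)))
        (solve 2 (λ D R → (R :+ con (+ 1)) :* (R :+ con (+ 1)) :* con (+ 0) :+ D :* D :* R :- D :* D :* R
              := con (+ 0)) refl D R))))

  infix 4 _≤±_
  -- Used in place of `abs`: the two halves pass separately through sums and nonnegative multiples,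
  -- and `abs` comes in only for the final discrepancy.
  _≤±_ : Carrier → Carrier → Set _
  x ≤± y = x ≤ y × - x ≤ y

  ≤±-cong : ∀ {x y u} → x ≈ y → y ≤± u → x ≤± u
  ≤±-cong x≈y (p , q) = ≤-trans (≤-reflexive x≈y) p , ≤-trans (≤-reflexive (-‿cong x≈y)) q

  ≤±-trans : ∀ {x y z} → x ≤± y → y ≤ z → x ≤± z
  ≤±-trans (p , q) y≤z = ≤-trans p y≤z , ≤-trans q y≤z

  ≤±-+ : ∀ {x y u v} → x ≤± u → y ≤± v → x + y ≤± u + v
  ≤±-+ {x} {y} (p , q) (r , s) = +-mono-≤ p r
    , ≤-trans (≤-reflexive (sym (⁻¹-∙-comm x y))) (+-mono-≤ q s)

  ≤±-* : ∀ {a x y} → a ≥0 → x ≤± y → a * x ≤± a * y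
  ≤±-* {a} {x} a≥0 (p , q) = *-monoˡ-≤ a≥0 p
    , ≤-trans (≤-reflexive (-‿distribʳ-* a x)) (*-monoˡ-≤ a≥0 q)

  square-bound⇒≤± : ∀ {x y} → y ≥0 → x * x ≤ y * y → x ≤± y
  square-bound⇒≤± {x} y≥0 p = square-cancel-≤ y≥0 p
    , square-cancel-≤ y≥0 (≤-trans (≤-reflexive (solve 1 (λ x → :- x :* :- x := x :* x) refl x)) p)

-- Quadratic forms and division-free elimination

module QuadraticForms {c ℓ₁ ℓ₂} (F : OrderedField c ℓ₁ ℓ₂) where
  open OrderedFieldProperties F
  open import Data.Vec.Functional using () renaming (_∷_ to _▹_)

  Matrix : ℕ → Set c
  Matrix n = Fin n → Fin n → Carrier

  Symmetric : ∀ {n} → Matrix n → Set _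
  Symmetric B = ∀ i j → B i j ≈ B j i

  infix 9 _∙_
  _∙_ : ∀ {n} → (Fin n → Carrier) → (Fin n → Carrier) → Carrier
  x ∙ y = sum λ i → x i * y i

  apply : ∀ {n} → Matrix n → (Fin n → Carrier) → Fin n → Carrier
  apply B x i = B i ∙ x

  Q : ∀ {n} → Matrix n → (Fin n → Carrier) → Carrier
  Q B x = x ∙ apply B x

  PSD : ∀ {n} → Matrix n → Set _
  PSD B = ∀ x → Q B x ≥0

  ∙-congʳ : ∀ {n} (x : Fin n → Carrier) {y z} → (∀ i → y i ≈ z i) → x ∙ y ≈ x ∙ z
  ∙-congʳ x e = sum-cong λ i → *-congˡ (e i)

  ∙-comm : ∀ {n} (x y : Fin n → Carrier) → x ∙ y ≈ y ∙ x
  ∙-comm x y = sum-cong λ i → *-comm (x i) (y i)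

  ∙-scaleʳ : ∀ {n} (x y : Fin n → Carrier) a → x ∙ (λ i → a * y i) ≈ a * x ∙ y
  ∙-scaleʳ x y a = trans
    (sum-cong λ i → solve 3 (λ a x y → x :* (a :* y) := a :* (x :* y)) refl a (x i) (y i))
    (sym (*-sum a (λ i → x i * y i)))

  ∙-+ʳ : ∀ {n} (x y z : Fin n → Carrier) → x ∙ (λ i → y i + z i) ≈ x ∙ y + x ∙ z
  ∙-+ʳ x y z = trans (sum-cong λ i → distribˡ (x i) (y i) (z i))
    (sum-+ (λ i → x i * y i) (λ i → x i * z i))

  ∙-linearˡ : ∀ {n} (x y z : Fin n → Carrier) a b →
              (λ i → a * x i + b * y i) ∙ z ≈ a * x ∙ z + b * y ∙ z
  ∙-linearˡ x y z a b = trans (∙-comm _ z) (trans (∙-+ʳ z _ _)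
    (+-cong (trans (∙-scaleʳ z x a) (*-congˡ (∙-comm z x)))
            (trans (∙-scaleʳ z y b) (*-congˡ (∙-comm z y)))))

  ∙-zeroʳ : ∀ {n} (x y : Fin n → Carrier) → (∀ i → y i ≈ 0#) → x ∙ y ≈ 0#
  ∙-zeroʳ x y e = sum-zero λ i → trans (*-congˡ (e i)) (zeroʳ _)

  ∙-self-≥0 : ∀ {n} (x : Fin n → Carrier) → x ∙ x ≥0
  ∙-self-≥0 x = sum-≥0 λ i → square-≥0 (x i)

  Q-scale : ∀ {n} (B : Matrix n) x a → Q B (λ i → a * x i) ≈ a * a * Q B x
  Q-scale B x a = begin
    Q B (λ i → a * x i)                      ≈⟨ ∙-congʳ (λ i → a * x i) (λ i → ∙-scaleʳ (B i) x a) ⟩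
    (λ i → a * x i) ∙ (λ i → a * apply B x i) ≈⟨ ∙-scaleʳ (λ i → a * x i) _ a ⟩
    a * (λ i → a * x i) ∙ apply B x          ≈⟨ *-congˡ (∙-comm (λ i → a * x i) (apply B x)) ⟩
    a * apply B x ∙ (λ i → a * x i)          ≈⟨ *-congˡ (∙-scaleʳ (apply B x) x a) ⟩
    a * (a * apply B x ∙ x)                  ≈⟨ *-assoc _ _ _ ⟨
    a * a * apply B x ∙ x                    ≈⟨ *-congˡ (∙-comm (apply B x) x) ⟩
    a * a * Q B x                            ∎
    where open ≈-Reasoning

  Q-linear : ∀ {n} (A B : Matrix n) a b x →
             Q (λ i j → a * A i j + b * B i j) x ≈ a * Q A x + b * Q B x
  Q-linear A B a b x = trans (∙-congʳ x (λ i → ∙-linearˡ (A i) (B i) x a b))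
    (trans (∙-+ʳ x _ _) (+-cong (∙-scaleʳ x _ a) (∙-scaleʳ x _ b)))

  -- Cauchy-Schwarz with an unspecified constant. The induction step uses (u + L)² ≤ 2u² + 2L², so
  -- the constant doubles with each coordinate.
  ∙-bounded : ∀ {n} (a : Fin n → Carrier) →
              ∃[ β ] β ≥0 × ∀ y → a ∙ y * a ∙ y ≤ β * y ∙ y
  ∙-bounded {zero}  a = 0# , ≤-refl , λ y →
    ≤-reflexive (solve 0 (con (+ 0) :* con (+ 0) := con (+ 0) :* con (+ 0)) refl)
  ∙-bounded {suc n} a with ∙-bounded (a ∘ suc)
  ... | β , β≥0 , p = a₀ * a₀ + a₀ * a₀ + (β + β) , +-≥0 (+-≥0 (square-≥0 a₀) (square-≥0 a₀)) (+-≥0 β≥0 β≥0) , λ y →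
    let y₀ = y zero ; Y = (y ∘ suc) ∙ (y ∘ suc) ; L = (a ∘ suc) ∙ (y ∘ suc) in begin
    (a₀ * y₀ + L) * (a₀ * y₀ + L)
      ≤⟨ x-y≥0⇒y≤x (≤-trans (square-≥0 (a₀ * y₀ - L)) (≤-reflexive (solve 2
           (λ u L → (u :- L) :* (u :- L) := u :* u :+ u :* u :+ (L :* L :+ L :* L) :- (u :+ L) :* (u :+ L))
           refl (a₀ * y₀) L))) ⟩
    a₀ * y₀ * (a₀ * y₀) + a₀ * y₀ * (a₀ * y₀) + (L * L + L * L)
      ≤⟨ +-mono-≤ ≤-refl (+-mono-≤ (p (y ∘ suc)) (p (y ∘ suc))) ⟩
    a₀ * y₀ * (a₀ * y₀) + a₀ * y₀ * (a₀ * y₀) + (β * Y + β * Y)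
      ≤⟨ x-y≥0⇒y≤x (≤-trans
           (+-≥0 (+-≥0 (*-≥0 (square-≥0 a₀) (∙-self-≥0 (y ∘ suc))) (*-≥0 (square-≥0 a₀) (∙-self-≥0 (y ∘ suc))))
                 (+-≥0 (*-≥0 β≥0 (square-≥0 y₀)) (*-≥0 β≥0 (square-≥0 y₀))))
           (≤-reflexive (solve 4 (λ a y Y β →
             a :* a :* Y :+ a :* a :* Y :+ (β :* (y :* y) :+ β :* (y :* y)) :=
             (a :* a :+ a :* a :+ (β :+ β)) :* (y :* y :+ Y)
               :- (a :* y :* (a :* y) :+ a :* y :* (a :* y) :+ (β :* Y :+ β :* Y)))
             refl a₀ y₀ Y β))) ⟩
    (a₀ * a₀ + a₀ * a₀ + (β + β)) * (y₀ * y₀ + Y) ∎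
    where
    open ≤-Reasoning
    a₀ = a zero

  -- The definite case carries a uniform constant `K`, not just positivity at each nonzero vector:
  -- it has to survive a small change of the form, and no compactness argument supplies such a
  -- constant afterwards.
  data Inertia {n} (B : Matrix n) : Set (c ⊔ℓ ℓ₁ ⊔ℓ ℓ₂) where
    negative : ∀ x → Q B x < 0# → Inertia B
    singular : PSD B → ∀ v → ∃[ i ] v i # 0# → (∀ i → apply B v i ≈ 0#) → Inertia B
    definite : ∀ K → 0# < K → (∀ x → x ∙ x ≤ K * Q B x) → Inertia B

  definite⇒PSD : ∀ {n} {B : Matrix n} {K} → 0# < K → (∀ x → x ∙ x ≤ K * Q B x) → PSD B
  definite⇒PSD 0<K p x = *-cancelˡ-≤ 0<K
    (≤-trans (≤-reflexive (zeroʳ _)) (≤-trans (∙-self-≥0 x) (p x)))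

  pivotConstant : (b d β K : Carrier) → Carrier
  pivotConstant b d β K = d * d * (b + b + (β * (K * b) + β * (K * b))) + K * b

  -- Here `q` is the value of the form, `r` that of the Schur complement, `t` the first coordinate,
  -- `L` the row applied to the tail, `Y` the squared length of the tail and `d` the inverse of the
  -- pivot. By the completed square, (bt + L)² and `r` are each at most `b * q`. Hence `Y` and L²
  -- are bounded by multiples of `q`, and t = d (bt) is controlled through (bt)² ≤ 2(bt + L)² + 2L².
  -- Adding up gives `pivotConstant`.
  pivot-bound : ∀ {b d β K t L Y q r} → b * d ≈ 1# → β ≥0 → K ≥0 → (b * t + L) * (b * t + L) ≥0 → r ≥0 →
                b * q ≈ (b * t + L) * (b * t + L) + r → L * L ≤ β * Y → Y ≤ K * r →
                t * t + Y ≤ pivotConstant b d β K * q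
  pivot-bound {b} {d} {β} {K} {t} {L} {Y} {q} {r} bd≈1 β≥0 K≥0 ss≥0 r≥0 bq≈ L-bound Y-bound = begin
    t * t + Y                         ≤⟨ +-mono-≤ t-bound Y≤ ⟩
    M * q + K * b * q                 ≈⟨ distribʳ q M (K * b) ⟨
    (M + K * b) * q                   ∎
    where
    open ≤-Reasoning
    M = d * d * (b + b + (β * (K * b) + β * (K * b)))
    s = b * t + L
    Y≤ : Y ≤ K * b * q
    Y≤ = begin
      Y                    ≤⟨ Y-bound ⟩
      K * r                ≤⟨ *-monoˡ-≤ K≥0 (≤-trans (≤-reflexive (sym (+-identityˡ r))) (+-mono-≤ ss≥0 ≤-refl)) ⟩
      K * (s * s + r)      ≈⟨ *-congˡ bq≈ ⟨
      K * (b * q)          ≈⟨ *-assoc K b q ⟨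
      K * b * q            ∎
    s-bound : s * s ≤ b * q
    s-bound = begin
      s * s                ≈⟨ +-identityʳ (s * s) ⟨
      s * s + 0#           ≤⟨ +-mono-≤ ≤-refl r≥0 ⟩
      s * s + r            ≈⟨ bq≈ ⟨
      b * q                ∎
    L≤ : L * L ≤ β * (K * b) * q
    L≤ = ≤-trans L-bound (≤-trans (*-monoˡ-≤ β≥0 Y≤) (≤-reflexive (sym (*-assoc β (K * b) q))))
    t≈ : t ≈ b * d * t
    t≈ = sym (trans (*-congʳ bd≈1) (*-identityˡ t))
    t-bound : t * t ≤ M * q
    t-bound = begin
      t * t                ≈⟨ *-cong t≈ t≈ ⟩
      b * d * t * (b * d * t)
        ≈⟨ solve 3 (λ b d t → b :* d :* t :* (b :* d :* t) := d :* d :* (b :* t :* (b :* t))) refl b d t ⟩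
      d * d * (b * t * (b * t))
        ≤⟨ *-monoˡ-≤ (square-≥0 d) (x-y≥0⇒y≤x (≤-trans (square-≥0 (b * t + L + L)) (≤-reflexive
             (solve 2 (λ u L → (u :+ L :+ L) :* (u :+ L :+ L)
               := (u :+ L) :* (u :+ L) :+ (u :+ L) :* (u :+ L) :+ (L :* L :+ L :* L) :- u :* u)
               refl (b * t) L)))) ⟩
      d * d * (s * s + s * s + (L * L + L * L))
        ≤⟨ *-monoˡ-≤ (square-≥0 d) (+-mono-≤ (+-mono-≤ s-bound s-bound) (+-mono-≤ L≤ L≤)) ⟩
      d * d * (b * q + b * q + (β * (K * b) * q + β * (K * b) * q))
        ≈⟨ solve 4 (λ e b q g → e :* (b :* q :+ b :* q :+ (g :* q :+ g :* q))
             := e :* (b :+ b :+ (g :+ g)) :* q) refl (d * d) b q (β * (K * b)) ⟩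
      M * q ∎

  module Pivot {n} (B : Matrix (suc n)) (B-sym : Symmetric B) where
    b : Carrier
    b = B zero zero

    row : Fin n → Carrier
    row j = B zero (suc j)

    tail : Matrix n
    tail i j = B (suc i) (suc j)

    -- The usual Schur complement multiplied by the pivot. Without division, integer entries stay
    -- integers, and their signs stay decidable throughout the elimination.
    schur : Matrix n
    schur i j = b * tail i j + (- row i) * row j

    schur-sym : Symmetric schur
    schur-sym i j = +-cong (*-congˡ (B-sym (suc i) (suc j)))
      (solve 2 (λ x y → :- x :* y := :- y :* x) refl (row i) (row j))

    apply-suc : ∀ t y i → apply B (t ▹ y) (suc i) ≈ t * row i + apply tail y i
    apply-suc t y i = +-congʳ (trans (*-congʳ (B-sym (suc i) zero)) (*-comm _ _))

    Q-cons : ∀ t y → Q B (t ▹ y) ≈ b * (t * t) + (t * row ∙ y + t * row ∙ y) + Q tail y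
    Q-cons t y = begin
      t * (b * t + row ∙ y) + y ∙ (λ i → apply B (t ▹ y) (suc i))
        ≈⟨ +-congˡ (∙-congʳ y (apply-suc t y)) ⟩
      t * (b * t + row ∙ y) + y ∙ (λ i → t * row i + apply tail y i)
        ≈⟨ +-congˡ (∙-+ʳ y _ _) ⟩
      t * (b * t + row ∙ y) + (y ∙ (λ i → t * row i) + Q tail y)
        ≈⟨ +-congˡ (+-congʳ (trans (∙-scaleʳ y row t) (*-congˡ (∙-comm y row)))) ⟩
      t * (b * t + row ∙ y) + (t * row ∙ y + Q tail y)
        ≈⟨ solve 4 (λ t b L q → t :* (b :* t :+ L) :+ (t :* L :+ q)
             := b :* (t :* t) :+ (t :* L :+ t :* L) :+ q) refl t b (row ∙ y) (Q tail y) ⟩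
      b * (t * t) + (t * row ∙ y + t * row ∙ y) + Q tail y ∎
      where open ≈-Reasoning

    apply-schur : ∀ y i → apply schur y i ≈ b * apply tail y i + (- row i) * row ∙ y
    apply-schur y i = ∙-linearˡ (tail i) row y b (- row i)

    Q-schur : ∀ y → Q schur y ≈ b * Q tail y - row ∙ y * row ∙ y
    Q-schur y = begin
      y ∙ apply schur y
        ≈⟨ ∙-congʳ y (λ i → trans (apply-schur y i)
             (+-congˡ (solve 2 (λ r L → :- r :* L := :- L :* r) refl (row i) (row ∙ y)))) ⟩
      y ∙ (λ i → b * apply tail y i + (- row ∙ y) * row i)
        ≈⟨ ∙-+ʳ y _ _ ⟩
      y ∙ (λ i → b * apply tail y i) + y ∙ (λ i → (- row ∙ y) * row i)
        ≈⟨ +-cong (∙-scaleʳ y _ b) (trans (∙-scaleʳ y row _) (*-congˡ (∙-comm y row))) ⟩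
      b * Q tail y + (- row ∙ y) * row ∙ y
        ≈⟨ +-congˡ (solve 1 (λ L → :- L :* L := :- (L :* L)) refl (row ∙ y)) ⟩
      b * Q tail y - row ∙ y * row ∙ y ∎
      where open ≈-Reasoning

    complete-square : ∀ t y → b * Q B (t ▹ y) ≈ (b * t + row ∙ y) * (b * t + row ∙ y) + Q schur y
    complete-square t y = trans (*-congˡ (Q-cons t y)) (trans
      (solve 4 (λ t b L q → b :* (b :* (t :* t) :+ (t :* L :+ t :* L) :+ q)
         := (b :* t :+ L) :* (b :* t :+ L) :+ (b :* q :- L :* L)) refl t b (row ∙ y) (Q tail y))
      (+-congˡ (sym (Q-schur y))))

    -- The vector whose first coordinate makes the completed square vanish.
    lift-schur : (Fin n → Carrier) → Fin (suc n) → Carrier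
    lift-schur y = (- row ∙ y) ▹ (λ i → b * y i)

    Q-lift-schur : ∀ y → Q B (lift-schur y) ≈ b * Q schur y
    Q-lift-schur y = begin
      Q B (lift-schur y)
        ≈⟨ Q-cons _ _ ⟩
      b * (- L * - L) + (- L * row ∙ (λ i → b * y i) + - L * row ∙ (λ i → b * y i)) + Q tail (λ i → b * y i)
        ≈⟨ +-cong (+-congˡ (+-cong (*-congˡ (∙-scaleʳ row y b)) (*-congˡ (∙-scaleʳ row y b)))) (Q-scale tail y b) ⟩
      b * (- L * - L) + (- L * (b * L) + - L * (b * L)) + b * b * Q tail y
        ≈⟨ solve 3 (λ b L q → b :* (:- L :* :- L) :+ (:- L :* (b :* L) :+ :- L :* (b :* L)) :+ b :* b :* q
             := b :* (b :* q :- L :* L)) refl b L (Q tail y) ⟩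
      b * (b * Q tail y - L * L) ≈⟨ *-congˡ (Q-schur y) ⟨
      b * Q schur y ∎
      where
      open ≈-Reasoning
      L = row ∙ y

    apply-lift-schur : ∀ y → (∀ i → apply schur y i ≈ 0#) → ∀ i → apply B (lift-schur y) i ≈ 0#
    apply-lift-schur y e zero = trans (+-congˡ (∙-scaleʳ row y b))
      (solve 2 (λ b L → b :* :- L :+ b :* L := con (+ 0)) refl b (row ∙ y))
    apply-lift-schur y e (suc i) = trans (apply-suc _ _ i) (trans
      (+-congˡ (∙-scaleʳ (tail i) y b)) (trans
      (solve 4 (λ L r b a → :- L :* r :+ b :* a := b :* a :+ :- r :* L) refl (row ∙ y) (row i) b (apply tail y i))
      (trans (sym (apply-schur y i)) (e i))))

    PSD-schur⇒PSD : 0# < b → PSD schur → PSD B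
    PSD-schur⇒PSD 0<b p x = *-cancelˡ-≤ 0<b (≤-trans (≤-reflexive (zeroʳ b)) (≤-trans
      (+-≥0 (square-≥0 _) (p (x ∘ suc))) (≤-reflexive (sym (complete-square (x zero) (x ∘ suc))))))

    definite-schur : 0# < b → ∀ K → 0# < K → (∀ y → y ∙ y ≤ K * Q schur y) → Inertia B
    definite-schur 0<b K 0<K p = definite K′ 0<K′ bound
      where
      d = proj₁ (reciprocal-pos 0<b)
      bd≈1 = proj₂ (proj₂ (reciprocal-pos 0<b))
      β = proj₁ (∙-bounded row)
      β≥0 = proj₁ (proj₂ (∙-bounded row))
      K′ = pivotConstant b d β K
      0<K′ : 0# < K′
      0<K′ = <-≤-trans (*-pos 0<K 0<b) (≤-trans (≤-reflexive (sym (+-identityˡ _)))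
        (+-mono-≤ (*-≥0 (square-≥0 d) (+-≥0 (+-≥0 (<⇒≤ 0<b) (<⇒≤ 0<b)) (+-≥0 βKb≥0 βKb≥0))) ≤-refl))
        where βKb≥0 = *-≥0 β≥0 (*-≥0 (<⇒≤ 0<K) (<⇒≤ 0<b))
      bound : ∀ x → x ∙ x ≤ K′ * Q B x
      bound x = pivot-bound {b = b} {d} {β} {K} {x zero} {row ∙ (x ∘ suc)} {(x ∘ suc) ∙ (x ∘ suc)}
        {Q B x} {Q schur (x ∘ suc)} bd≈1 β≥0 (<⇒≤ 0<K) (square-≥0 (b * x zero + row ∙ (x ∘ suc)))
        (definite⇒PSD {B = schur} 0<K p (x ∘ suc)) (complete-square (x zero) (x ∘ suc))
        (proj₂ (proj₂ (∙-bounded row)) (x ∘ suc)) (p (x ∘ suc))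

  -- In continuation-passing style, so that the signs may come either from a decision
  -- procedure or, when R is ⊥, from the classically valid trichotomy.
  module Elimination {r d} (R : Set r) (D : Carrier → Set d)
    (D-+ : ∀ {x y} → D x → D y → D (x + y))
    (D-* : ∀ {x y} → D x → D y → D (x * y))
    (D-neg : ∀ {x} → D x → D (- x))
    (sign : ∀ {x} → D x → (Trichotomy x → R) → R)
    where

    zero-or-apart : ∀ {n} (f : Fin n → Carrier) → (∀ j → D (f j)) →
                    ((∀ j → f j ≈ 0#) ⊎ (∃[ j ] f j # 0#) → R) → R
    zero-or-apart {zero}  f d k = k (inj₁ λ ())
    zero-or-apart {suc n} f d k = sign (d zero) λ where
      (inj₁ f₀<0)        → k (inj₂ (zero , <⇒# f₀<0))
      (inj₂ (inj₂ 0<f₀)) → k (inj₂ (zero , 0<⇒# 0<f₀))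
      (inj₂ (inj₁ f₀≈0)) → zero-or-apart (f ∘ suc) (d ∘ suc) λ where
        (inj₁ e)       → k (inj₁ λ { zero → f₀≈0 ; (suc j) → e j })
        (inj₂ (j , p)) → k (inj₂ (suc j , p))

    -- The pivot decides. If it is positive, the Schur complement has the same type. If it vanishes
    -- together with its row, the form ignores the first coordinate, so `e₀` is a null vector unless
    -- the rest takes a negative value. A negative pivot, or a zero one with a nonzero row, gives a
    -- negative value at once.
    inertia : ∀ {n} (B : Matrix n) → Symmetric B → (∀ i j → D (B i j)) → (Inertia B → R) → R
    inertia {zero}  B B-sym d k = k (definite 1# 0<1 λ x → ≤-reflexive (sym (zeroʳ 1#)))
    inertia {suc n} B B-sym d k = sign (d zero zero) λ where
        (inj₁ b<0) → k (negative e₀ (<-respˡ (sym Q-e₀) b<0))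
        (inj₂ (inj₁ b≈0)) → zero-or-apart row (λ j → d zero (suc j)) λ where
          (inj₁ row≈0) → inertia tail (λ i j → B-sym _ _) (λ i j → d _ _) λ where
            (negative y q)   → k (negative (0# ▹ y) (<-respˡ (sym (Q-cons-0 b≈0 row≈0 0# y)) q))
            (singular p _ _ _) → k (null-e₀ b≈0 row≈0 p)
            (definite K 0<K p) → k (null-e₀ b≈0 row≈0 (definite⇒PSD 0<K p))
          (inj₂ (j , β#0)) → k (hyperbolic b≈0 j β#0)
        (inj₂ (inj₂ 0<b)) → inertia schur schur-sym
          (λ i j → D-+ (D-* (d _ _) (d _ _)) (D-* (D-neg (d _ _)) (d _ _))) λ where
            (negative y q) → k (negative (lift-schur y) (<-respˡ (sym (Q-lift-schur y))
              (<-respʳ (zeroʳ b) (*-monoˡ-< 0<b q))))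
            (singular p v (i , vᵢ#0) e) → k (singular (PSD-schur⇒PSD 0<b p) (lift-schur v)
              (suc i , x#0y#0→xy#0 (0<⇒# 0<b) vᵢ#0) (apply-lift-schur v e))
            (definite K 0<K p) → k (definite-schur 0<b K 0<K p)
      where
      open Pivot B B-sym
      open import Algebra.Apartness.Properties.HeytingCommutativeRing heytingCommutativeRing
        using (x#0y#0→xy#0)
      e₀ : Fin (suc n) → Carrier
      e₀ = 1# ▹ (λ _ → 0#)

      row∙0 : row ∙ (λ _ → 0#) ≈ 0#
      row∙0 = ∙-zeroʳ row (λ _ → 0#) (λ _ → refl)

      Q-e₀ : Q B e₀ ≈ b
      Q-e₀ = trans (Q-cons 1# (λ _ → 0#)) (trans
        (+-cong (+-congˡ (+-cong (*-congˡ row∙0) (*-congˡ row∙0))) (sum-zero λ i → zeroˡ (apply tail (λ _ → 0#) i)))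
        (solve 1 (λ b → b :* (con (+ 1) :* con (+ 1)) :+ (con (+ 1) :* con (+ 0) :+ con (+ 1) :* con (+ 0))
           :+ con (+ 0) := b) refl b))

      Q-cons-0 : b ≈ 0# → (∀ j → row j ≈ 0#) → ∀ t y → Q B (t ▹ y) ≈ Q tail y
      Q-cons-0 b≈0 row≈0 t y = trans (Q-cons t y) (trans
        (+-congʳ (+-cong (*-congʳ b≈0) (+-cong (*-congˡ row∙y) (*-congˡ row∙y))))
        (solve 2 (λ t q → con (+ 0) :* (t :* t) :+ (t :* con (+ 0) :+ t :* con (+ 0)) :+ q := q) refl t (Q tail y)))
        where row∙y = trans (∙-comm row y) (∙-zeroʳ y row row≈0)

      null-e₀ : b ≈ 0# → (∀ j → row j ≈ 0#) → PSD tail → Inertia B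
      null-e₀ b≈0 row≈0 p = singular
        (λ x → ≤-trans (p (x ∘ suc)) (≤-reflexive (sym (Q-cons-0 b≈0 row≈0 (x zero) (x ∘ suc)))))
        e₀ (zero , 1#0) λ where
          zero    → trans (+-cong (trans (*-congʳ b≈0) (zeroˡ _)) row∙0) (+-identityʳ 0#)
          (suc i) → trans (apply-suc 1# (λ _ → 0#) i) (trans
            (+-cong (trans (*-congˡ (row≈0 i)) (zeroʳ _)) (∙-zeroʳ (tail i) _ λ _ → refl)) (+-identityʳ 0#))

      -- With zero pivot and y = β e_j, the form at `t ▹ y` is β² (2t + q), which is linear in `t`;
      -- the chosen `t` makes the bracket equal to -1.
      hyperbolic : b ≈ 0# → ∀ j → row j # 0# → Inertia B
      hyperbolic b≈0 j β#0 = negative (t ▹ y) (<-respˡ (sym Q≈) (0<x-y⇒y<x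
          (<-respʳ (solve 1 (λ x → x :* x := con (+ 0) :- :- (x :* x)) refl β) (#0⇒0<square β#0))))
        where
        h = recipℕ 2
        β = row j
        q = tail j j
        t = - ((q + 1#) * h)
        y : Fin n → Carrier
        y i = β * δ j i
        ∙δ : ∀ (f : Fin n → Carrier) → f ∙ δ j ≈ f j
        ∙δ f = trans (∙-comm f (δ j)) (sum-δ j f)
        row∙y : row ∙ y ≈ β * β
        row∙y = trans (∙-scaleʳ row (δ j) β) (*-congˡ (∙δ row))
        Qy : Q tail y ≈ β * β * q
        Qy = trans (Q-scale tail (δ j) β) (*-congˡ (trans (∙-comm (δ j) _)
          (trans (∙δ (apply tail (δ j))) (∙δ (tail j)))))
        Q≈ : Q B (t ▹ y) ≈ - (β * β)
        Q≈ = trans (Q-cons t y) (trans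
          (+-cong (+-cong (*-congʳ b≈0) (+-cong (*-congˡ row∙y) (*-congˡ row∙y))) Qy)
          (trans (solve 4 (λ q h β t → con (+ 0) :* (t :* t) :+ (:- ((q :+ con (+ 1)) :* h) :* (β :* β) :+ :- ((q :+ con (+ 1)) :* h) :* (β :* β)) :+ β :* β :* q
              := β :* β :* (q :- con (+ 2) :* h :* (q :+ con (+ 1)))) refl q h β t)
          (trans (*-congˡ (+-congˡ (-‿cong (*-congʳ (*-recipℕ 2)))))
          (solve 2 (λ q β → β :* β :* (q :- con (+ 1) :* (q :+ con (+ 1))) := :- (β :* β)) refl q β))))

-- The critical value of a pencil of integer forms

module CriticalValue {c ℓ₁ ℓ₂} (ℝ : Reals c ℓ₁ ℓ₂) where
  open OrderedFieldProperties (Reals.orderedField ℝ)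
  open QuadraticForms (Reals.orderedField ℝ)
  open Reals ℝ using (archimedean; complete)

  recipℕ-small : ∀ {ε} → 0# < ε → ∃[ K ] ∀ n → K ℕ.≤ n → recipℕ (suc n) < ε
  recipℕ-small {ε} 0<ε = K , λ n K≤n →
      <-respˡ (trans (*-congˡ εy≈1) (*-identityʳ (recipℕ (suc n))))
        (<-respʳ (rM≈ n) (*-monoˡ-< (recipℕ-pos (suc n)) (*-monoˡ-< 0<ε
          (<-≤-trans y<K (fromℕ-mono-≤ (ℕ.≤-trans K≤n (ℕ.n≤1+n n)))))))
    where
    y = proj₁ (reciprocal-pos 0<ε)
    εy≈1 = proj₂ (proj₂ (reciprocal-pos 0<ε))
    K = proj₁ (archimedean y)
    y<K = proj₂ (archimedean y)
    rM≈ : ∀ n → recipℕ (suc n) * (ε * fromℕ (suc n)) ≈ ε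
    rM≈ n = trans
      (solve 3 (λ r ε M → r :* (ε :* M) := M :* r :* ε) refl (recipℕ (suc n)) ε (fromℕ (suc n)))
      (trans (*-congʳ (*-recipℕ (suc n))) (*-identityˡ ε))

  -- Only the existence of some bound matters: coordinatewise xy ≤ x² + y², followed by `∙-bounded`
  -- for every row.
  Q-bounded : ∀ {n} (B : Matrix n) → ∃[ β ] β ≥0 × ∀ x → Q B x ≤ β * x ∙ x
  Q-bounded {n} B = 1# + sum β , +-≥0 0≤1 (sum-≥0 β≥0) , λ x → begin
      x ∙ apply B x
        ≤⟨ sum-mono-≤ (λ i → x-y≥0⇒y≤x (≤-trans
             (+-≥0 (square-≥0 (x i - h * apply B x i)) (*-≥0 ¾≥0 (square-≥0 (apply B x i))))
                   (≤-reflexive (young (x i) (apply B x i))))) ⟩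
      sum (λ i → x i * x i + apply B x i * apply B x i)
        ≈⟨ sum-+ (λ i → x i * x i) (λ i → apply B x i * apply B x i) ⟩
      x ∙ x + sum (λ i → apply B x i * apply B x i)
        ≤⟨ +-mono-≤ ≤-refl (sum-mono-≤ (λ i → proj₂ (proj₂ (∙-bounded (B i))) x)) ⟩
      x ∙ x + sum (λ i → β i * x ∙ x)
        ≈⟨ +-cong (*-identityˡ (x ∙ x)) (sum-* (x ∙ x) β) ⟨
      1# * x ∙ x + sum β * x ∙ x
        ≈⟨ distribʳ (x ∙ x) 1# (sum β) ⟨
      (1# + sum β) * x ∙ x ∎
    where
    open ≤-Reasoning
    h = recipℕ 2
    β = λ i → proj₁ (∙-bounded (B i))
    β≥0 = λ i → proj₁ (proj₂ (∙-bounded (B i)))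
    2h≈1 : fromℕ 2 * h ≈ 1#
    2h≈1 = *-recipℕ 2
    ¾≥0 : 1# - h * h ≥0
    ¾≥0 = ≤-trans (+-≥0 (*-≥0 h≥0 h≥0) (+-≥0 (*-≥0 h≥0 h≥0) (*-≥0 h≥0 h≥0))) (≤-reflexive (trans
      (solve 1 (λ h → h :* h :+ (h :* h :+ h :* h) := con (+ 2) :* h :* (con (+ 2) :* h) :- h :* h) refl h)
      (+-congʳ (trans (*-cong 2h≈1 2h≈1) (*-identityˡ 1#)))))
      where h≥0 = <⇒≤ (recipℕ-pos 2)
    young : ∀ u v → (u - h * v) * (u - h * v) + (1# - h * h) * (v * v) ≈ u * u + v * v - u * v
    young u v = trans
      (solve 3 (λ u v h → (u :- h :* v) :* (u :- h :* v) :+ (con (+ 1) :- h :* h) :* (v :* v)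
         := u :* u :+ v :* v :- con (+ 2) :* h :* (u :* v)) refl u v h)
      (+-congˡ (-‿cong (trans (*-congʳ 2h≈1) (*-identityˡ _))))

  module _ {n} (D C : Matrix n) (D-sym : Symmetric D) (C-sym : Symmetric C)
    (D-integer : ∀ i j → IsInteger (D i j)) (C-integer : ∀ i j → IsInteger (C i j))
    (D-PSD : PSD D) where

    -- Two parameters allow denominators to be cleared: at the fraction i / (k + 1) the form is a
    -- positive multiple of the integer form with parameters i and k + 1.
    pencil : Carrier → Carrier → Matrix n
    pencil s t i j = s * D i j + t * C i j

    pencil-sym : ∀ s t → Symmetric (pencil s t)
    pencil-sym s t i j = +-cong (*-congˡ (D-sym i j)) (*-congˡ (C-sym i j))

    private
      q : Carrier → (Fin n → Carrier) → Carrier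
      q s x = s * Q D x + Q C x

      Q-pencil-1 : ∀ s x → Q (pencil s 1#) x ≈ q s x
      Q-pencil-1 s x = trans (Q-linear D C s 1# x) (+-congˡ (*-identityˡ (Q C x)))

      Indefinite Semidefinite : Carrier → Set _
      Indefinite s   = ∃[ x ] q s x < 0#
      Semidefinite s = ∀ x → q s x ≥0

      decide-integer : ∀ i j → (∃[ x ] Q (pencil (fromℕ i) (fromℕ j)) x < 0#) ⊎ PSD (pencil (fromℕ i) (fromℕ j))
      decide-integer i j = inertia B (pencil-sym (fromℕ i) (fromℕ j))
        (λ k l → integer-+ (integer-* (integer-fromℕ i) (D-integer k l)) (integer-* (integer-fromℕ j) (C-integer k l))) λ where
          (negative x p)     → inj₁ (x , p)
          (singular p _ _ _) → inj₂ p
          (definite K 0<K p) → inj₂ (definite⇒PSD {B = B} 0<K p)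
        where
        B = pencil (fromℕ i) (fromℕ j)
        open Elimination ((∃[ x ] Q B x < 0#) ⊎ PSD B) IsInteger integer-+ integer-* integer-neg (λ d k → k (integer-sign d))

      fraction : ℕ → ℕ → Carrier
      fraction i k = fromℕ i * recipℕ (suc k)

      Q-fraction : ∀ i k x → fromℕ (suc k) * q (fraction i k) x ≈ Q (pencil (fromℕ i) (fromℕ (suc k))) x
      Q-fraction i k x = trans
        (solve 5 (λ m i r d e → m :* (i :* r :* d :+ e) := m :* r :* (i :* d) :+ m :* e) refl
          (fromℕ (suc k)) (fromℕ i) (recipℕ (suc k)) (Q D x) (Q C x))
        (trans (+-congʳ (trans (*-congʳ (*-recipℕ (suc k))) (*-identityˡ _)))
              (sym (Q-linear D C (fromℕ i) (fromℕ (suc k)) x)))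

      decide : ∀ k i → Indefinite (fraction i k) ⊎ Semidefinite (fraction i k)
      decide k i with decide-integer i (suc k)
      ... | inj₁ (x , p) = inj₁ (x , 0<x-y⇒y<x (<-respʳ (sym (+-identityˡ _)) (*-cancelˡ-pos (fromℕ-≥0 (suc k))
            (<-respʳ (solve 2 (λ m q → :- (m :* q) := m :* :- q) refl (fromℕ (suc k)) (q (fraction i k) x))
              (x<0⇒0<-x (<-respˡ (sym (Q-fraction i k x)) p))))))
      ... | inj₂ p = inj₂ λ x → *-cancelˡ-≤ (fromℕ-pos k)
            (≤-trans (≤-reflexive (zeroʳ _)) (≤-trans (p x) (≤-reflexive (sym (Q-fraction i k x)))))

      -- Descends through the numerators while the form remains semidefinite. Numerator 0 cannot be
      -- reached in this way, as the form is indefinite there.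
      search : ∀ k i → Indefinite (fraction 0 k) → Semidefinite (fraction i k) →
               ∃[ j ] Indefinite (fraction j k) × Semidefinite (fraction (suc j) k)
      search k zero    (x , p) above = contradiction p (above x)
      search k (suc i) below above with decide k i
      ... | inj₁ below′ = i , below′ , above
      ... | inj₂ above′ = search k i below above′

      -- Since `D` is semidefinite, the form grows with the parameter. This compares brackets with
      -- different denominators and makes their lower ends a Cauchy sequence.
      indefinite≤semidefinite : ∀ {s t} → Indefinite s → Semidefinite t → s ≤ t
      indefinite≤semidefinite {s} {t} (x , p) above t<s = ≤-trans
        (+-≥0 (*-≥0 (<⇒≤ (y<x⇒0<x-y t<s)) (D-PSD x)) (above x))
        (≤-reflexive (solve 4 (λ s t d e → (s :- t) :* d :+ (t :* d :+ e) := s :* d :+ e) refl s t (Q D x) (Q C x))) p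

    module _ (below : ∃[ x ] Q C x < 0#) (above : ∀ x → Q D x + Q C x ≥0) where
      private
        -- The search starts at numerator k + 1, that is at s = 1, where `above` gives
        -- semidefiniteness; `below` is indefiniteness at s = 0.
        bracket : ∀ k → ∃[ j ] Indefinite (fraction j k) × Semidefinite (fraction (suc j) k)
        bracket k = search k (suc k)
          (proj₁ below , <-respˡ (sym (trans (+-congʳ (trans (*-congʳ (zeroˡ _)) (zeroˡ _))) (+-identityˡ _))) (proj₂ below))
          (λ x → ≤-trans (above x) (≤-reflexive (+-congʳ (sym (trans (*-congʳ (*-recipℕ (suc k))) (*-identityˡ _))))))

        a : ℕ → Carrier
        a k = fraction (proj₁ (bracket k)) k

        a-indefinite : ∀ k → Indefinite (a k)
        a-indefinite k = proj₁ (proj₂ (bracket k))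

        a-semidefinite : ∀ k → Semidefinite (a k + recipℕ (suc k))
        a-semidefinite k x = ≤-trans (proj₂ (proj₂ (bracket k)) x) (≤-reflexive (+-congʳ (*-congʳ
          (solve 2 (λ j r → (con (+ 1) :+ j) :* r := j :* r :+ r) refl (fromℕ (proj₁ (bracket k))) (recipℕ (suc k))))))

        a-close : ∀ m n → a m - a n ≤ recipℕ (suc n)
        a-close m n = x-y≥0⇒y≤x (≤-trans
          (y≤x⇒x-y≥0 (indefinite≤semidefinite (a-indefinite m) (a-semidefinite n)))
          (≤-reflexive (solve 3 (λ x y r → y :+ r :- x := r :- (x :- y)) refl (a m) (a n) (recipℕ (suc n)))))

        -- The larger of `u` and `v` cannot be singled out. Cotransitivity settles the claim unless
        -- both lie below `abs x`; in that case only a contradiction is wanted, so `trichotomy` may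
        -- compare them.
        abs-< : ∀ {x u v ε} → x ≤ u → - x ≤ v → u < ε → v < ε → abs x < ε
        abs-< {x} {u} {v} {ε} x≤u -x≤v u<ε v<ε with <-cotrans u<ε (abs x)
        ... | inj₂ p = p
        ... | inj₁ u<abs with <-cotrans v<ε (abs x)
        ...   | inj₂ p = p
        ...   | inj₁ v<abs = ⊥-elim (trichotomy u v λ where
          (inj₁ u<v)        → abs-≤ (≤-trans x≤u (<⇒≤ u<v)) -x≤v v<abs
          (inj₂ (inj₁ u≈v)) → abs-≤ (≤-trans x≤u (≤-reflexive u≈v)) -x≤v v<abs
          (inj₂ (inj₂ v<u)) → abs-≤ x≤u (≤-trans -x≤v (<⇒≤ v<u)) u<abs)

        limit : ∃[ s ] ∀ ε → 0# < ε → ∃[ K ] ∀ n → K ℕ.≤ n → abs (a n - s) < ε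
        limit = complete a λ ε 0<ε → let (K , small) = recipℕ-small 0<ε in
          K , λ m n K≤m K≤n → abs-< (a-close m n)
            (≤-trans (≤-reflexive (solve 2 (λ x y → :- (x :- y) := y :- x) refl (a m) (a n))) (a-close n m))
            (small n K≤n) (small m K≤m)

      critical : Carrier
      critical = proj₁ limit

      private
        s : Carrier
        s = critical

        near : ∀ ε → 0# < ε → ∃[ k ] (a k - s < ε) × (s - a k < ε) × recipℕ (suc k) < ε
        near ε 0<ε = k , ≤-<-trans (x≤abs (a k - s)) close
            , ≤-<-trans (≤-trans (≤-reflexive (solve 2 (λ x y → y :- x
                  := :- (x :- y)) refl (a k) s)) (-x≤abs (a k - s))) close
            , proj₂ (recipℕ-small 0<ε) k (ℕ.m≤n⊔m _ _)
          where
          k = proj₁ (proj₂ limit ε 0<ε) ℕ.⊔ proj₁ (recipℕ-small 0<ε)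
          close = proj₂ (proj₂ limit ε 0<ε) k (ℕ.m≤m⊔n _ _)

      critical-semidefinite : ∀ x → s * Q D x + Q C x ≥0
      critical-semidefinite x qs<0 = a-semidefinite k x (0<x-y⇒y<x (<-respʳ eq
          (+-mono-≤-< (*-≥0 (D-PSD x) (<⇒≤ (y<x⇒0<x-y (+-mono-< a-s<ε r<ε)))) (*-pos 0<ε (<-respʳ 2≈ (fromℕ-pos 1))))))
        where
        m = - q s x
        0<m : 0# < m
        0<m = x<0⇒0<-x qs<0
        d = Q D x + 1#
        0<d : 0# < d
        0<d = <-≤-trans 0<1 (≤-trans (≤-reflexive (sym (+-identityˡ 1#))) (+-mono-≤ (D-PSD x) ≤-refl))
        y = proj₁ (reciprocal-pos 0<d)
        dy≈1 : d * y ≈ 1#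
        dy≈1 = proj₂ (proj₂ (reciprocal-pos 0<d))
        -- Chosen so that 2ε (Q D x + 1) = m. Raising `s` by less than 2ε adds at most m - 2ε to the
        -- form at `x`, which thus stays negative at the upper end of a close bracket, although the
        -- form is semidefinite there.
        ε = m * y * recipℕ 2
        0<ε : 0# < ε
        0<ε = *-pos (*-pos 0<m (proj₁ (proj₂ (reciprocal-pos 0<d)))) (recipℕ-pos 2)
        k = proj₁ (near ε 0<ε)
        a-s<ε = proj₁ (proj₂ (near ε 0<ε))
        r<ε = proj₂ (proj₂ (proj₂ (near ε 0<ε)))
        +-mono-≤-< : ∀ {x y} → x ≥0 → 0# < y → 0# < x + y
        +-mono-≤-< {x} {y} x≥0 0<y = <-≤-trans 0<y (≤-trans (≤-reflexive (sym (+-identityˡ y))) (+-mono-≤ x≥0 ≤-refl))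
        2εd≈m : (ε + ε) * d ≈ m
        2εd≈m = trans (solve 4 (λ m y h d → (m :* y :* h :+ m :* y :* h) :* d
              := m :* (d :* y) :* (con (+ 2) :* h)) refl m y (recipℕ 2) d)
          (trans (*-cong (*-congˡ dy≈1) (*-recipℕ 2)) (trans (*-identityʳ _) (*-identityʳ m)))
        eq : Q D x * (ε + ε - (a k - s + recipℕ (suc k))) + ε * (1# + 1#) ≈ 0# - q (a k + recipℕ (suc k)) x
        eq = trans (solve 6 (λ e D C s a r → D :* (e :+ e :- (a :- s :+ r)) :+ e :* (con (+ 1) :+ con (+ 1))
               := (e :+ e) :* (D :+ con (+ 1)) :+ (s :* D :+ C) :- ((a :+ r) :* D :+ C)) refl ε (Q D x) (Q C x) s (a k) (recipℕ (suc k)))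
             (+-congʳ (trans (+-congʳ 2εd≈m) (-‿inverseˡ (q s x))))

      -- Definiteness is an open condition: `Q D` is at most β K times the form at `s`, so the form
      -- stays nonnegative when `s` is lowered by up to 1 / (β K + 1). But some bracket has an
      -- indefinite lower end that close to `s`.
      critical-not-definite : ∀ K → 0# < K → ¬ (∀ x → x ∙ x ≤ K * q s x)
      critical-not-definite K 0<K p = ≤-refl {q s x} (<-≤-trans
          (0<x-y⇒y<x {ε * Q D x} {q s x} (<-respʳ eq (<-≤-trans (x<0⇒0<-x qa<0) (≤-trans (≤-reflexive (sym (+-identityˡ _)))
            (+-mono-≤ (*-≥0 (<⇒≤ (y<x⇒0<x-y s-a<ε)) (D-PSD x)) ≤-refl)))))
          bound)
        where
        β = proj₁ (Q-bounded D)
        β≥0 = proj₁ (proj₂ (Q-bounded D))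
        e = β * K + 1#
        0<e : 0# < e
        0<e = <-≤-trans 0<1 (≤-trans (≤-reflexive (sym (+-identityˡ 1#))) (+-mono-≤ (*-≥0 β≥0 (<⇒≤ 0<K)) ≤-refl))
        ε = proj₁ (reciprocal-pos 0<e)
        0<ε = proj₁ (proj₂ (reciprocal-pos 0<e))
        k = proj₁ (near ε 0<ε)
        s-a<ε = proj₁ (proj₂ (proj₂ (near ε 0<ε)))
        x = proj₁ (a-indefinite k)
        qa<0 = proj₂ (a-indefinite k)
        eq : (ε - (s - a k)) * Q D x + - q (a k) x ≈ ε * Q D x - q s x
        eq = solve 5 (λ ε s a D C → (ε :- (s :- a)) :* D :+ :- (a :* D :+ C)
              := ε :* D :- (s :* D :+ C)) refl ε s (a k) (Q D x) (Q C x)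
        open ≤-Reasoning
        bound : ε * Q D x ≤ q s x
        bound = begin
          ε * Q D x             ≤⟨ *-monoˡ-≤ (<⇒≤ 0<ε) (proj₂ (proj₂ (Q-bounded D)) x) ⟩
          ε * (β * x ∙ x)       ≤⟨ *-monoˡ-≤ (<⇒≤ 0<ε) (*-monoˡ-≤ β≥0 (p x)) ⟩
          ε * (β * (K * q s x)) ≤⟨ x-y≥0⇒y≤x (≤-trans (*-≥0 (<⇒≤ 0<ε) (critical-semidefinite x))
              (≤-reflexive (solve 4 (λ ε β K z → ε :* z
                    := (β :* K :+ con (+ 1)) :* ε :* z :- ε :* (β :* (K :* z))) refl ε β K (q s x)))) ⟩
          e * ε * q s x         ≈⟨ trans (*-congʳ (proj₂ (proj₂ (reciprocal-pos 0<e)))) (*-identityˡ _) ⟩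
          q s x                 ∎

      -- The entries at `s` are arbitrary reals, so the elimination runs on the classical
      -- `trichotomy` and its outcome is only doubly negated. This suffices for deriving an order
      -- relation.
      critical-singular : ¬ ¬ (∃[ v ] (∃[ i ] v i # 0#) × ∀ i → s * apply D v i + apply C v i ≈ 0#)
      critical-singular k = inertia B (pencil-sym s 1#) (λ _ _ → lift tt) λ where
          (negative x p)       → critical-semidefinite x (<-respˡ (Q-pencil-1 s x) p)
          (singular _ v v#0 e) → k (v , v#0 , λ i → trans
            (sym (trans (∙-linearˡ (D i) (C i) v s 1#) (+-congˡ (*-identityˡ (apply C v i))))) (e i))
          (definite K 0<K p)   → critical-not-definite K 0<K λ x →
            ≤-trans (p x) (≤-reflexive (*-congˡ (Q-pencil-1 s x)))
        where
        B = pencil s 1#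
        open Elimination ⊥ (λ _ → Lift 0ℓ ⊤) (λ _ _ → lift tt) (λ _ _ → lift tt) (λ _ → lift tt)
          (λ {x} _ k → trichotomy x 0# k)

-- From eigenvalues of a weighted graph to its quadratic form

module SpectralGap {c ℓ₁ ℓ₂} (ℝ : Reals c ℓ₁ ℓ₂) where
  open OrderedFieldProperties (Reals.orderedField ℝ)
  open QuadraticForms (Reals.orderedField ℝ)
  open CriticalValue ℝ

  diagonal : ∀ {n} → (Fin n → Carrier) → Matrix n
  diagonal f i j = δ i j * f i

  apply-diagonal : ∀ {n} (f x : Fin n → Carrier) i → apply (diagonal f) x i ≈ f i * x i
  apply-diagonal f x i = trans (sum-cong λ j → *-assoc (δ i j) (f i) (x j)) (sum-δ i (λ j → f i * x j))

  Q-diagonal : ∀ {n} (f x : Fin n → Carrier) → Q (diagonal f) x ≈ f ∙ (λ i → x i * x i)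
  Q-diagonal f x = sum-cong λ i → trans (*-congˡ (apply-diagonal f x i))
    (solve 2 (λ x f → x :* (f :* x) := f :* (x :* x)) refl (x i) (f i))

  module _ {N} (A : Matrix N) (d : Fin N → Carrier)
    (A-sym : Symmetric A) (A-integer : ∀ i j → IsInteger (A i j)) (d-integer : ∀ i → IsInteger (d i))
    (A≥0 : ∀ i j → A i j ≥0) (row-sum : ∀ i → sum (A i) ≈ d i)
    where

    private
      sq : (Fin N → Carrier) → Fin N → Carrier
      sq x i = x i * x i

      d≥0 : ∀ i → d i ≥0
      d≥0 i = ≤-trans (sum-≥0 (A≥0 i)) (≤-reflexive (row-sum i))

      sum-apply : ∀ y → sum (apply A y) ≈ d ∙ y
      sum-apply y = trans (∑-comm (λ i j → A i j * y j)) (sum-cong λ j →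
        trans (sym (sum-* (y j) (λ i → A i j))) (*-congʳ (trans (sum-cong λ i → A-sym i j) (row-sum j))))

      -- The Dirichlet energy of the weighted graph. On expanding the square, the two pure terms
      -- collapse through row sums and column sums, which agree by symmetry.
      dirichlet : ∀ x → sum (λ i → sum λ j → A i j * ((x i - x j) * (x i - x j))) ≈ (d ∙ sq x - Q A x) + (d ∙ sq x - Q A x)
      dirichlet x = begin
        sum (λ i → sum λ j → A i j * ((x i - x j) * (x i - x j)))
          ≈⟨ sum-cong (λ i → trans (sum-cong λ j → solve 3 (λ a x y → a :* ((x :- y) :* (x :- y))
               := a :* (x :* x) :+ (:- (con (+ 2) :* x) :* (a :* y) :+ a :* (y :* y))) refl (A i j) (x i) (x j))
             (trans (sum-+ (λ j → A i j * sq x i) (λ j → - (fromℕ 2 * x i) * (A i j * x j) + A i j * sq x j))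
               (+-cong (trans (sym (sum-* (sq x i) (A i))) (*-congʳ (row-sum i)))
                 (trans (sum-+ (λ j → - (fromℕ 2 * x i) * (A i j * x j)) (λ j → A i j * sq x j))
                   (+-congʳ (sym (*-sum (- (fromℕ 2 * x i)) (λ j → A i j * x j)))))))) ⟩
        sum (λ i → d i * sq x i + (- (fromℕ 2 * x i) * apply A x i + apply A (sq x) i))
          ≈⟨ trans (sum-+ (λ i → d i * sq x i) (λ i → - (fromℕ 2 * x i) * apply A x i + apply A (sq x) i))
               (+-congˡ (sum-+ (λ i → - (fromℕ 2 * x i) * apply A x i) (apply A (sq x)))) ⟩
        d ∙ sq x + (sum (λ i → - (fromℕ 2 * x i) * apply A x i) + sum (apply A (sq x)))
          ≈⟨ +-congˡ (+-cong (trans (sum-cong λ i → solve 2 (λ x y → :- (con (+ 2) :* x) :* y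
                := :- con (+ 2) :* (x :* y)) refl (x i) (apply A x i))
               (sym (*-sum (- fromℕ 2) (λ i → x i * apply A x i)))) (sum-apply (sq x))) ⟩
        d ∙ sq x + (- fromℕ 2 * Q A x + d ∙ sq x)
          ≈⟨ solve 2 (λ D q → D :+ (:- con (+ 2) :* q :+ D) := (D :- q) :+ (D :- q)) refl (d ∙ sq x) (Q A x) ⟩
        (d ∙ sq x - Q A x) + (d ∙ sq x - Q A x) ∎
        where
        open ≈-Reasoning

      dirichlet-≥0 : ∀ (x : Fin N → Carrier) i → sum (λ j → A i j * ((x i - x j) * (x i - x j))) ≥0
      dirichlet-≥0 x i = sum-≥0 λ j → *-≥0 (A≥0 i j) (square-≥0 (x i - x j))

      QA≤ : ∀ (x : Fin N → Carrier) → d ∙ sq x - Q A x ≥0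
      QA≤ x p = ≤-trans (sum-≥0 (dirichlet-≥0 x)) (≤-reflexive (dirichlet x))
        (<-respʳ (+-identityˡ 0#) (+-mono-< p p))

      -- For such `x` the Dirichlet energy is zero, hence so is each of its nonnegative summands.
      harmonic⇒constant : ∀ (x : Fin N → Carrier) → (∀ i → apply A x i ≈ d i * x i) → ∀ i j → 0# < A i j → x i ≈ x j
      harmonic⇒constant x e i j 0<A = trans (solve 2 (λ x y → x := x :- y :+ y) refl (x i) (x j))
        (trans (+-congʳ (square≈0⇒≈0 (*-cancelˡ-≈ 0<A (trans
          (≤0⇒≈0 (*-≥0 (A≥0 i j) (square-≥0 (x i - x j)))
                (≤-trans (term≤sum {f = λ j → A i j * ((x i - x j) * (x i - x j))}
                      (λ j → *-≥0 (A≥0 i j) (square-≥0 (x i - x j))) j)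
            (≤-trans (term≤sum (dirichlet-≥0 x) i) (≤-reflexive total≈0)))) (sym (zeroʳ _)))))) (+-identityˡ _))
        where
        QA≈ : Q A x ≈ d ∙ sq x
        QA≈ = sum-cong λ i → trans (*-congˡ (e i)) (solve 2 (λ x d → x :* (d :* x) := d :* (x :* x)) refl (x i) (d i))
        total≈0 : sum (λ i → sum λ j → A i j * ((x i - x j) * (x i - x j))) ≈ 0#
        total≈0 = trans (dirichlet x) (trans (+-cong z z) (+-identityˡ 0#))
          where z = trans (+-congˡ (-‿cong QA≈)) (-‿inverseʳ (d ∙ sq x))

      J-sign : ∀ {x} → Trichotomy x → Carrier
      J-sign (inj₁ _)        = 0#
      J-sign (inj₂ (inj₁ _)) = 1#
      J-sign (inj₂ (inj₂ _)) = 0#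

      -- The indicator of the points with d i = 0, such as points of `Fin N` outside a link. Degrees
      -- are integers, so their vanishing is decidable.
      J : Fin N → Carrier
      J i = J-sign (integer-sign (d-integer i))

      J-cases : ∀ i → (d i ≈ 0# × J i ≈ 1#) ⊎ (0# < d i × J i ≈ 0#)
      J-cases i with integer-sign (d-integer i)
      ... | inj₁ d<0        = contradiction d<0 (d≥0 i)
      ... | inj₂ (inj₁ d≈0) = inj₁ (d≈0 , refl)
      ... | inj₂ (inj₂ 0<d) = inj₂ (0<d , refl)

      J-integer : ∀ i → IsInteger (J i)
      J-integer i with integer-sign (d-integer i)
      ... | inj₁ _        = integer-0
      ... | inj₂ (inj₁ _) = integer-1
      ... | inj₂ (inj₂ _) = integer-0

      J*J≈J : ∀ i → J i * (1# - J i) ≈ 0#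
      J*J≈J i with J-cases i
      ... | inj₁ (_ , J≈1) = trans (*-cong J≈1 (+-congˡ (-‿cong J≈1))) (solve 0 (con (+ 1) :* (con (+ 1) :- con (+ 1))
            := con (+ 0)) refl)
      ... | inj₂ (_ , J≈0) = trans (*-congʳ J≈0) (zeroˡ _)

      d*J≈0 : ∀ i → d i * J i ≈ 0#
      d*J≈0 i with J-cases i
      ... | inj₁ (d≈0 , _) = trans (*-congʳ d≈0) (zeroˡ _)
      ... | inj₂ (_ , J≈0) = trans (*-congˡ J≈0) (zeroʳ _)

      d≈0⇒A≈0 : ∀ i → d i ≈ 0# → ∀ j → A i j ≈ 0#
      d≈0⇒A≈0 i d≈0 j = ≤0⇒≈0 (A≥0 i j) (≤-trans (term≤sum (A≥0 i) j) (≤-reflexive (trans (row-sum i) d≈0)))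

      A*J≈0 : ∀ i j → A i j * J i ≈ 0#
      A*J≈0 i j with J-cases i
      ... | inj₁ (d≈0 , _) = trans (*-congʳ (d≈0⇒A≈0 i d≈0 j)) (zeroˡ _)
      ... | inj₂ (_ , J≈0) = trans (*-congˡ J≈0) (zeroʳ _)

      -- The rank-one term pushes the constant functions out of the way, and J makes
      -- the form positive definite where d vanishes.
      C : Matrix N
      C i j = diagonal J i j + (d i * d j - A i j)

      D : Matrix N
      D = diagonal d

      diagonal-sym : ∀ (f : Fin N → Carrier) → Symmetric (diagonal f)
      diagonal-sym f i j = δ-subst i j f

      C-sym : Symmetric C
      C-sym i j = +-cong (diagonal-sym J i j) (+-cong (*-comm (d i) (d j)) (-‿cong (A-sym i j)))

      C-integer : ∀ i j → IsInteger (C i j)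
      C-integer i j = integer-+ (integer-* (integer-ind (i Fin.≟ j)) (J-integer i))
        (integer-+ (integer-* (d-integer i) (d-integer j)) (integer-neg (A-integer i j)))

      D-integer : ∀ i j → IsInteger (D i j)
      D-integer i j = integer-* (integer-ind (i Fin.≟ j)) (d-integer i)

      D-PSD : PSD D
      D-PSD x = ≤-trans (sum-≥0 λ i → *-≥0 (d≥0 i) (square-≥0 (x i))) (≤-reflexive (sym (Q-diagonal d x)))

      apply-C : ∀ x i → apply C x i ≈ J i * x i + (d i * d ∙ x - apply A x i)
      apply-C x i = begin
        sum (λ j → (diagonal J i j + (d i * d j - A i j)) * x j)
          ≈⟨ sum-cong (λ j → solve 5 (λ e d f a x → (e :+ (d :* f :- a)) :* x
                := e :* x :+ (d :* (f :* x) :+ :- con (+ 1) :* (a :* x)))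
               refl (diagonal J i j) (d i) (d j) (A i j) (x j)) ⟩
        sum (λ j → diagonal J i j * x j + (d i * (d j * x j) + - 1# * (A i j * x j)))
          ≈⟨ trans (sum-+ (λ j → diagonal J i j * x j) (λ j → d i * (d j * x j) + - 1# * (A i j * x j)))
               (+-cong (apply-diagonal J x i) (sum-+ (λ j → d i * (d j * x j)) (λ j → - 1# * (A i j * x j)))) ⟩
        J i * x i + (sum (λ j → d i * (d j * x j)) + sum (λ j → - 1# * (A i j * x j)))
          ≈⟨ +-congˡ (+-cong (sym (*-sum (d i) (λ j → d j * x j)))
               (trans (sym (*-sum (- 1#) (λ j → A i j * x j))) (solve 1 (λ y → :- con (+ 1) :* y
                     := :- y) refl (apply A x i)))) ⟩
        J i * x i + (d i * d ∙ x - apply A x i) ∎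
        where open ≈-Reasoning

      Q-C : ∀ x → Q C x ≈ J ∙ sq x + (d ∙ x * d ∙ x - Q A x)
      Q-C x = begin
        x ∙ apply C x
          ≈⟨ sum-cong (λ i → trans (*-congˡ (apply-C x i)) (solve 5 (λ x J d y a → x :* (J :* x :+ (d :* y :- a))
               := J :* (x :* x) :+ (y :* (d :* x) :+ :- con (+ 1) :* (x :* a))) refl (x i) (J i) (d i) (d ∙ x) (apply A x i))) ⟩
        sum (λ i → J i * sq x i + (d ∙ x * (d i * x i) + - 1# * (x i * apply A x i)))
          ≈⟨ trans (sum-+ (λ i → J i * sq x i) (λ i → d ∙ x * (d i * x i) + - 1# * (x i * apply A x i)))
               (+-congˡ (sum-+ (λ i → d ∙ x * (d i * x i)) (λ i → - 1# * (x i * apply A x i)))) ⟩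
        J ∙ sq x + (sum (λ i → d ∙ x * (d i * x i)) + sum (λ i → - 1# * (x i * apply A x i)))
          ≈⟨ +-congˡ (+-cong (sym (*-sum (d ∙ x) (λ i → d i * x i)))
               (trans (sym (*-sum (- 1#) (λ i → x i * apply A x i))) (solve 1 (λ y → :- con (+ 1) :* y
                     := :- y) refl (Q A x)))) ⟩
        J ∙ sq x + (d ∙ x * d ∙ x - Q A x) ∎
        where open ≈-Reasoning

      J-sq-≥0 : ∀ x → J ∙ sq x ≥0
      J-sq-≥0 x = sum-≥0 λ i → *-≥0 (J≥0 i) (square-≥0 (x i))
        where
        J≥0 : ∀ i → J i ≥0
        J≥0 i with J-cases i
        ... | inj₁ (_ , J≈1) = ≤-trans 0≤1 (≤-reflexive (sym J≈1))
        ... | inj₂ (_ , J≈0) = ≤-reflexive (sym J≈0)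

      C+D-PSD : ∀ x → Q D x + Q C x ≥0
      C+D-PSD x = ≤-trans (+-≥0 (QA≤ x) (+-≥0 (J-sq-≥0 x) (square-≥0 (d ∙ x))))
        (≤-reflexive (trans (solve 4 (λ D q j r → D :- q :+ (j :+ r)
              := D :+ (j :+ (r :- q))) refl (d ∙ sq x) (Q A x) (J ∙ sq x) (d ∙ x * d ∙ x))
          (sym (+-cong (Q-diagonal d x) (Q-C x)))))

    module _ (λ′ : Carrier) (0<λ′ : 0# < λ′)
      (eigenvalue-bound : ∀ μ φ → (∃[ v ] 0# < d v × φ v # 0#) →
                          (∀ v → 0# < d v → apply A φ v ≈ μ * (d v * φ v)) → μ ≤ λ′ ⊎ μ ≈ 1#)
      (connected : ∀ (φ : Fin N → Carrier) → (∀ u v → 0# < A u v → φ u ≈ φ v) →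
                   ∀ u v → 0# < d u → 0# < d v → φ u ≈ φ v)
      where

      private
        -- Sets φ to zero where `d` vanishes. The forms of `D` and `A` do not see those values, but
        -- the summand `J` of `C` does.
        cut : (Fin N → Carrier) → Fin N → Carrier
        cut φ i = (1# - J i) * φ i

        cut-d : ∀ φ → d ∙ cut φ ≈ d ∙ φ
        cut-d φ = sum-cong λ i → trans (solve 3 (λ d J φ → d :* ((con (+ 1) :- J) :* φ)
              := d :* φ :- d :* J :* φ) refl (d i) (J i) (φ i))
          (trans (+-congˡ (-‿cong (trans (*-congʳ (d*J≈0 i)) (zeroˡ _)))) (x-0≈x _))

        cut-D : ∀ φ → d ∙ sq (cut φ) ≈ d ∙ sq φ
        cut-D φ = sum-cong λ i → trans (solve 3 (λ d J φ → d :* (((con (+ 1) :- J) :* φ) :* ((con (+ 1) :- J) :* φ))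
              := d :* (φ :* φ) :- d :* J :* ((con (+ 2) :- J) :* (φ :* φ))) refl (d i) (J i) (φ i))
          (trans (+-congˡ (-‿cong (trans (*-congʳ (d*J≈0 i)) (zeroˡ _)))) (x-0≈x _))

        cut-J : ∀ φ → J ∙ sq (cut φ) ≈ 0#
        cut-J φ = sum-zero λ i → trans (solve 2 (λ J φ → J :* (((con (+ 1) :- J) :* φ) :* ((con (+ 1) :- J) :* φ))
              := J :* (con (+ 1) :- J) :* ((con (+ 1) :- J) :* (φ :* φ))) refl (J i) (φ i))
          (trans (*-congʳ (J*J≈J i)) (zeroˡ _))

        cut-A : ∀ φ → Q A (cut φ) ≈ Q A φ
        cut-A φ = sum-cong λ i → trans (*-sum (cut φ i) (λ j → A i j * cut φ j)) (trans (sum-cong (term i)) (sym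
              (*-sum (φ i) (λ j → A i j * φ j))))
          where
          term : ∀ i j → cut φ i * (A i j * cut φ j) ≈ φ i * (A i j * φ j)
          term i j = trans
            (solve 5 (λ a J K φ ψ → (con (+ 1) :- J) :* φ :* (a :* ((con (+ 1) :- K) :* ψ))
               := φ :* (a :* ψ) :- (a :* J :* (con (+ 1) :- K) :+ a :* K) :* (φ :* ψ)) refl (A i j) (J i) (J j) (φ i) (φ j))
            (trans (+-congˡ (-‿cong (trans (*-congʳ (trans (+-cong (trans (*-congʳ (A*J≈0 i j)) (zeroˡ _))
              (trans (*-congʳ (A-sym i j)) (A*J≈0 j i))) (+-identityˡ 0#))) (zeroˡ _)))) (x-0≈x _))

        -- Where `d` vanishes, the equation reads v i = 0. Elsewhere, summing all rows gives (s + V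
        -- - 1) (d ∙ v) = 0 with V the total degree, so `v` is centred, the rank-one term drops out,
        -- and `v` is an eigenvector for `s`. As `s` exceeds the bound, s = 1 remains; then `v` is
        -- constant on the connected support and, being centred, zero there.
        no-eigenvector : ∀ s → λ′ < s → ∀ v → ∃[ i ] v i # 0# →
                         ¬ (∀ i → s * apply D v i + apply C v i ≈ 0#)
        no-eigenvector s λ<s v (i , vᵢ#0) e with J-cases i
        ... | inj₁ (d≈0 , J≈1) = proj₂ (tight (v i) 0#) vᵢ≈0 vᵢ#0
          where
          vᵢ≈0 : v i ≈ 0#
          vᵢ≈0 = begin
            v i
              ≈⟨ solve 3 (λ s v t → v := s :* (con (+ 0) :* v) :+ (con (+ 1) :* v :+ (con (+ 0) :* t :- con (+ 0)))) refl s (v i) (d ∙ v) ⟩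
            s * (0# * v i) + (1# * v i + (0# * d ∙ v - 0#))
              ≈⟨ +-cong (*-congˡ (*-congʳ d≈0)) (+-cong (*-congʳ J≈1) (+-cong (*-congʳ d≈0) (-‿cong
                   (trans (∙-comm (A i) v) (∙-zeroʳ v (A i) (d≈0⇒A≈0 i d≈0)))))) ⟨
            s * (d i * v i) + (J i * v i + (d i * d ∙ v - apply A v i))
              ≈⟨ +-cong (*-congˡ (apply-diagonal d v i)) (apply-C v i) ⟨
            s * apply D v i + apply C v i
              ≈⟨ e i ⟩
            0# ∎
            where open ≈-Reasoning
        ... | inj₂ (0<dᵢ , _) = case eigenvalue-bound s v (i , 0<dᵢ , vᵢ#0) (λ j _ → eigen j) of λ where
            (inj₁ s≤λ) → s≤λ λ<s
            (inj₂ s≈1) → proj₂ (tight (v i) 0#) (vᵢ≈0 s≈1) vᵢ#0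
          where
          e′ : ∀ j → s * (d j * v j) + (J j * v j + (d j * d ∙ v - apply A v j)) ≈ 0#
          e′ j = trans (sym (+-cong (*-congˡ (apply-diagonal d v j)) (apply-C v j))) (e j)
          Jv≈0 : ∀ j → J j * v j ≈ 0#
          Jv≈0 j with J-cases j
          ... | inj₂ (_ , J≈0) = trans (*-congʳ J≈0) (zeroˡ _)
          ... | inj₁ (d≈0 , _) = begin
            J j * v j
              ≈⟨ solve 3 (λ s v w → w := s :* (con (+ 0) :* v) :+ (w :+ (con (+ 0) :* v :- con (+ 0)))) refl s (v j) (J j * v j) ⟩
            s * (0# * v j) + (J j * v j + (0# * v j - 0#))
              ≈⟨ +-cong (*-congˡ (*-congʳ d≈0)) (+-congˡ (+-cong (trans (*-congʳ d≈0) (trans (zeroˡ _)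
                    (sym (zeroˡ _)))) (-‿cong
                   (trans (∙-comm (A j) v) (∙-zeroʳ v (A j) (d≈0⇒A≈0 j d≈0)))))) ⟨
            s * (d j * v j) + (J j * v j + (d j * d ∙ v - apply A v j))
              ≈⟨ e′ j ⟩
            0# ∎
            where open ≈-Reasoning
          V : Carrier
          V = sum d
          V≥1 : 1# ≤ V
          V≥1 = ≤-trans (integer-≥1 (d-integer i) 0<dᵢ) (term≤sum d≥0 i)
          0<V : 0# < V
          0<V = <-≤-trans 0<1 V≥1
          -- A positive integer degree is at least 1, hence so is `V`; therefore `κ` is at least `s`
          -- and can be cancelled.
          κ : Carrier
          κ = s + (V - 1#)
          0<κ : 0# < κ
          0<κ = <-≤-trans (<-trans 0<λ′ λ<s) (≤-trans (≤-reflexive (sym (+-identityʳ s))) (+-mono-≤ ≤-refl (y≤x⇒x-y≥0 V≥1)))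
          e″ : ∀ j → s * (d j * v j) + (d j * d ∙ v + - 1# * apply A v j) ≈ 0#
          e″ j = trans (+-congˡ (trans (+-congˡ (solve 1 (λ a → :- con (+ 1) :* a := :- a) refl (apply A v j)))
            (trans (sym (+-identityˡ _)) (+-congʳ (sym (Jv≈0 j)))))) (e′ j)
          κdv≈0 : κ * d ∙ v ≈ κ * 0#
          κdv≈0 = begin
            κ * d ∙ v
              ≈⟨ solve 3 (λ s V t → (s :+ (V :- con (+ 1))) :* t
                    := s :* t :+ (V :* t :+ :- con (+ 1) :* t)) refl s V (d ∙ v) ⟩
            s * d ∙ v + (V * d ∙ v + - 1# * d ∙ v)
              ≈⟨ +-cong (*-sum s (λ j → d j * v j)) (+-cong (sum-* (d ∙ v) d)
                   (trans (*-congˡ (sym (sum-apply v))) (*-sum (- 1#) (apply A v)))) ⟩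
            sum (λ j → s * (d j * v j)) + (sum (λ j → d j * d ∙ v) + sum (λ j → - 1# * apply A v j))
              ≈⟨ +-congˡ (sum-+ (λ j → d j * d ∙ v) (λ j → - 1# * apply A v j)) ⟨
            sum (λ j → s * (d j * v j)) + sum (λ j → d j * d ∙ v + - 1# * apply A v j)
              ≈⟨ sum-+ (λ j → s * (d j * v j)) (λ j → d j * d ∙ v + - 1# * apply A v j) ⟨
            sum (λ j → s * (d j * v j) + (d j * d ∙ v + - 1# * apply A v j))
              ≈⟨ sum-zero e″ ⟩
            0#
              ≈⟨ zeroʳ κ ⟨
            κ * 0# ∎
            where open ≈-Reasoning
          dv≈0 : d ∙ v ≈ 0#
          dv≈0 = *-cancelˡ-≈ 0<κ κdv≈0
          eigen : ∀ j → apply A v j ≈ s * (d j * v j)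
          eigen j = begin
            apply A v j
              ≈⟨ solve 2 (λ a w → a := w :- (w :+ (con (+ 0) :+ :- con (+ 1) :* a))) refl (apply A v j) (s * (d j * v j)) ⟩
            s * (d j * v j) - (s * (d j * v j) + (0# + - 1# * apply A v j))
              ≈⟨ +-congˡ (-‿cong (+-congˡ (+-congʳ (trans (*-congˡ dv≈0) (zeroʳ _))))) ⟨
            s * (d j * v j) - (s * (d j * v j) + (d j * d ∙ v + - 1# * apply A v j))
              ≈⟨ trans (+-congˡ (-‿cong (e″ j))) (x-0≈x _) ⟩
            s * (d j * v j) ∎
            where open ≈-Reasoning
          vᵢ≈0 : s ≈ 1# → v i ≈ 0#
          vᵢ≈0 s≈1 = *-cancelˡ-≈ 0<V (trans (sum-* (v i) d) (trans (sum-cong term) (trans dv≈0 (sym (zeroʳ V)))))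
            where
            constant : ∀ j → 0# < d j → v i ≈ v j
            constant j 0<dⱼ = connected v (harmonic⇒constant v λ j → trans (eigen j) (trans (*-congʳ s≈1)
                  (*-identityˡ _))) i j 0<dᵢ 0<dⱼ
            term : ∀ j → d j * v i ≈ d j * v j
            term j with J-cases j
            ... | inj₁ (d≈0 , _) = trans (trans (*-congʳ d≈0) (zeroˡ _)) (sym (trans (*-congʳ d≈0) (zeroˡ _)))
            ... | inj₂ (0<d , _) = *-congˡ (constant j 0<d)

      -- If the bound fails at φ, then `cut φ` makes `C` negative and a critical `s` exists.
      -- Semidefiniteness at `s`, evaluated at the same vector, bounds Q A φ by `s` times the
      -- weighted square norm of φ, so `s` exceeds `λ′`; this is what `no-eigenvector` forbids.
      spectral-gap : ∀ φ → d ∙ φ ≈ 0# → Q A φ ≤ λ′ * d ∙ (λ i → φ i * φ i)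
      spectral-gap φ dφ≈0 λd<QA = trichotomy λ′ s λ where
          (inj₁ λ<s)        → critical-singular D C (diagonal-sym d) C-sym D-integer C-integer D-PSD below C+D-PSD
                                λ (v , v#0 , e) → no-eigenvector s λ<s v v#0 e
          (inj₂ (inj₁ λ≈s)) → ¬s≤λ (≤-reflexive (sym λ≈s))
          (inj₂ (inj₂ s<λ)) → ¬s≤λ (<⇒≤ s<λ)
        where
        ψ = cut φ
        q = d ∙ sq φ
        Q-Cψ : Q C ψ ≈ - Q A φ
        Q-Cψ = trans (Q-C ψ) (trans (+-cong (cut-J φ) (+-cong (*-cong (trans (cut-d φ) dφ≈0)
              (trans (cut-d φ) dφ≈0)) (-‿cong (cut-A φ))))
          (solve 1 (λ a → con (+ 0) :+ (con (+ 0) :* con (+ 0) :- a) := :- a) refl (Q A φ)))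
        Q-Dψ : Q D ψ ≈ q
        Q-Dψ = trans (Q-diagonal d ψ) (cut-D φ)
        below : ∃[ x ] Q C x < 0#
        below = ψ , <-respˡ (sym Q-Cψ) (0<x-y⇒y<x (<-respʳ (solve 1 (λ a → a := con (+ 0) :- :- a) refl (Q A φ))
          (≤-<-trans (*-≥0 (<⇒≤ 0<λ′) (sum-≥0 λ i → *-≥0 (d≥0 i) (square-≥0 (φ i)))) λd<QA)))
        s = critical D C (diagonal-sym d) C-sym D-integer C-integer D-PSD below C+D-PSD
        ¬s≤λ : ¬ (s ≤ λ′)
        ¬s≤λ s≤λ = ≤-trans (x-y≥0⇒y≤x (≤-trans
            (critical-semidefinite D C (diagonal-sym d) C-sym D-integer C-integer D-PSD below C+D-PSD ψ)
            (≤-reflexive (+-cong (*-congˡ Q-Dψ) Q-Cψ))))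
          (*-monoʳ-≤ (sum-≥0 λ i → *-≥0 (d≥0 i) (square-≥0 (φ i))) s≤λ) λd<QA

-- Sizes of finite subsets and counting

module SubsetSizes where

  ∣p∪⁅x⁆∣≡1+∣p∣ : ∀ {N} (p : Subset N) {x} → x ∉ p → ∣ p ∪ ⁅ x ⁆ ∣ ≡ suc ∣ p ∣
  ∣p∪⁅x⁆∣≡1+∣p∣ (Subset.inside Vec.∷ p)  {zero}  x∉p = contradiction Vec.here x∉p
  ∣p∪⁅x⁆∣≡1+∣p∣ (Subset.outside Vec.∷ p) {zero}  x∉p = ≡.cong (suc ∘ ∣_∣) (Subset.∪-identityʳ p)
  ∣p∪⁅x⁆∣≡1+∣p∣ (Subset.inside Vec.∷ p)  {suc x} x∉p = ≡.cong suc (∣p∪⁅x⁆∣≡1+∣p∣ p (x∉p ∘ Vec.there))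
  ∣p∪⁅x⁆∣≡1+∣p∣ (Subset.outside Vec.∷ p) {suc x} x∉p = ∣p∪⁅x⁆∣≡1+∣p∣ p (x∉p ∘ Vec.there)

  ∪-least : ∀ {N} {p q r : Subset N} → p ⊆ r → q ⊆ r → p ∪ q ⊆ r
  ∪-least {p = p} {q} p⊆r q⊆r x∈p∪q = [ p⊆r , q⊆r ]′ (Subset.x∈p∪q⁻ p q x∈p∪q)

  ⁅x⁆⊆ : ∀ {N} {p : Subset N} {x} → x ∈ p → ⁅ x ⁆ ⊆ p
  ⁅x⁆⊆ {x = x} x∈p y∈⁅x⁆ = ≡.subst (_∈ _) (≡.sym (Subset.x∈⁅y⁆⇒x≡y x y∈⁅x⁆)) x∈p

  ∣p∪⁅x⁆∣≤1+∣p∣ : ∀ {N} (p : Subset N) x → ∣ p ∪ ⁅ x ⁆ ∣ ℕ.≤ suc ∣ p ∣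
  ∣p∪⁅x⁆∣≤1+∣p∣ p x with x Subset.∈? p
  ... | yes x∈p = ℕ.≤-trans (Subset.p⊆q⇒∣p∣≤∣q∣ (∪-least {p = p} (λ z → z) (⁅x⁆⊆ x∈p))) (ℕ.n≤1+n _)
  ... | no x∉p  = ℕ.≤-reflexive (∣p∪⁅x⁆∣≡1+∣p∣ p x∉p)

  ∣p∣≡1⇒unique : ∀ {N} {p : Subset N} {x y} → ∣ p ∣ ≡ 1 → x ∈ p → y ∈ p → x ≡ y
  ∣p∣≡1⇒unique {p = p} {x} {y} ∣p∣≡1 x∈p y∈p with x Fin.≟ y
  ... | yes x≡y = x≡y
  ... | no x≢y  = contradiction
    (ℕ.≤-trans (ℕ.≤-reflexive (≡.sym 2≡)) (ℕ.≤-trans (Subset.p⊆q⇒∣p∣≤∣q∣ (∪-least {p = ⁅ x ⁆} (⁅x⁆⊆ x∈p) (⁅x⁆⊆ y∈p)))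
          (ℕ.≤-reflexive ∣p∣≡1)))
    (ℕ.<-irrefl ≡.refl)
    where
    2≡ : ∣ ⁅ x ⁆ ∪ ⁅ y ⁆ ∣ ≡ 2
    2≡ = ≡.trans (∣p∪⁅x⁆∣≡1+∣p∣ ⁅ x ⁆ (Subset.x≢y⇒x∉⁅y⁆ (x≢y ∘ ≡.sym))) (≡.cong suc (Subset.∣⁅x⁆∣≡1 x))

  ∣p∣≡1⇒nonempty : ∀ {N} {p : Subset N} → ∣ p ∣ ≡ 1 → Subset.Nonempty p
  ∣p∣≡1⇒nonempty {N} {p} ∣p∣≡1 with Subset.nonempty? p
  ... | yes p≢∅ = p≢∅
  ... | no p≡∅  = contradiction (≡.trans (≡.sym ∣p∣≡1) (≡.trans (≡.cong ∣_∣ (Subset.Empty-unique p≡∅))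
        (Subset.∣⊥∣≡0 N))) λ ()

  ∈-subsets : ∀ {N} (p : Subset N) → p List.∈ subsets N
  ∈-subsets Vec.[] = here ≡.refl
  ∈-subsets {suc N} (Subset.inside Vec.∷ p)  = List.∈-++⁺ˡ (List.∈-map⁺ (Subset.inside Vec.∷_) (∈-subsets p))
  ∈-subsets {suc N} (Subset.outside Vec.∷ p) = List.∈-++⁺ʳ (List.map
        (Subset.inside Vec.∷_) (subsets N)) (List.∈-map⁺ (Subset.outside Vec.∷_) (∈-subsets p))

module Counting {c ℓ₁ ℓ₂} (F : OrderedField c ℓ₁ ℓ₂) where
  open OrderedFieldProperties F

  fromℕ-∣p∣ : ∀ {N} (p : Subset N) → fromℕ ∣ p ∣ ≈ sum λ v → ind (v Subset.∈? p)
  fromℕ-∣p∣ Vec.[] = refl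
  fromℕ-∣p∣ (Subset.inside Vec.∷ p)  = +-congˡ (fromℕ-∣p∣ p)
  fromℕ-∣p∣ (Subset.outside Vec.∷ p) = trans (fromℕ-∣p∣ p) (sym (+-identityˡ _))

  -- Fixing the first predicate turns all counts of top simplices with some property into sums of
  -- indicators over one index set, where field algebra applies.
  length-filter-× : ∀ {a p q} {A : Set a} {P : A → Set p} {Q : A → Set q}
    (P? : ∀ x → Dec (P x)) (Q? : ∀ x → Dec (Q x)) (xs : List A) →
    fromℕ (length (filter (λ x → P? x ×-dec Q? x) xs)) ≈
    sum λ i → ind (Q? (List.lookup (filter P? xs) i))
  length-filter-× P? Q? [] = refl
  length-filter-× P? Q? (x ∷ xs) with does (P? x)
  ... | false = length-filter-× P? Q? xs
  ... | true with does (Q? x)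
  ...   | false = trans (length-filter-× P? Q? xs) (sym (+-identityˡ _))
  ...   | true  = +-congˡ (length-filter-× P? Q? xs)

-- Averages over the top simplices

module TopSimplices {c ℓ₁ ℓ₂} (F : OrderedField c ℓ₁ ℓ₂) {N} (X : Complex N) (n : ℕ) where
  open OrderedFieldProperties F
  open Counting F
  open SubsetSizes

  tops : List (Subset N)
  tops = filter (sized? X (suc n)) (subsets N)

  #tops : ℕ
  #tops = length tops

  top : Fin #tops → Subset N
  top = List.lookup tops

  top-sized : ∀ i → Sized X (suc n) (top i)
  top-sized i = All.lookup (List.all-filter (sized? X (suc n)) (subsets N)) (List.∈-lookup i)

  top-index : ∀ {σ} → Sized X (suc n) σ → ∃[ i ] top i ≡ σ
  top-index {σ} σ-sized = Any.index σ∈tops , ≡.sym (Any.lookup-index σ∈tops)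
    where σ∈tops = List.∈-filter⁺ (sized? X (suc n)) (∈-subsets σ) σ-sized

  count-tops : ∀ {q} {Q : Subset N → Set q} (Q? : ∀ σ → Dec (Q σ)) →
               fromℕ (length (filter (λ σ → sized? X (suc n) σ ×-dec Q? σ) (subsets N))) ≈ sum λ i → ind (Q? (top i))
  count-tops Q? = length-filter-× (sized? X (suc n)) Q? (subsets N)

  W : Subset N → Fin #tops → Carrier
  W τ i = ind (τ Subset.⊆? top i)

  -- An unnormalised conditional expectation given τ. Leaving out the division makes it additive
  -- when the condition is refined, and zero when τ is not a simplex.
  ⟪_⟫ : (Fin #tops → Carrier) → Subset N → Carrier
  ⟪ f ⟫ τ = sum λ i → W τ i * f i

  fromℕ-topDegree : ∀ τ → fromℕ (topDegree X n τ) ≈ sum (W τ)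
  fromℕ-topDegree τ = count-tops (τ Subset.⊆?_)

  ⟪⟫-cong : ∀ {f g} τ → (∀ i → τ ⊆ top i → f i ≈ g i) → ⟪ f ⟫ τ ≈ ⟪ g ⟫ τ
  ⟪⟫-cong {f} {g} τ e = sum-cong term
    where
    term : ∀ i → W τ i * f i ≈ W τ i * g i
    term i with τ Subset.⊆? top i
    ... | yes τ⊆σ = *-congˡ (e i (λ {x} → τ⊆σ {x}))
    ... | no _    = trans (zeroˡ _) (sym (zeroˡ _))

  ⟪⟫-mono : ∀ {f g} τ → (∀ i → f i ≤ g i) → ⟪ f ⟫ τ ≤ ⟪ g ⟫ τ
  ⟪⟫-mono τ p = sum-mono-≤ λ i → *-monoˡ-≤ (ind-≥0 (τ Subset.⊆? top i)) (p i)

  ⟪⟫-≥0 : ∀ {f} τ → (∀ i → f i ≥0) → ⟪ f ⟫ τ ≥0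
  ⟪⟫-≥0 τ p = sum-≥0 λ i → *-≥0 (ind-≥0 (τ Subset.⊆? top i)) (p i)

  ⟪⟫-+ : ∀ f g τ → ⟪ (λ i → f i + g i) ⟫ τ ≈ ⟪ f ⟫ τ + ⟪ g ⟫ τ
  ⟪⟫-+ f g τ = trans (sum-cong λ i → distribˡ (W τ i) (f i) (g i)) (sum-+ (λ i → W τ i * f i) (λ i → W τ i * g i))

  ⟪⟫-* : ∀ a f τ → ⟪ (λ i → a * f i) ⟫ τ ≈ a * ⟪ f ⟫ τ
  ⟪⟫-* a f τ = trans (sum-cong λ i → solve 3 (λ w a f → w :* (a :* f) := a :* (w :* f)) refl (W τ i) a (f i))
    (sym (*-sum a (λ i → W τ i * f i)))

  ⟪⟫-zero : ∀ τ f → (∀ i → ¬ (τ ⊆ top i)) → ⟪ f ⟫ τ ≈ 0#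
  ⟪⟫-zero τ f p = sum-zero λ i → trans (*-congʳ (ind-no (τ Subset.⊆? top i) (p i))) (zeroˡ (f i))

  ⟪1⟫≈topDegree : ∀ τ → ⟪ (λ _ → 1#) ⟫ τ ≈ fromℕ (topDegree X n τ)
  ⟪1⟫≈topDegree τ = trans (sum-cong λ i → *-identityʳ (W τ i)) (sym (fromℕ-topDegree τ))

  nonsimplex⇒not-covered : ∀ {τ} → ¬ Simplex X τ → ∀ i → ¬ (τ ⊆ top i)
  nonsimplex⇒not-covered ¬τ i τ⊆σ = ¬τ (⊆-closed X (λ {x} → τ⊆σ {x}) (proj₁ (top-sized i)))

  W-∪ : ∀ τ v i → W (τ ∪ ⁅ v ⁆) i ≈ W τ i * ind (v Subset.∈? top i)
  W-∪ τ v i = trans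
    (ind-cong (τ ∪ ⁅ v ⁆ Subset.⊆? top i) ((τ Subset.⊆? top i) ×-dec (v Subset.∈? top i))
      (λ p → (λ {x} x∈τ → p (Subset.p⊆p∪q {p = τ} ⁅ v ⁆ x∈τ)) , p (Subset.q⊆p∪q τ ⁅ v ⁆ (Subset.x∈⁅x⁆ v)))
      (λ (τ⊆σ , v∈σ) {x} → ∪-least {p = τ} (λ {y} → τ⊆σ {y}) (⁅x⁆⊆ v∈σ) {x}))
    (ind-× (τ Subset.⊆? top i) (v Subset.∈? top i))

  module Coverings (pure : Pure X n) where
    covering : ∀ {τ} → Simplex X τ → ∃[ i ] τ ⊆ top i
    covering {τ} τ-simplex with pure τ τ-simplex
    ... | σ , σ-sized , τ⊆σ with top-index σ-sized
    ...   | i , ≡.refl = i , λ {x} → τ⊆σ {x}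

    topDegree-pos : ∀ {τ} → Simplex X τ → 0# < fromℕ (topDegree X n τ)
    topDegree-pos {τ} τ-simplex with covering τ-simplex
    ... | i , τ⊆σ = <-≤-trans 0<1 (≤-trans (≤-reflexive (sym (ind-yes (τ Subset.⊆? top i) (λ {x} → τ⊆σ {x}))))
      (≤-trans (term≤sum (λ i → ind-≥0 (τ Subset.⊆? top i)) i) (≤-reflexive (sym (fromℕ-topDegree τ)))))

  module Coordinates (pure : Pure X n) (S : Fin (suc n) → Subset N) (partite : Partite X n S) where
    open Partite partite
    private
      side : ∀ i k → Subset.Nonempty (top i ∩ S k)
      side i k = ∣p∣≡1⇒nonempty (transversal (top i) (top-sized i) k)

    coord : Fin #tops → Fin (suc n) → Fin N
    coord i k = proj₁ (side i k)

    coord∈top : ∀ i k → coord i k ∈ top i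
    coord∈top i k = proj₁ (Subset.x∈p∩q⁻ (top i) (S k) (proj₂ (side i k)))

    coord∈S : ∀ i k → coord i k ∈ S k
    coord∈S i k = proj₂ (Subset.x∈p∩q⁻ (top i) (S k) (proj₂ (side i k)))

    coord-unique : ∀ i k {v} → v ∈ top i → v ∈ S k → coord i k ≡ v
    coord-unique i k v∈σ v∈S = ∣p∣≡1⇒unique (transversal (top i) (top-sized i) k)
      (proj₂ (side i k)) (Subset.x∈p∩q⁺ (v∈σ , v∈S))

    S-disjoint : ∀ {k l v} → k ≢ l → v ∈ S k → v ∉ S l
    S-disjoint {k} {l} k≢l v∈Sk v∈Sl = sides-disjoint k l k≢l (_ , Subset.x∈p∩q⁺ (v∈Sk , v∈Sl))

    -- The law of total expectation: a top simplex has exactly one vertex on side `l`, so the sum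
    -- over `y` counts it once.
    disintegrate : ∀ f τ l → ⟪ f ⟫ τ ≈ sum λ y → ind (y Subset.∈? S l) * ⟪ f ⟫ (τ ∪ ⁅ y ⁆)
    disintegrate f τ l = begin
      sum (λ i → W τ i * f i)
        ≈⟨ sum-cong (λ i → trans (sym (*-identityˡ _)) (*-congʳ (sym (trans (sym
              (sum-cong λ y → *-identityʳ (δ (coord i l) y))) (sum-δ (coord i l) (λ _ → 1#)))))) ⟩
      sum (λ i → sum (δ (coord i l)) * (W τ i * f i))
        ≈⟨ sum-cong (λ i → sum-* (W τ i * f i) (δ (coord i l))) ⟩
      sum (λ i → sum λ y → δ (coord i l) y * (W τ i * f i))
        ≈⟨ ∑-comm (λ i y → δ (coord i l) y * (W τ i * f i)) ⟩
      sum (λ y → sum λ i → δ (coord i l) y * (W τ i * f i))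
        ≈⟨ sum-cong (λ y → trans (sum-cong (term y)) (sym (*-sum (ind (y Subset.∈? S l)) (λ i → W (τ ∪ ⁅ y ⁆) i * f i)))) ⟩
      sum (λ y → ind (y Subset.∈? S l) * ⟪ f ⟫ (τ ∪ ⁅ y ⁆)) ∎
      where
      open ≈-Reasoning
      δ≈ : ∀ y i → δ (coord i l) y ≈ ind (y Subset.∈? S l) * ind (y Subset.∈? top i)
      δ≈ y i = trans
        (ind-cong (coord i l Fin.≟ y) ((y Subset.∈? S l) ×-dec (y Subset.∈? top i))
          (λ { ≡.refl → coord∈S i l , coord∈top i l }) (λ (y∈S , y∈σ) → coord-unique i l y∈σ y∈S))
        (ind-× (y Subset.∈? S l) (y Subset.∈? top i))
      term : ∀ y i → δ (coord i l) y * (W τ i * f i) ≈ ind (y Subset.∈? S l) * (W (τ ∪ ⁅ y ⁆) i * f i)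
      term y i = trans (*-congʳ (δ≈ y i)) (trans
        (solve 4 (λ s t w f → s :* t :* (w :* f) := s :* (w :* t :* f)) refl (ind (y Subset.∈? S l)) (ind (y Subset.∈? top i)) (W τ i) (f i))
        (*-congˡ (*-congʳ (sym (W-∪ τ y i)))))

-- The weighted graph of a link and its spectral gap

module LocalMixing {c ℓ₁ ℓ₂} (ℝ : Reals c ℓ₁ ℓ₂) {N} (X : Complex N) (n : ℕ)
  (pure : Pure X n) (connected : ConnectedLinks X n) where
  open OrderedFieldProperties (Reals.orderedField ℝ)
  open QuadraticForms (Reals.orderedField ℝ)
  open Counting (Reals.orderedField ℝ)
  open TopSimplices (Reals.orderedField ℝ) X n
  open Coverings pure
  open SubsetSizes
  open SpectralGap ℝ using (spectral-gap)

  -- With n = |τ| + m + 1, a top simplex through τ has m + 2 vertices outside τ, so the link has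
  -- dimension m + 1, which is at least 1.
  module LinkGraph (τ : Subset N) (τ-simplex : Simplex X τ) (m : ℕ) (n≡ : n ≡ ∣ τ ∣ ℕ.+ suc m) where

    Outside : Fin #tops → Fin N → Set
    Outside i v = v ∈ top i × v ∉ τ

    Outside? : ∀ i v → Dec (Outside i v)
    Outside? i v = (v Subset.∈? top i) ×-dec ¬? (v Subset.∈? τ)

    ρ : Fin #tops → Fin N → Carrier
    ρ i v = ind (Outside? i v)

    Edge? : ∀ i u v → Dec (Outside i u × Outside i v × u ≢ v)
    Edge? i u v = Outside? i u ×-dec (Outside? i v ×-dec ¬? (u Fin.≟ v))

    -- Up to the factor m !, the weights of the edges and of the vertices of the link.
    A : Matrix N
    A u v = sum λ i → W τ i * ind (Edge? i u v)

    d : Fin N → Carrier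
    d v = fromℕ (suc m) * ⟪ (λ i → ρ i v) ⟫ τ

    ind-Edge : ∀ i u v → ind (Edge? i u v) ≈ ρ i u * ρ i v - δ u v * ρ i u
    ind-Edge i u v = by-cases (u Fin.≟ v)
      where
      by-cases : (u≟v : Dec (u ≡ v)) →
                 ind (Outside? i u ×-dec (Outside? i v ×-dec ¬? u≟v)) ≈ ρ i u * ρ i v - ind u≟v * ρ i u
      by-cases (yes ≡.refl) = trans
        (ind-no (Outside? i u ×-dec (Outside? i u ×-dec ¬? (yes (≡.refl {x = u})))) (λ (_ , _ , k) → k ≡.refl))
        (sym (trans (+-cong (ind-idem (Outside? i u)) (-‿cong (*-identityˡ (ρ i u)))) (-‿inverseʳ (ρ i u))))
      by-cases (no u≢v) = trans (ind-× (Outside? i u) (Outside? i v ×-dec yes u≢v)) (trans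
            (*-congˡ (ind-× (Outside? i v) (yes u≢v)))
        (solve 2 (λ x y → x :* (y :* con (+ 1)) := x :* y :- con (+ 0) :* x) refl (ρ i u) (ρ i v)))

    sum-ρ : ∀ i → τ ⊆ top i → sum (ρ i) ≈ fromℕ (suc (suc m))
    sum-ρ i τ⊆σ = begin
      sum (ρ i)
        ≈⟨ sum-cong term ⟩
      sum (λ v → ind (v Subset.∈? top i) + - ind (v Subset.∈? τ))
        ≈⟨ trans (sum-+ (λ v → ind (v Subset.∈? top i)) (λ v → - ind (v Subset.∈? τ))) (+-congˡ (sum-neg
              (λ v → ind (v Subset.∈? τ)))) ⟩
      sum (λ v → ind (v Subset.∈? top i)) - sum (λ v → ind (v Subset.∈? τ))
        ≈⟨ +-cong (fromℕ-∣p∣ (top i)) (-‿cong (fromℕ-∣p∣ τ)) ⟨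
      fromℕ (∣ top i ∣) - t
        ≈⟨ +-congʳ (fromℕ-cong (≡.trans (proj₂ (top-sized i)) (≡.trans (≡.cong suc n≡)
             (≡.trans (≡.sym (ℕ.+-suc ∣ τ ∣ (suc m))) (ℕ.+-comm ∣ τ ∣ (suc (suc m))))))) ⟩
      fromℕ (suc (suc m) ℕ.+ ∣ τ ∣) - t
        ≈⟨ +-congʳ (fromℕ-+ (suc (suc m)) ∣ τ ∣) ⟩
      fromℕ (suc (suc m)) + t - t
        ≈⟨ solve 2 (λ x y → x :+ y :- y := x) refl (fromℕ (suc (suc m))) t ⟩
      fromℕ (suc (suc m)) ∎
      where
      open ≈-Reasoning
      t = fromℕ (∣ τ ∣)
      term : ∀ v → ρ i v ≈ ind (v Subset.∈? top i) + - ind (v Subset.∈? τ)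
      term v = by-cases (v Subset.∈? τ)
        where
        by-cases : (v∈?τ : Dec (v ∈ τ)) → ind ((v Subset.∈? top i) ×-dec ¬? v∈?τ) ≈ ind (v Subset.∈? top i) + - ind v∈?τ
        by-cases (yes v∈τ) = trans (ind-no ((v Subset.∈? top i) ×-dec ¬? (yes v∈τ)) (λ (_ , k) → k v∈τ))
          (sym (trans (+-congʳ (ind-yes (v Subset.∈? top i) (τ⊆σ v∈τ))) (-‿inverseʳ 1#)))
        by-cases (no v∉τ) = trans (ind-× (v Subset.∈? top i) (yes v∉τ)) (trans (*-identityʳ _) (sym (x-0≈x _)))

    A-sym : Symmetric A
    A-sym u v = sum-cong λ i → *-congˡ (ind-cong (Edge? i u v) (Edge? i v u)
      (λ (p , q , u≢v) → q , p , u≢v ∘ ≡.sym) (λ (p , q , u≢v) → q , p , u≢v ∘ ≡.sym))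

    A-integer : ∀ u v → IsInteger (A u v)
    A-integer u v = integer-sum λ i → integer-* (integer-ind (τ Subset.⊆? top i)) (integer-ind (Edge? i u v))

    d-integer : ∀ v → IsInteger (d v)
    d-integer v = integer-* (integer-fromℕ (suc m)) (integer-sum λ i → integer-* (integer-ind (τ Subset.⊆? top i)) (integer-ind (Outside? i v)))

    A≥0 : ∀ u v → A u v ≥0
    A≥0 u v = ⟪⟫-≥0 τ λ i → ind-≥0 (Edge? i u v)

    -- In a top simplex through τ and `u`, each of the m + 1 other vertices outside τ is the second
    -- end of one edge at `u`.
    row-sum : ∀ u → sum (A u) ≈ d u
    row-sum u = begin
      sum (λ v → sum λ i → W τ i * ind (Edge? i u v))
        ≈⟨ ∑-comm (λ v i → W τ i * ind (Edge? i u v)) ⟩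
      sum (λ i → sum λ v → W τ i * ind (Edge? i u v))
        ≈⟨ sum-cong (λ i → sym (*-sum (W τ i) (λ v → ind (Edge? i u v)))) ⟩
      ⟪ (λ i → sum λ v → ind (Edge? i u v)) ⟫ τ
        ≈⟨ ⟪⟫-cong τ inner ⟩
      ⟪ (λ i → fromℕ (suc m) * ρ i u) ⟫ τ
        ≈⟨ ⟪⟫-* (fromℕ (suc m)) (λ i → ρ i u) τ ⟩
      d u ∎
      where
      open ≈-Reasoning
      inner : ∀ i → τ ⊆ top i → sum (λ v → ind (Edge? i u v)) ≈ fromℕ (suc m) * ρ i u
      inner i τ⊆σ = begin
        sum (λ v → ind (Edge? i u v))
          ≈⟨ sum-cong (λ v → trans (ind-Edge i u v) (+-congˡ (solve 2 (λ x y → :- (x :* y)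
                := x :* :- y) refl (δ u v) (ρ i u)))) ⟩
        sum (λ v → ρ i u * ρ i v + δ u v * - ρ i u)
          ≈⟨ sum-+ (λ v → ρ i u * ρ i v) (λ v → δ u v * - ρ i u) ⟩
        sum (λ v → ρ i u * ρ i v) + sum (λ v → δ u v * - ρ i u)
          ≈⟨ +-cong (trans (sym (*-sum (ρ i u) (ρ i))) (*-congˡ (sum-ρ i (λ {x} → τ⊆σ {x})))) (sum-δ u (λ _ → - ρ i u)) ⟩
        ρ i u * fromℕ (suc (suc m)) - ρ i u
          ≈⟨ solve 2 (λ r x → r :* (con (+ 1) :+ x) :- r := x :* r) refl (ρ i u) (fromℕ (suc m)) ⟩
        fromℕ (suc m) * ρ i u ∎

    pull : ∀ (f : Fin #tops → Fin N → Carrier) →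
           sum (λ v → ⟪ (λ i → f i v) ⟫ τ) ≈ ⟪ (λ i → sum (f i)) ⟫ τ
    pull f = trans (∑-comm (λ v i → W τ i * f i v)) (sum-cong λ i → sym (*-sum (W τ i) (f i)))

    d∙ : ∀ g → d ∙ g ≈ fromℕ (suc m) * ⟪ (λ i → sum λ v → ρ i v * g v) ⟫ τ
    d∙ g = trans (sum-cong λ v → trans (*-assoc (fromℕ (suc m)) (⟪ (λ i → ρ i v) ⟫ τ) (g v)) (*-congˡ
        (trans (sum-* (g v) (λ i → W τ i * ρ i v)) (sum-cong λ i → *-assoc (W τ i) (ρ i v) (g v)))))
      (trans (sym (*-sum (fromℕ (suc m)) (λ v → ⟪ (λ i → ρ i v * g v) ⟫ τ))) (*-congˡ (pull (λ i v → ρ i v * g v))))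

    -- Within one simplex, the sum over ordered pairs of distinct vertices is the square of the sum
    -- minus the sum of the squares. The form becomes an average over top simplices, in which the
    -- sides can be told apart.
    Q-A : ∀ φ → Q A φ ≈ ⟪ (λ i → (sum λ v → ρ i v * φ v) * (sum λ v → ρ i v * φ v) - sum λ v → ρ i v * (φ v * φ v)) ⟫ τ
    Q-A φ = begin
      sum (λ u → φ u * sum λ v → A u v * φ v)
        ≈⟨ sum-cong (λ u → trans (*-sum (φ u) (λ v → A u v * φ v)) (sum-cong λ v → entry u v)) ⟩
      sum (λ u → sum λ v → ⟪ (λ i → ind (Edge? i u v) * (φ u * φ v)) ⟫ τ)
        ≈⟨ trans (sum-cong λ u → pull (λ i v → ind (Edge? i u v) * (φ u * φ v))) (pull
              (λ i u → sum λ v → ind (Edge? i u v) * (φ u * φ v))) ⟩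
      ⟪ (λ i → sum λ u → sum λ v → ind (Edge? i u v) * (φ u * φ v)) ⟫ τ
        ≈⟨ ⟪⟫-cong τ (λ i _ → square i) ⟩
      ⟪ (λ i → (sum λ v → ρ i v * φ v) * (sum λ v → ρ i v * φ v) - sum λ v → ρ i v * (φ v * φ v)) ⟫ τ ∎
      where
      open ≈-Reasoning
      entry : ∀ u v → φ u * (A u v * φ v) ≈ ⟪ (λ i → ind (Edge? i u v) * (φ u * φ v)) ⟫ τ
      entry u v = trans (solve 3 (λ x a y → x :* (a :* y) := a :* (x :* y)) refl (φ u) (A u v) (φ v))
        (trans (sum-* (φ u * φ v) (λ i → W τ i * ind (Edge? i u v)))
              (sum-cong λ i → *-assoc (W τ i) (ind (Edge? i u v)) (φ u * φ v)))
      square : ∀ i → sum (λ u → sum λ v → ind (Edge? i u v) * (φ u * φ v)) ≈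
               (sum λ v → ρ i v * φ v) * (sum λ v → ρ i v * φ v) - sum λ v → ρ i v * (φ v * φ v)
      square i = begin
        sum (λ u → sum λ v → ind (Edge? i u v) * (φ u * φ v))
          ≈⟨ sum-cong (λ u → trans
               (sum-cong λ v → trans (*-congʳ (ind-Edge i u v))
                 (solve 5 (λ r s e x y → (r :* s :- e :* r) :* (x :* y) := r :* x :* (s :* y) :+ e :* (:- (r :* (x :* y))))
                   refl (ρ i u) (ρ i v) (δ u v) (φ u) (φ v)))
               (trans (sum-+ (λ v → ρ i u * φ u * (ρ i v * φ v)) (λ v → δ u v * (- (ρ i u * (φ u * φ v)))))
                 (+-cong (sym (*-sum (ρ i u * φ u) (λ v → ρ i v * φ v))) (sum-δ u (λ v → - (ρ i u * (φ u * φ v))))))) ⟩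
        sum (λ u → ρ i u * φ u * R + - (ρ i u * (φ u * φ u)))
          ≈⟨ trans (sum-+ (λ u → ρ i u * φ u * R) (λ u → - (ρ i u * (φ u * φ u))))
               (+-cong (sym (sum-* R (λ u → ρ i u * φ u))) (sum-neg (λ u → ρ i u * (φ u * φ u)))) ⟩
        R * R - sum (λ v → ρ i v * (φ v * φ v)) ∎
        where R = sum λ v → ρ i v * φ v

    n∸∣τ∣≡1+m : n ℕ.∸ ∣ τ ∣ ≡ suc m
    n∸∣τ∣≡1+m = ≡.trans (≡.cong (ℕ._∸ ∣ τ ∣) n≡) (ℕ.m+n∸m≡n ∣ τ ∣ (suc m))

    n∸1+∣τ∣≡m : n ℕ.∸ suc ∣ τ ∣ ≡ m
    n∸1+∣τ∣≡m = ≡.trans (≡.cong (ℕ._∸ suc ∣ τ ∣) (≡.trans n≡ (ℕ.+-suc ∣ τ ∣ m))) (ℕ.m+n∸m≡n (suc ∣ τ ∣) m)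

    outside⇒vertex : ∀ {i v} → τ ⊆ top i → Outside i v → LinkVertex X τ v
    outside⇒vertex {i} {v} τ⊆σ (v∈σ , v∉τ) =
        (⊆-closed X (⁅x⁆⊆ v∈σ) (proj₁ (top-sized i)) , Subset.∣⁅x⁆∣≡1 v)
      , (⊆-closed X (∪-least {p = τ} (λ {x} → τ⊆σ {x}) (⁅x⁆⊆ v∈σ)) (proj₁ (top-sized i))
        , ≡.trans (∣p∪⁅x⁆∣≡1+∣p∣ τ v∉τ) (ℕ.+-comm 1 ∣ τ ∣))

    vertex∉τ : ∀ {v} → LinkVertex X τ v → v ∉ τ
    vertex∉τ {v} (_ , _ , size) v∈τ = ℕ.<-irrefl ≡.refl (ℕ.≤-trans (ℕ.≤-reflexive (≡.trans (ℕ.+-comm 1 ∣ τ ∣) (≡.sym size)))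
      (Subset.p⊆q⇒∣p∣≤∣q∣ (∪-least {p = τ} (λ z → z) (⁅x⁆⊆ v∈τ))))

    0<d⇒vertex : ∀ v → 0# < d v → LinkVertex X τ v
    0<d⇒vertex v 0<d with Fin.any? (λ i → (τ Subset.⊆? top i) ×-dec Outside? i v)
    ... | yes (i , τ⊆σ , out) = outside⇒vertex (λ {x} → τ⊆σ {x}) out
    ... | no ¬∃ = contradiction 0<d (≤-reflexive (trans (*-congˡ (sum-zero λ i →
        trans (sym (ind-× (τ Subset.⊆? top i) (Outside? i v))) (ind-no ((τ Subset.⊆? top i) ×-dec Outside? i v) λ p → ¬∃ (i , p)))) (zeroʳ _)))

    -- The homogeneous weight has the factorial (m + 1)! at a vertex of the link and m ! at an edge;
    -- their quotient m + 1 is the factor in `d`.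
    weight-vertex : ∀ v → LinkVertex X τ v → fromℕ (weight X n (τ ∪ ⁅ v ⁆)) ≈ fromℕ (m !) * d v
    weight-vertex v v-link = begin
      fromℕ ((suc n ℕ.∸ ∣ τ ∪ ⁅ v ⁆ ∣) ! ℕ.* topDegree X n (τ ∪ ⁅ v ⁆))
        ≈⟨ fromℕ-* ((suc n ℕ.∸ ∣ τ ∪ ⁅ v ⁆ ∣) !) _ ⟩
      fromℕ ((suc n ℕ.∸ ∣ τ ∪ ⁅ v ⁆ ∣) !) * fromℕ (topDegree X n (τ ∪ ⁅ v ⁆))
        ≈⟨ *-cong (fromℕ-cong (≡.cong _! (≡.trans (≡.cong (suc n ℕ.∸_) (∣p∪⁅x⁆∣≡1+∣p∣ τ v∉τ)) n∸∣τ∣≡1+m)))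
             (trans (fromℕ-topDegree (τ ∪ ⁅ v ⁆)) (sum-cong term)) ⟩
      fromℕ (suc m ℕ.* m !) * ⟪ (λ i → ρ i v) ⟫ τ
        ≈⟨ *-congʳ (fromℕ-* (suc m) (m !)) ⟩
      fromℕ (suc m) * fromℕ (m !) * ⟪ (λ i → ρ i v) ⟫ τ
        ≈⟨ solve 3 (λ x y z → x :* y :* z := y :* (x :* z)) refl (fromℕ (suc m)) (fromℕ (m !)) (⟪ (λ i → ρ i v) ⟫ τ) ⟩
      fromℕ (m !) * d v ∎
      where
      open ≈-Reasoning
      v∉τ = vertex∉τ v-link
      term : ∀ i → W (τ ∪ ⁅ v ⁆) i ≈ W τ i * ρ i v
      term i = trans (W-∪ τ v i) (*-congˡ (ind-cong (v Subset.∈? top i) (Outside? i v) (λ v∈σ → v∈σ , v∉τ) proj₁))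

    edge-assoc : ∀ u v → τ ∪ (⁅ u ⁆ ∪ ⁅ v ⁆) ≡ (τ ∪ ⁅ u ⁆) ∪ ⁅ v ⁆
    edge-assoc u v = ≡.sym (Subset.∪-assoc τ ⁅ u ⁆ ⁅ v ⁆)

    edge-outside : ∀ {u v} → LinkEdge X τ u v → u ∉ τ × v ∉ τ × u ≢ v
    edge-outside {u} {v} ((_ , size₂) , _ , size) = u∉τ , v∉τ , u≢v
      where
      size′ : ∣ (τ ∪ ⁅ u ⁆) ∪ ⁅ v ⁆ ∣ ≡ suc (suc ∣ τ ∣)
      size′ = ≡.trans (≡.cong ∣_∣ (≡.sym (edge-assoc u v))) (≡.trans size (ℕ.+-comm ∣ τ ∣ 2))
      too-big : ∀ {k} → ¬ (suc k ℕ.≤ k)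
      too-big = ℕ.<-irrefl ≡.refl
      u∉τ : u ∉ τ
      u∉τ u∈τ = too-big (ℕ.≤-trans (ℕ.≤-reflexive (≡.sym size′)) (ℕ.≤-trans (∣p∪⁅x⁆∣≤1+∣p∣ (τ ∪ ⁅ u ⁆) v)
        (ℕ.s≤s (Subset.p⊆q⇒∣p∣≤∣q∣ (∪-least {p = τ} (λ z → z) (⁅x⁆⊆ u∈τ))))))
      v∉τ : v ∉ τ
      v∉τ v∈τ = too-big (ℕ.≤-trans (ℕ.≤-reflexive (≡.sym size′)) (ℕ.≤-trans
        (Subset.p⊆q⇒∣p∣≤∣q∣ (∪-least {p = τ ∪ ⁅ u ⁆} (λ z → z) (⁅x⁆⊆
              (Subset.p⊆p∪q {p = τ} ⁅ u ⁆ v∈τ)))) (∣p∪⁅x⁆∣≤1+∣p∣ τ u)))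
      u≢v : u ≢ v
      u≢v ≡.refl = too-big (ℕ.≤-reflexive (≡.trans (≡.sym size₂) (≡.trans (≡.cong ∣_∣ (Subset.∪-idem ⁅ u ⁆))
            (Subset.∣⁅x⁆∣≡1 u))))

    outside⇒edge : ∀ {i u v} → τ ⊆ top i → Outside i u × Outside i v × u ≢ v → LinkEdge X τ u v
    outside⇒edge {i} {u} {v} τ⊆σ ((u∈σ , u∉τ) , (v∈σ , v∉τ) , u≢v) =
        (⊆-closed X uv⊆σ (proj₁ (top-sized i))
        , ≡.trans (∣p∪⁅x⁆∣≡1+∣p∣ ⁅ u ⁆ (Subset.x≢y⇒x∉⁅y⁆ (u≢v ∘ ≡.sym))) (≡.cong suc (Subset.∣⁅x⁆∣≡1 u)))
      , (⊆-closed X (∪-least {p = τ} (λ {x} → τ⊆σ {x}) uv⊆σ) (proj₁ (top-sized i))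
        , ≡.trans (≡.cong ∣_∣ (edge-assoc u v)) (≡.trans (∣p∪⁅x⁆∣≡1+∣p∣ (τ ∪ ⁅ u ⁆) v∉τu)
            (≡.trans (≡.cong suc (∣p∪⁅x⁆∣≡1+∣p∣ τ u∉τ)) (ℕ.+-comm 2 ∣ τ ∣))))
      where
      uv⊆σ : ⁅ u ⁆ ∪ ⁅ v ⁆ ⊆ top i
      uv⊆σ = ∪-least {p = ⁅ u ⁆} (⁅x⁆⊆ u∈σ) (⁅x⁆⊆ v∈σ)
      v∉τu : v ∉ τ ∪ ⁅ u ⁆
      v∉τu v∈ = [ v∉τ , (λ v∈⁅u⁆ → u≢v (≡.sym (Subset.x∈⁅y⁆⇒x≡y u v∈⁅u⁆))) ]′ (Subset.x∈p∪q⁻ τ ⁅ u ⁆ v∈)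

    W-edge : ∀ {u v} → LinkEdge X τ u v → ∀ i → W (τ ∪ (⁅ u ⁆ ∪ ⁅ v ⁆)) i ≈ W τ i * ind (Edge? i u v)
    W-edge {u} {v} edge i = trans
      (ind-cong ((τ ∪ (⁅ u ⁆ ∪ ⁅ v ⁆)) Subset.⊆? top i) ((τ Subset.⊆? top i) ×-dec Edge? i u v)
        (λ p → (λ {x} x∈τ → p (Subset.p⊆p∪q {p = τ} (⁅ u ⁆ ∪ ⁅ v ⁆) x∈τ))
          , (p (Subset.q⊆p∪q τ (⁅ u ⁆ ∪ ⁅ v ⁆) (Subset.p⊆p∪q {p = ⁅ u ⁆} ⁅ v ⁆ (Subset.x∈⁅x⁆ u))) , proj₁ out)
          , (p (Subset.q⊆p∪q τ (⁅ u ⁆ ∪ ⁅ v ⁆) (Subset.q⊆p∪q ⁅ u ⁆ ⁅ v ⁆ (Subset.x∈⁅x⁆ v))) , proj₁ (proj₂ out))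
          , proj₂ (proj₂ out))
        (λ { (τ⊆σ , (u∈σ , _) , (v∈σ , _) , _) {x} →
          ∪-least {p = τ} {q = ⁅ u ⁆ ∪ ⁅ v ⁆} (λ {y} → τ⊆σ {y}) (∪-least {p = ⁅ u ⁆} (⁅x⁆⊆ u∈σ) (⁅x⁆⊆ v∈σ)) {x} }))
      (ind-× (τ Subset.⊆? top i) (Edge? i u v))
      where out = edge-outside edge

    weight-edge : ∀ {u v} → LinkEdge X τ u v → fromℕ (weight X n (τ ∪ (⁅ u ⁆ ∪ ⁅ v ⁆))) ≈ fromℕ (m !) * A u v
    weight-edge {u} {v} edge@(_ , _ , size) = trans (fromℕ-* ((suc n ℕ.∸ ∣ τ ∪ (⁅ u ⁆ ∪ ⁅ v ⁆) ∣) !) _)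
      (*-cong (fromℕ-cong (≡.cong _! (≡.trans (≡.cong (suc n ℕ.∸_) (≡.trans size (ℕ.+-comm ∣ τ ∣ 2))) n∸1+∣τ∣≡m)))
        (trans (fromℕ-topDegree (τ ∪ (⁅ u ⁆ ∪ ⁅ v ⁆))) (sum-cong (W-edge edge))))

    edge⇒0<A : ∀ {u v} → LinkEdge X τ u v → 0# < A u v
    edge⇒0<A {u} {v} edge = <-respʳ (trans (fromℕ-topDegree (τ ∪ (⁅ u ⁆ ∪ ⁅ v ⁆))) (sum-cong (W-edge edge)))
      (topDegree-pos (proj₁ (proj₂ edge)))

    no-edge⇒A≈0 : ∀ {u v} → ¬ LinkEdge X τ u v → A u v ≈ 0#
    no-edge⇒A≈0 {u} {v} ¬edge = sum-zero λ i → trans (sym (ind-× (τ Subset.⊆? top i) (Edge? i u v)))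
      (ind-no ((τ Subset.⊆? top i) ×-dec Edge? i u v) λ (τ⊆σ , out) → ¬edge (outside⇒edge (λ {x} → τ⊆σ {x}) out))

    connected-A : ∀ (φ : Fin N → Carrier) → (∀ u v → 0# < A u v → φ u ≈ φ v) →
                  ∀ u v → 0# < d u → 0# < d v → φ u ≈ φ v
    connected-A φ e u v 0<du 0<dv = along (connected τ τ-simplex
      (≡.subst (∣ τ ∣ ℕ.<_) (≡.sym n≡) (ℕ.m<m+n ∣ τ ∣ (ℕ.s≤s ℕ.z≤n))) u v (0<d⇒vertex u 0<du) (0<d⇒vertex v 0<dv))
      where
      along : ∀ {u v} → Star (LinkEdge X τ) u v → φ u ≈ φ v
      along Star.ε = refl
      along (edge Star.◅ path) = trans (e _ _ (edge⇒0<A edge)) (along path)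

    -- The walk is the adjacency normalised by the degrees, the common m ! cancelling. Positivity of
    -- `d v` keeps the denominator away from the junk value of division by zero.
    walk-A : ∀ φ v → 0# < d v → fromℕ (m !) * (d v * walk ℝ X n τ φ v) ≈ fromℕ (m !) * apply A φ v
    walk-A φ v 0<d = begin
      fromℕ (m !) * (d v * walk ℝ X n τ φ v)
        ≈⟨ trans (sym (*-assoc _ _ _)) (*-congʳ (sym w≈)) ⟩
      fromℕ w * walk ℝ X n τ φ v
        ≈⟨ *-sum (fromℕ w) (λ u → if does (link? X τ 2 (⁅ u ⁆ ∪ ⁅ v ⁆))
             then fromℕ (weight X n (τ ∪ (⁅ u ⁆ ∪ ⁅ v ⁆))) /ℕ w * φ u else 0#) ⟩
      sum (λ u → fromℕ w * (if does (link? X τ 2 (⁅ u ⁆ ∪ ⁅ v ⁆))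
             then fromℕ (weight X n (τ ∪ (⁅ u ⁆ ∪ ⁅ v ⁆))) /ℕ w * φ u else 0#))
        ≈⟨ sum-cong (λ u → term u (link? X τ 2 (⁅ u ⁆ ∪ ⁅ v ⁆))) ⟩
      sum (λ u → fromℕ (m !) * (A v u * φ u))
        ≈⟨ *-sum (fromℕ (m !)) (λ u → A v u * φ u) ⟨
      fromℕ (m !) * apply A φ v ∎
      where
      open ≈-Reasoning
      w = weight X n (τ ∪ ⁅ v ⁆)
      w≈ : fromℕ w ≈ fromℕ (m !) * d v
      w≈ = weight-vertex v (0<d⇒vertex v 0<d)
      w-nonZero : NonZero w
      w-nonZero = ℕ.≢-nonZero λ w≡0 → ≤-reflexive (fromℕ-cong w≡0)
        (<-respʳ (sym w≈) (*-pos (fromℕ-pos′ (m !) {{m ℕ.!≢0}}) 0<d))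
      term : ∀ u (edge? : Dec (LinkEdge X τ u v)) →
             fromℕ w * (if does edge? then fromℕ (weight X n (τ ∪ (⁅ u ⁆ ∪ ⁅ v ⁆))) /ℕ w * φ u else 0#)
             ≈ fromℕ (m !) * (A v u * φ u)
      term u (yes edge) = trans (sym (*-assoc _ _ (φ u))) (trans (*-congʳ (trans (/ℕ-*-cancel _ w {{w-nonZero}})
        (trans (weight-edge edge) (*-congˡ (A-sym u v))))) (*-assoc _ _ (φ u)))
      term u (no ¬edge) = trans (zeroʳ _) (sym (trans (*-congˡ (trans (*-congʳ
            (trans (A-sym v u) (no-edge⇒A≈0 ¬edge))) (zeroˡ _))) (zeroʳ _)))

    module _ (λ′ : Carrier) (0<λ′ : 0# < λ′) (bound : LocalSpectralBound ℝ X n λ′) where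

      eigenvalue-bound : ∀ μ φ → (∃[ v ] 0# < d v × φ v # 0#) →
                         (∀ v → 0# < d v → apply A φ v ≈ μ * (d v * φ v)) → μ ≤ λ′ ⊎ μ ≈ 1#
      eigenvalue-bound μ φ (v , 0<d , φ#0) e = case bound τ τ-simplex
        (≡.subst (∣ τ ∣ ℕ.<_) (≡.sym n≡) (ℕ.m<m+n ∣ τ ∣ (ℕ.s≤s ℕ.z≤n)))
        μ (φ , (v , 0<d⇒vertex v 0<d , φ#0) , λ v v-link → eigen v (0<d′ v v-link)) of λ where
          (inj₁ (_ , μ≤λ)) → inj₁ μ≤λ
          (inj₂ μ≈1)       → inj₂ μ≈1
        where
        0<d′ : ∀ v → LinkVertex X τ v → 0# < d v
        0<d′ v v-link = *-cancelˡ-pos (fromℕ-≥0 (m !)) (<-respʳ (weight-vertex v v-link)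
          (<-respʳ (sym (fromℕ-* ((suc n ℕ.∸ ∣ τ ∪ ⁅ v ⁆ ∣) !) _)) (*-pos
            (fromℕ-pos′ ((suc n ℕ.∸ ∣ τ ∪ ⁅ v ⁆ ∣) !) {{(suc n ℕ.∸ ∣ τ ∪ ⁅ v ⁆ ∣) ℕ.!≢0}})
            (topDegree-pos (proj₁ (proj₂ v-link))))))
        eigen : ∀ v → 0# < d v → walk ℝ X n τ φ v ≈ μ * φ v
        eigen v 0<d = *-cancelˡ-≈ 0<d (trans
          (*-cancelˡ-≈ (fromℕ-pos′ (m !) {{m ℕ.!≢0}}) (walk-A φ v 0<d))
          (trans (e v 0<d) (solve 3 (λ μ d φ → μ :* (d :* φ) := d :* (μ :* φ)) refl μ (d v) (φ v))))

      link-spectral-gap : ∀ φ → d ∙ φ ≈ 0# → Q A φ ≤ λ′ * d ∙ (λ v → φ v * φ v)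
      link-spectral-gap = spectral-gap A d A-sym A-integer d-integer A≥0 row-sum λ′ 0<λ′ eigenvalue-bound connected-A

-- Correlation of one side with a product over others

module Conditioning {c ℓ₁ ℓ₂} (ℝ : Reals c ℓ₁ ℓ₂) {N} (X : Complex N) (n : ℕ)
  (pure : Pure X n) (connected : ConnectedLinks X n)
  (S : Fin (suc n) → Subset N) (partite : Partite X n S)
  (λ′ : Reals.Carrier ℝ) (0<λ′ : Reals._<_ ℝ (Reals.0# ℝ) λ′)
  (bound : LocalSpectralBound ℝ X n λ′) where
  open OrderedFieldProperties (Reals.orderedField ℝ)
  open QuadraticForms (Reals.orderedField ℝ) using (_∙_; Q)
  open TopSimplices (Reals.orderedField ℝ) X n
  open Coverings pure
  open Coordinates pure S partite
  open SubsetSizes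
  open LocalMixing ℝ X n pure connected

  Avoids : Subset N → Fin (suc n) → Set
  Avoids τ k = ∀ v → v ∈ τ → v ∉ S k

  ⟪⟫-linear : ∀ f a g τ → ⟪ (λ i → f i + a * g i) ⟫ τ ≈ ⟪ f ⟫ τ + a * ⟪ g ⟫ τ
  ⟪⟫-linear f a g τ = trans (⟪⟫-+ f (λ i → a * g i) τ) (+-congˡ (⟪⟫-* a g τ))

  Z : Subset N → Carrier
  Z = ⟪ (λ _ → 1#) ⟫

  mean : (Fin #tops → Carrier) → Subset N → Carrier
  mean f τ = ⟪ f ⟫ τ /ℕ topDegree X n τ

  -- Outside the complex both sides are zero. Conditioning may therefore run over all `y` in a side,
  -- whether or not adding `y` to τ gives a simplex.
  Z*mean : ∀ f τ → Z τ * mean f τ ≈ ⟪ f ⟫ τ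
  Z*mean f τ = by-cases (simplex? X τ)
    where
    by-cases : Dec (Simplex X τ) → Z τ * mean f τ ≈ ⟪ f ⟫ τ
    by-cases (yes τ-simplex) = trans (*-congʳ (⟪1⟫≈topDegree τ)) (/ℕ-*-cancel (⟪ f ⟫ τ) (topDegree X n τ)
      {{ℕ.≢-nonZero λ t≡0 → ≤-reflexive (fromℕ-cong t≡0) (topDegree-pos τ-simplex)}})
    by-cases (no ¬τ) = trans (*-congʳ (⟪⟫-zero τ (λ _ → 1#) (nonsimplex⇒not-covered ¬τ)))
      (trans (zeroˡ _) (sym (⟪⟫-zero τ f (nonsimplex⇒not-covered ¬τ))))

  variance : ∀ f τ a → Z τ * a ≈ ⟪ f ⟫ τ →
             ⟪ (λ i → (f i - a) * (f i - a)) ⟫ τ ≈ ⟪ (λ i → f i * f i) ⟫ τ - a * a * Z τ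
  variance f τ a Za≈ = begin
    ⟪ (λ i → (f i - a) * (f i - a)) ⟫ τ
      ≈⟨ ⟪⟫-cong τ (λ i _ → solve 2 (λ x a → (x :- a) :* (x :- a)
            := x :* x :+ :- (a :+ a) :* x :+ a :* a :* con (+ 1)) refl (f i) a) ⟩
    ⟪ (λ i → f i * f i + - (a + a) * f i + a * a * 1#) ⟫ τ
      ≈⟨ trans (⟪⟫-linear (λ i → f i * f i + - (a + a) * f i) (a * a) (λ _ → 1#) τ) (+-congʳ (⟪⟫-linear
            (λ i → f i * f i) (- (a + a)) f τ)) ⟩
    ⟪ (λ i → f i * f i) ⟫ τ + - (a + a) * ⟪ f ⟫ τ + a * a * Z τ
      ≈⟨ +-congʳ (+-congˡ (*-congˡ (sym Za≈))) ⟩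
    ⟪ (λ i → f i * f i) ⟫ τ + - (a + a) * (Z τ * a) + a * a * Z τ
      ≈⟨ solve 3 (λ q a z → q :+ :- (a :+ a) :* (z :* a) :+ a :* a :* z := q :- a :* a :* z) refl (⟪
            (λ i → f i * f i) ⟫ τ) a (Z τ) ⟩
    ⟪ (λ i → f i * f i) ⟫ τ - a * a * Z τ ∎
    where open ≈-Reasoning

  variance-≤ : ∀ f τ a → Z τ * a ≈ ⟪ f ⟫ τ →
               ⟪ (λ i → (f i - a) * (f i - a)) ⟫ τ ≤ ⟪ (λ i → f i * f i) ⟫ τ
  variance-≤ f τ a Za≈ = ≤-trans (≤-reflexive (variance f τ a Za≈)) (x-y≥0⇒y≤x (≤-trans
    (*-≥0 (square-≥0 a) (⟪⟫-≥0 {λ _ → 1#} τ λ _ → 0≤1))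
    (≤-reflexive (solve 2 (λ q z → z := q :- (q :- z)) refl (⟪ (λ i → f i * f i) ⟫ τ) (a * a * Z τ)))))

  mean-square-≤ : ∀ f τ a → Z τ * a ≈ ⟪ f ⟫ τ → a * a * Z τ ≤ ⟪ (λ i → f i * f i) ⟫ τ
  mean-square-≤ f τ a Za≈ = x-y≥0⇒y≤x (≤-trans (⟪⟫-≥0 τ λ i → square-≥0 (f i - a)) (≤-reflexive (variance f τ a Za≈)))

  κ : Carrier
  κ = fromℕ n * λ′

  κ≥0 : κ ≥0
  κ≥0 = *-≥0 (fromℕ-≥0 n) (<⇒≤ 0<λ′)

  infix 4 _⊥[_,_]_
  -- Approximate orthogonality given τ, stated without square roots and with sums on both sides, so
  -- that it can be added up by `disintegrate`.
  _⊥[_,_]_ : (Fin #tops → Carrier) → Carrier → Subset N → (Fin #tops → Carrier) → Set _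
  H ⊥[ C , τ ] G = ⟪ (λ i → H i * G i + H i * G i) ⟫ τ ≤ ⟪ (λ i → C * (H i * H i + G i * G i)) ⟫ τ

  at : Fin (suc n) → (Fin N → Carrier) → Fin #tops → Carrier
  at k a i = a (coord i k)

  module _ (τ : Subset N) (k l : Fin (suc n)) (k≢l : k ≢ l) (τ∌k : Avoids τ k) (τ∌l : Avoids τ l) where

    module _ (τ-simplex : Simplex X τ) (m : ℕ) (n≡ : n ≡ ∣ τ ∣ ℕ.+ suc m) where
      open LinkGraph τ τ-simplex m n≡

      side-sum : ∀ {j} → Avoids τ j → ∀ g i → sum (λ v → ρ i v * (ind (v Subset.∈? S j) * g v)) ≈ g (coord i j)
      side-sum {j} τ∌j g i = trans (sum-cong term) (sum-δ (coord i j) g)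
        where
        term : ∀ v → ρ i v * (ind (v Subset.∈? S j) * g v) ≈ δ (coord i j) v * g v
        term v = trans (sym (*-assoc _ _ _)) (*-congʳ (trans (sym (ind-× (Outside? i v) (v Subset.∈? S j)))
          (ind-cong (Outside? i v ×-dec (v Subset.∈? S j)) (coord i j Fin.≟ v)
            (λ ((v∈σ , _) , v∈S) → coord-unique i j v∈σ v∈S)
            (λ { ≡.refl → (coord∈top i j , λ v∈τ → τ∌j (coord i j) v∈τ (coord∈S i j)) , coord∈S i j }))))

      two-sides : ∀ g h i → sum (λ v → ρ i v * (ind (v Subset.∈? S k) * g v + ind (v Subset.∈? S l) * h v)) ≈ at k g i + at l h i
      two-sides g h i = trans (sum-cong λ v → distribˡ (ρ i v) _ _) (trans
        (sum-+ (λ v → ρ i v * (ind (v Subset.∈? S k) * g v)) (λ v → ρ i v * (ind (v Subset.∈? S l) * h v)))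
        (+-cong (side-sum τ∌k g i) (side-sum τ∌l h i)))

      -- Take the function equal to `a` on side `k`, to `b` on side `l` and to 0 elsewhere. A top
      -- simplex meets both sides once, so the square of the sum minus the sum of the squares is
      -- 2ab, and the form of the link is the correlation. The degrees contribute the factor m + 1,
      -- which is at most `n`.
      centred-pair-bound : ∀ a b → ⟪ at k a ⟫ τ ≈ 0# → ⟪ at l b ⟫ τ ≈ 0# → at k a ⊥[ κ , τ ] at l b
      centred-pair-bound a b a-mean b-mean = begin
        ⟪ (λ i → α i * β i + α i * β i) ⟫ τ
          ≈⟨ ⟪⟫-cong τ (λ i _ → trans
               (solve 2 (λ x y → x :* y :+ x :* y := (x :+ y) :* (x :+ y) :- (x :* x :+ y :* y)) refl (α i) (β i))
               (sym (+-cong (*-cong (two-sides a b i) (two-sides a b i)) (-‿cong (squares i))))) ⟩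
        ⟪ (λ i → (sum λ v → ρ i v * φ v) * (sum λ v → ρ i v * φ v) - sum λ v → ρ i v * (φ v * φ v)) ⟫ τ
          ≈⟨ Q-A φ ⟨
        Q A φ
          ≤⟨ link-spectral-gap λ′ 0<λ′ bound φ φ-mean ⟩
        λ′ * d ∙ (λ v → φ v * φ v)
          ≈⟨ *-congˡ (trans (d∙ (λ v → φ v * φ v)) (*-congˡ (⟪⟫-cong τ (λ i _ → squares i)))) ⟩
        λ′ * (fromℕ (suc m) * E)
          ≤⟨ *-monoˡ-≤ (<⇒≤ 0<λ′) (*-monoʳ-≤ E≥0 (fromℕ-mono-≤ (ℕ.≤-trans (ℕ.m≤n+m (suc m) ∣ τ ∣)
                (ℕ.≤-reflexive (≡.sym n≡))))) ⟩
        λ′ * (fromℕ n * E)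
          ≈⟨ trans (solve 3 (λ x y e → x :* (y :* e) := y :* x :* e) refl λ′ (fromℕ n) E) (sym (⟪⟫-* κ
                (λ i → α i * α i + β i * β i) τ)) ⟩
        ⟪ (λ i → κ * (α i * α i + β i * β i)) ⟫ τ ∎
        where
        open ≤-Reasoning
        α = at k a
        β = at l b
        E = ⟪ (λ i → α i * α i + β i * β i) ⟫ τ
        E≥0 : E ≥0
        E≥0 = ⟪⟫-≥0 τ λ i → +-≥0 (square-≥0 (α i)) (square-≥0 (β i))
        p q : Fin N → Carrier
        p v = ind (v Subset.∈? S k)
        q v = ind (v Subset.∈? S l)
        φ : Fin N → Carrier
        φ v = p v * a v + q v * b v
        pq≈0 : ∀ v → p v * q v ≈ 0#
        pq≈0 v = trans (sym (ind-× (v Subset.∈? S k) (v Subset.∈? S l)))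
          (ind-no ((v Subset.∈? S k) ×-dec (v Subset.∈? S l)) (λ (v∈k , v∈l) → S-disjoint k≢l v∈k v∈l))
        φ² : ∀ v → φ v * φ v ≈ p v * (a v * a v) + q v * (b v * b v)
        φ² v = trans
          (solve 4 (λ p a q b → (p :* a :+ q :* b) :* (p :* a :+ q :* b)
             := p :* p :* (a :* a) :+ q :* q :* (b :* b) :+ p :* q :* (con (+ 2) :* (a :* b))) refl (p v) (a v) (q v) (b v))
          (trans (+-cong (+-cong (*-congʳ (ind-idem (v Subset.∈? S k))) (*-congʳ (ind-idem (v Subset.∈? S l)))) (trans
                (*-congʳ (pq≈0 v)) (zeroˡ _))) (+-identityʳ _))
        squares : ∀ i → sum (λ v → ρ i v * (φ v * φ v)) ≈ α i * α i + β i * β i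
        squares i = trans (sum-cong λ v → *-congˡ (φ² v)) (two-sides (λ v → a v * a v) (λ v → b v * b v) i)
        φ-mean : d ∙ φ ≈ 0#
        φ-mean = trans (d∙ φ) (trans (*-congˡ (trans (⟪⟫-cong τ (λ i _ → two-sides a b i))
          (trans (⟪⟫-+ α β τ) (trans (+-cong a-mean b-mean) (+-identityʳ 0#))))) (zeroʳ _))

    -- Centring the second function changes nothing on the left, because the first has mean zero,
    -- and it can only lower the second moment on the right.
    pair-bound : ∣ τ ∣ ℕ.< n → ∀ a b → ⟪ at k a ⟫ τ ≈ 0# → at k a ⊥[ κ , τ ] at l b
    pair-bound τ<n a b a-mean = by-cases (simplex? X τ)
      where
      open ≤-Reasoning
      α = at k a
      β = at l b
      by-cases : Dec (Simplex X τ) → α ⊥[ κ , τ ] β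
      by-cases (no ¬τ) = ≤-reflexive (trans (⟪⟫-zero τ (λ i → α i * β i + α i * β i) (nonsimplex⇒not-covered ¬τ))
        (sym (⟪⟫-zero τ (λ i → κ * (α i * α i + β i * β i)) (nonsimplex⇒not-covered ¬τ))))
      by-cases (yes τ-simplex) = begin
        ⟪ (λ i → α i * β i + α i * β i) ⟫ τ
          ≈⟨ trans (sym (+-identityʳ _)) (+-congˡ (sym (trans (*-congˡ a-mean) (zeroʳ _)))) ⟩
        ⟪ (λ i → α i * β i + α i * β i) ⟫ τ + - (μ + μ) * ⟪ α ⟫ τ
          ≈⟨ ⟪⟫-linear (λ i → α i * β i + α i * β i) (- (μ + μ)) α τ ⟨
        ⟪ (λ i → α i * β i + α i * β i + - (μ + μ) * α i) ⟫ τ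
          ≈⟨ ⟪⟫-cong τ (λ i _ → solve 3 (λ x y m → x :* y :+ x :* y :+ :- (m :+ m) :* x
                := x :* (y :- m) :+ x :* (y :- m)) refl (α i) (β i) μ) ⟩
        ⟪ (λ i → α i * (β i - μ) + α i * (β i - μ)) ⟫ τ
          ≤⟨ centred-pair-bound τ-simplex m n≡ a (λ v → b v - μ) a-mean b-mean ⟩
        ⟪ (λ i → κ * (α i * α i + (β i - μ) * (β i - μ))) ⟫ τ
          ≈⟨ trans (⟪⟫-* κ (λ i → α i * α i + (β i - μ) * (β i - μ)) τ) (*-congˡ (⟪⟫-+ (λ i → α i * α i)
                (λ i → (β i - μ) * (β i - μ)) τ)) ⟩
        κ * (⟪ (λ i → α i * α i) ⟫ τ + ⟪ (λ i → (β i - μ) * (β i - μ)) ⟫ τ)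
          ≤⟨ *-monoˡ-≤ κ≥0 (+-mono-≤ ≤-refl (variance-≤ β τ μ (Z*mean β τ))) ⟩
        κ * (⟪ (λ i → α i * α i) ⟫ τ + ⟪ (λ i → β i * β i) ⟫ τ)
          ≈⟨ trans (⟪⟫-* κ (λ i → α i * α i + β i * β i) τ) (*-congˡ (⟪⟫-+ (λ i → α i * α i) (λ i → β i * β i) τ)) ⟨
        ⟪ (λ i → κ * (α i * α i + β i * β i)) ⟫ τ ∎
        where
        μ = mean β τ
        m = proj₁ (ℕ.m≤n⇒∃[o]m+o≡n τ<n)
        n≡ : n ≡ ∣ τ ∣ ℕ.+ suc m
        n≡ = ≡.trans (≡.sym (proj₂ (ℕ.m≤n⇒∃[o]m+o≡n τ<n))) (≡.sym (ℕ.+-suc ∣ τ ∣ m))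
        b-mean : ⟪ (λ i → β i - μ) ⟫ τ ≈ 0#
        b-mean = trans (⟪⟫-cong τ (λ i _ → solve 2 (λ x m → x :- m := x :+ :- m :* con (+ 1)) refl (β i) μ))
          (trans (⟪⟫-linear β (- μ) (λ _ → 1#) τ) (trans (+-congʳ (sym (Z*mean β τ)))
            (solve 2 (λ z m → z :* m :+ :- m :* z := con (+ 0)) refl (Z τ) μ)))

  disintegrate-≤ : ∀ {f g} τ l → (∀ {y} → y ∈ S l → ⟪ f ⟫ (τ ∪ ⁅ y ⁆) ≤ ⟪ g ⟫ (τ ∪ ⁅ y ⁆)) → ⟪ f ⟫ τ ≤ ⟪ g ⟫ τ
  disintegrate-≤ {f} {g} τ l p = ≤-trans (≤-reflexive (disintegrate f τ l))
    (≤-trans (sum-mono-≤ λ y → term y (y Subset.∈? S l)) (≤-reflexive (sym (disintegrate g τ l))))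
    where
    term : ∀ y (y∈? : Dec (y ∈ S l)) → ind y∈? * ⟪ f ⟫ (τ ∪ ⁅ y ⁆) ≤ ind y∈? * ⟪ g ⟫ (τ ∪ ⁅ y ⁆)
    term y (yes y∈S) = *-monoˡ-≤ 0≤1 (p y∈S)
    term y (no _)    = ≤-reflexive (trans (zeroˡ _) (sym (zeroˡ _)))

  Avoids-∪ : ∀ {τ k l y} → Avoids τ k → l ≢ k → y ∈ S l → Avoids (τ ∪ ⁅ y ⁆) k
  Avoids-∪ {τ} {y = y} τ∌k l≢k y∈S v v∈ with Subset.x∈p∪q⁻ τ ⁅ y ⁆ v∈
  ... | inj₁ v∈τ   = τ∌k v v∈τ
  ... | inj₂ v∈⁅y⁆ with Subset.x∈⁅y⁆⇒x≡y y v∈⁅y⁆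
  ...   | ≡.refl = S-disjoint l≢k y∈S

  Π : List (Fin (suc n)) → (Fin (suc n) → Fin N → Carrier) → Fin #tops → Carrier
  Π ls f i = prod (λ l → at l (f l) i) ls

  -- Conditioning on the vertex of side l splits the correlation of H and G into the
  -- average of the conditional ones, with H centred, and the correlation of H with
  -- the conditional mean of G, which is a function on side l.
  product-bound : ∀ ls τ k → Avoids τ k → All.All (λ l → l ≢ k × Avoids τ l) ls → Unique ls →
                  ∣ τ ∣ ℕ.+ length ls ℕ.≤ n → ∀ f a h → ⟪ at k h ⟫ τ ≈ 0# →
                  at k h ⊥[ fromℕ (length ls) * κ , τ ] (λ i → a * Π ls f i)
  -- An empty product is constant, and a function with mean zero is uncorrelated with constants.
  product-bound [] τ k _ _ _ _ f a h h-mean = ≤-reflexive (trans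
    (⟪⟫-cong τ (λ i _ → solve 2 (λ x a → x :* (a :* con (+ 1)) :+ x :* (a :* con (+ 1)) := (a :+ a) :* x) refl (at k h i) a))
    (trans (⟪⟫-* (a + a) (at k h) τ) (trans (*-congˡ h-mean) (trans (zeroʳ _) (sym (trans
      (⟪⟫-cong τ (λ i _ → *-congʳ (zeroˡ κ)))
      (trans (⟪⟫-* 0# (λ i → at k h i * at k h i + (a * 1#) * (a * 1#)) τ) (zeroˡ _))))))))
  product-bound (l ∷ ls) τ k τ∌k ((l≢k , τ∌l) All.∷ avoid) (l∉ls AllPairs.∷ unique) size f a h h-mean = begin
      ⟪ (λ i → H i * G i + H i * G i) ⟫ τ
        ≤⟨ disintegrate-≤ τ l slice ⟩
      ⟪ (λ i → C * (H i * H i + G i * G i) + (H i * B i + H i * B i)) ⟫ τ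
        ≈⟨ ⟪⟫-+ (λ i → C * (H i * H i + G i * G i)) (λ i → H i * B i + H i * B i) τ ⟩
      ⟪ (λ i → C * (H i * H i + G i * G i)) ⟫ τ + ⟪ (λ i → H i * B i + H i * B i) ⟫ τ
        ≤⟨ +-mono-≤ ≤-refl (pair-bound τ k l (l≢k ∘ ≡.sym) τ∌k τ∌l
             (ℕ.≤-trans (ℕ.m<m+n ∣ τ ∣ (ℕ.s≤s ℕ.z≤n)) size) h (λ y → mean G (τ ∪ ⁅ y ⁆)) h-mean) ⟩
      ⟪ (λ i → C * (H i * H i + G i * G i)) ⟫ τ + ⟪ (λ i → κ * (H i * H i + B i * B i)) ⟫ τ
        ≤⟨ +-mono-≤ ≤-refl B≤G ⟩
      ⟪ (λ i → C * (H i * H i + G i * G i)) ⟫ τ + ⟪ (λ i → κ * (H i * H i + G i * G i)) ⟫ τ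
        ≈⟨ trans (sym (⟪⟫-+ (λ i → C * (H i * H i + G i * G i)) (λ i → κ * (H i * H i + G i * G i)) τ))
             (⟪⟫-cong τ (λ i _ → solve 3 (λ m κ e → m :* κ :* e :+ κ :* e := (con (+ 1) :+ m) :* κ :* e) refl
               (fromℕ (length ls)) κ (H i * H i + G i * G i))) ⟩
      ⟪ (λ i → fromℕ (suc (length ls)) * κ * (H i * H i + G i * G i)) ⟫ τ ∎
    where
    open ≤-Reasoning
    H = at k h
    G : Fin #tops → Carrier
    G i = a * Π (l ∷ ls) f i
    B = at l (λ y → mean G (τ ∪ ⁅ y ⁆))
    C = fromℕ (length ls) * κ
    C≥0 : C ≥0
    C≥0 = *-≥0 (fromℕ-≥0 (length ls)) κ≥0
    coord≡ : ∀ {y} → y ∈ S l → ∀ i → τ ∪ ⁅ y ⁆ ⊆ top i → coord i l ≡ y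
    coord≡ {y} y∈S i τy⊆σ = coord-unique i l (τy⊆σ (Subset.q⊆p∪q τ ⁅ y ⁆ (Subset.x∈⁅x⁆ y))) y∈S
    B≈ : ∀ {y} → y ∈ S l → ∀ i → τ ∪ ⁅ y ⁆ ⊆ top i → B i ≈ mean G (τ ∪ ⁅ y ⁆)
    B≈ y∈S i τy⊆σ = reflexive (≡.cong (λ z → mean G (τ ∪ ⁅ z ⁆)) (coord≡ y∈S i (λ {x} → τy⊆σ {x})))
    B≤G : ⟪ (λ i → κ * (H i * H i + B i * B i)) ⟫ τ ≤ ⟪ (λ i → κ * (H i * H i + G i * G i)) ⟫ τ
    B≤G = disintegrate-≤ τ l λ {y} y∈S → let τy = τ ∪ ⁅ y ⁆ ; μ = mean G τy in begin
      ⟪ (λ i → κ * (H i * H i + B i * B i)) ⟫ τy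
        ≈⟨ trans (⟪⟫-cong τy (λ i τy⊆σ → *-congˡ (+-congˡ (trans (*-cong (B≈ y∈S i (λ {x} → τy⊆σ {x})) (B≈ y∈S i
              (λ {x} → τy⊆σ {x}))) (sym (*-identityʳ _))))))
             (trans (⟪⟫-* κ (λ i → H i * H i + μ * μ * 1#) τy) (*-congˡ (⟪⟫-linear (λ i → H i * H i) (μ * μ)
                   (λ _ → 1#) τy))) ⟩
      κ * (⟪ (λ i → H i * H i) ⟫ τy + μ * μ * Z τy)
        ≤⟨ *-monoˡ-≤ κ≥0 (+-mono-≤ ≤-refl (mean-square-≤ G τy μ (Z*mean G τy))) ⟩
      κ * (⟪ (λ i → H i * H i) ⟫ τy + ⟪ (λ i → G i * G i) ⟫ τy)
        ≈⟨ trans (⟪⟫-* κ (λ i → H i * H i + G i * G i) τy) (*-congˡ (⟪⟫-+ (λ i → H i * H i) (λ i → G i * G i) τy)) ⟨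
      ⟪ (λ i → κ * (H i * H i + G i * G i)) ⟫ τy ∎
    slice : ∀ {y} → y ∈ S l → ⟪ (λ i → H i * G i + H i * G i) ⟫ (τ ∪ ⁅ y ⁆) ≤
            ⟪ (λ i → C * (H i * H i + G i * G i) + (H i * B i + H i * B i)) ⟫ (τ ∪ ⁅ y ⁆)
    slice {y} y∈S = begin
      ⟪ (λ i → H i * G i + H i * G i) ⟫ τy
        ≈⟨ ⟪⟫-cong τy (λ i _ → solve 3 (λ h g m → h :* g :+ h :* g
              := (h :- m) :* g :+ (h :- m) :* g :+ (m :+ m) :* g) refl (H i) (G i) η) ⟩
      ⟪ (λ i → (H i - η) * G i + (H i - η) * G i + (η + η) * G i) ⟫ τy
        ≈⟨ ⟪⟫-linear (λ i → (H i - η) * G i + (H i - η) * G i) (η + η) G τy ⟩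
      ⟪ (λ i → (H i - η) * G i + (H i - η) * G i) ⟫ τy + (η + η) * ⟪ G ⟫ τy
        ≤⟨ +-mono-≤ centred (≤-reflexive cross) ⟩
      ⟪ (λ i → C * (H i * H i + G i * G i)) ⟫ τy + ⟪ (λ i → H i * B i + H i * B i) ⟫ τy
        ≈⟨ ⟪⟫-+ (λ i → C * (H i * H i + G i * G i)) (λ i → H i * B i + H i * B i) τy ⟨
      ⟪ (λ i → C * (H i * H i + G i * G i) + (H i * B i + H i * B i)) ⟫ τy ∎
      where
      τy = τ ∪ ⁅ y ⁆
      η = mean H τy
      μ = mean G τy
      -- On the slice the factor of side `l` is the constant `f l y`; the scalar `a` in the
      -- statement is there to absorb it.
      G′ : Fin #tops → Carrier
      G′ i = a * f l y * Π ls f i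
      G≈G′ : ∀ i → τy ⊆ top i → G i ≈ G′ i
      G≈G′ i τy⊆σ = trans (sym (*-assoc a _ _)) (*-congʳ (*-congˡ (reflexive (≡.cong (f l) (coord≡ y∈S i
            (λ {x} → τy⊆σ {x}))))))
      η-mean : ⟪ (λ i → H i - η) ⟫ τy ≈ 0#
      η-mean = trans (⟪⟫-cong τy (λ i _ → solve 2 (λ x m → x :- m := x :+ :- m :* con (+ 1)) refl (H i) η))
        (trans (⟪⟫-linear H (- η) (λ _ → 1#) τy) (trans (+-congʳ (sym (Z*mean H τy)))
          (solve 2 (λ z m → z :* m :+ :- m :* z := con (+ 0)) refl (Z τy) η)))
      -- Both sides equal 2ημ times `Z τy`, since `B` is the constant `μ` on the slice.
      cross : (η + η) * ⟪ G ⟫ τy ≈ ⟪ (λ i → H i * B i + H i * B i) ⟫ τy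
      cross = trans (*-congˡ (sym (Z*mean G τy))) (trans
        (solve 3 (λ h z g → (h :+ h) :* (z :* g) := (g :+ g) :* (z :* h)) refl η (Z τy) μ)
        (trans (*-congˡ (Z*mean H τy)) (trans (sym (⟪⟫-* (μ + μ) H τy)) (⟪⟫-cong τy λ i τy⊆σ → trans
          (solve 2 (λ m h → (m :+ m) :* h := h :* m :+ h :* m) refl μ (H i))
          (+-cong (*-congˡ (sym (B≈ y∈S i (λ {x} → τy⊆σ {x})))) (*-congˡ (sym (B≈ y∈S i (λ {x} → τy⊆σ {x})))))))))
      recursive : (λ i → H i - η) ⊥[ C , τy ] G′
      recursive = product-bound ls τy k (Avoids-∪ {τ} τ∌k l≢k y∈S)
        (All.zipWith (λ { ((l′≢k , τ∌l′) , l≢l′) → l′≢k , Avoids-∪ {τ} τ∌l′ l≢l′ y∈S }) (avoid , l∉ls)) unique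
        (ℕ.≤-trans (ℕ.+-monoˡ-≤ (length ls) (∣p∪⁅x⁆∣≤1+∣p∣ τ y)) (ℕ.≤-trans (ℕ.≤-reflexive (≡.sym
              (ℕ.+-suc ∣ τ ∣ (length ls)))) size))
        f (a * f l y) (λ v → h v - η) η-mean
      centred : ⟪ (λ i → (H i - η) * G i + (H i - η) * G i) ⟫ τy ≤ ⟪ (λ i → C * (H i * H i + G i * G i)) ⟫ τy
      centred = begin
        ⟪ (λ i → (H i - η) * G i + (H i - η) * G i) ⟫ τy
          ≈⟨ ⟪⟫-cong τy (λ i τy⊆σ → +-cong (*-congˡ (G≈G′ i (λ {x} → τy⊆σ {x}))) (*-congˡ (G≈G′ i (λ {x} → τy⊆σ {x})))) ⟩
        ⟪ (λ i → (H i - η) * G′ i + (H i - η) * G′ i) ⟫ τy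
          ≤⟨ recursive ⟩
        ⟪ (λ i → C * ((H i - η) * (H i - η) + G′ i * G′ i)) ⟫ τy
          ≈⟨ trans (⟪⟫-* C (λ i → (H i - η) * (H i - η) + G′ i * G′ i) τy) (*-congˡ (⟪⟫-+
                (λ i → (H i - η) * (H i - η)) (λ i → G′ i * G′ i) τy)) ⟩
        C * (⟪ (λ i → (H i - η) * (H i - η)) ⟫ τy + ⟪ (λ i → G′ i * G′ i) ⟫ τy)
          ≤⟨ *-monoˡ-≤ C≥0 (+-mono-≤ (variance-≤ H τy η (Z*mean H τy))
               (≤-reflexive (⟪⟫-cong τy λ i τy⊆σ → sym (*-cong (G≈G′ i (λ {x} → τy⊆σ {x})) (G≈G′ i (λ {x} → τy⊆σ {x})))))) ⟩
        C * (⟪ (λ i → H i * H i) ⟫ τy + ⟪ (λ i → G i * G i) ⟫ τy)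
          ≈⟨ trans (⟪⟫-* C (λ i → H i * H i + G i * G i) τy) (*-congˡ (⟪⟫-+ (λ i → H i * H i) (λ i → G i * G i) τy)) ⟨
        ⟪ (λ i → C * (H i * H i + G i * G i)) ⟫ τy ∎

-- Splitting the product of indicators

module Telescoping {c ℓ₁ ℓ₂} (ℝ : Reals c ℓ₁ ℓ₂) {N} (X : Complex N) (n : ℕ)
  (pure : Pure X n) (connected : ConnectedLinks X n)
  (S : Fin (suc n) → Subset N) (partite : Partite X n S) (regular : PartiteRegular X n S)
  (λ′ : Reals.Carrier ℝ) (0<λ′ : Reals._<_ ℝ (Reals.0# ℝ) λ′)
  (bound : LocalSpectralBound ℝ X n λ′)
  (U : Fin (suc n) → Subset N) (U⊆S : ∀ k → U k ⊆ S k) where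
  open OrderedFieldProperties (Reals.orderedField ℝ)
  open Counting (Reals.orderedField ℝ)
  open TopSimplices (Reals.orderedField ℝ) X n
  open Coverings pure
  open Coordinates pure S partite
  open SubsetSizes
  open Conditioning ℝ X n pure connected S partite λ′ 0<λ′ bound
  open Reals ℝ using (√_; √-≥0; √-*-√)

  E : (Fin #tops → Carrier) → Carrier
  E f = ⟪ f ⟫ Subset.⊥

  W-⊥ : ∀ i → W Subset.⊥ i ≈ 1#
  W-⊥ i = ind-yes (Subset.⊥ Subset.⊆? top i) (λ {x} → Subset.⊥⊆ {p = top i} {x})

  E≈sum : ∀ f → E f ≈ sum f
  E≈sum f = sum-cong λ i → trans (*-congʳ (W-⊥ i)) (*-identityˡ (f i))

  T : Carrier
  T = fromℕ #tops

  sum-1 : ∀ m → sum {m} (λ _ → 1#) ≈ fromℕ m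
  sum-1 zero    = refl
  sum-1 (suc m) = +-congˡ (sum-1 m)

  Z-⊥ : Z Subset.⊥ ≈ T
  Z-⊥ = trans (E≈sum (λ _ → 1#)) (sum-1 #tops)

  0<T : 0# < T
  0<T = <-respʳ (trans (sym (⟪1⟫≈topDegree Subset.⊥)) Z-⊥) (topDegree-pos (∅-simplex X))

  u : Fin (suc n) → Fin N → Carrier
  u k v = ind (v Subset.∈? U k)

  degree : Fin (suc n) → Carrier
  degree k = fromℕ (proj₁ (regular k))

  marginal : ∀ k g → E (at k g) ≈ degree k * sum (λ y → ind (y Subset.∈? S k) * g y)
  marginal k g = trans (disintegrate (at k g) Subset.⊥ k) (trans
    (sum-cong λ y → term y (y Subset.∈? S k)) (sym (*-sum (degree k) (λ y → ind (y Subset.∈? S k) * g y))))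
    where
    term : ∀ y (y∈? : Dec (y ∈ S k)) → ind y∈? * ⟪ at k g ⟫ (Subset.⊥ ∪ ⁅ y ⁆) ≈ degree k * (ind y∈? * g y)
    term y (no _)    = trans (zeroˡ _) (sym (trans (*-congˡ (zeroˡ _)) (zeroʳ _)))
    term y (yes y∈S) = begin
      1# * ⟪ at k g ⟫ (Subset.⊥ ∪ ⁅ y ⁆)
        ≈⟨ *-congˡ (⟪⟫-cong {g = λ _ → g y * 1#} (Subset.⊥ ∪ ⁅ y ⁆) λ i y⊆σ → trans (reflexive (≡.cong g
             (coord-unique i k (y⊆σ (Subset.q⊆p∪q Subset.⊥ ⁅ y ⁆ (Subset.x∈⁅x⁆ y))) y∈S))) (sym (*-identityʳ (g y)))) ⟩
      1# * ⟪ (λ _ → g y * 1#) ⟫ (Subset.⊥ ∪ ⁅ y ⁆)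
        ≈⟨ *-congˡ (trans (⟪⟫-* (g y) (λ _ → 1#) (Subset.⊥ ∪ ⁅ y ⁆)) (*-congˡ (trans (⟪1⟫≈topDegree (Subset.⊥ ∪ ⁅ y ⁆))
             (fromℕ-cong (≡.trans (≡.cong (topDegree X n) (Subset.∪-identityˡ ⁅ y ⁆)) (proj₂ (regular k) y y∈S)))))) ⟩
      1# * (g y * degree k)
        ≈⟨ solve 2 (λ g d → con (+ 1) :* (g :* d) := d :* (con (+ 1) :* g)) refl (g y) (degree k) ⟩
      degree k * (1# * g y) ∎
      where open ≈-Reasoning

  T≈degree*S : ∀ k → T ≈ degree k * fromℕ (∣ S k ∣)
  T≈degree*S k = trans (sym Z-⊥) (trans (marginal k (λ _ → 1#)) (*-congˡ
    (trans (sum-cong λ y → *-identityʳ (ind (y Subset.∈? S k))) (sym (fromℕ-∣p∣ (S k))))))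

  E-u : ∀ k → E (at k (u k)) ≈ degree k * fromℕ (∣ U k ∣)
  E-u k = trans (marginal k (u k)) (*-congˡ (trans (sum-cong λ y →
    trans (sym (ind-× (y Subset.∈? S k) (y Subset.∈? U k))) (ind-cong ((y Subset.∈? S k) ×-dec (y Subset.∈? U k)) (y Subset.∈? U k) proj₂ (λ y∈U → U⊆S k y∈U , y∈U)))
    (sym (fromℕ-∣p∣ (U k)))))

  S-nonZero : ∀ k → NonZero ∣ S k ∣
  S-nonZero k = ℕ.≢-nonZero λ s≡0 → ≤-reflexive (trans (T≈degree*S k) (trans (*-congˡ (fromℕ-cong s≡0)) (zeroʳ _))) 0<T

  p : Fin (suc n) → Carrier
  p k = fromℕ (∣ U k ∣) /ℕ ∣ S k ∣

  S*p : ∀ k → fromℕ (∣ S k ∣) * p k ≈ fromℕ (∣ U k ∣)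
  S*p k = /ℕ-*-cancel (fromℕ (∣ U k ∣)) ∣ S k ∣ {{S-nonZero k}}

  T*p≈E-u : ∀ k → T * p k ≈ E (at k (u k))
  T*p≈E-u k = trans (*-congʳ (T≈degree*S k)) (trans (*-assoc _ _ _) (trans (*-congˡ (S*p k)) (sym (E-u k))))

  p≥0 : ∀ k → p k ≥0
  p≥0 k = /ℕ-≥0 ∣ S k ∣ (fromℕ-≥0 ∣ U k ∣)

  p≤1 : ∀ k → p k ≤ 1#
  p≤1 k = *-cancelˡ-≤ (fromℕ-pos′ ∣ S k ∣ {{S-nonZero k}}) (≤-trans (≤-reflexive (S*p k))
    (≤-trans (fromℕ-mono-≤ (Subset.p⊆q⇒∣p∣≤∣q∣ (U⊆S k))) (≤-reflexive (sym (*-identityʳ _)))))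

  r : Fin (suc n) → Carrier
  r k = √ p k

  r≥0 : ∀ k → r k ≥0
  r≥0 k = √-≥0 (p≥0 k)

  r*r : ∀ k → r k * r k ≈ p k
  r*r k = √-*-√ (p≥0 k)

  r≤1 : ∀ k → r k ≤ 1#
  r≤1 k = square-cancel-≤ 0≤1 (≤-trans (≤-reflexive (r*r k)) (≤-trans (p≤1 k) (≤-reflexive (sym (*-identityˡ 1#)))))

  p≤r : ∀ k → p k ≤ r k
  p≤r k = ≤-trans (≤-reflexive (sym (r*r k))) (≤-trans (*-monoˡ-≤ (r≥0 k) (r≤1 k)) (≤-reflexive (*-identityʳ (r k))))

  u-≥0 : ∀ i k → at k (u k) i ≥0
  u-≥0 i k = ind-≥0 (coord i k Subset.∈? U k)

  u-idem : ∀ i k → at k (u k) i * at k (u k) i ≈ at k (u k) i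
  u-idem i k = ind-idem (coord i k Subset.∈? U k)

  u-≤1 : ∀ i k → at k (u k) i ≤ 1#
  u-≤1 i k with does (coord i k Subset.∈? U k)
  ... | true  = ≤-refl
  ... | false = 0≤1

  -- The cost of splitting off one factor: at most `n` conditionings at `κ` each, times the number
  -- of top simplices, because `E` is not normalised.
  B : Carrier
  B = fromℕ n * κ * T

  B≥0 : B ≥0
  B≥0 = *-≥0 (*-≥0 (fromℕ-≥0 n) κ≥0) (fromℕ-≥0 #tops)

  G : List (Fin (suc n)) → Fin #tops → Carrier
  G ls = Π ls u

  G-idem : ∀ ls i → G ls i * G ls i ≈ G ls i
  G-idem ls i = trans (sym (prod-* (λ l → at l (u l) i) (λ l → at l (u l) i) ls)) (prod-cong (u-idem i) ls)

  module _ (k j : Fin (suc n)) (ls : List (Fin (suc n))) (k∉ : All.All (_≢ k) (ls ++ j ∷ []))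
    (unique : Unique (ls ++ j ∷ [])) (size : length (ls ++ j ∷ []) ℕ.≤ n) where
    private
      ms = ls ++ j ∷ []
      D = E (λ i → at k (u k) i * G ms i) - p k * E (G ms)
      C = fromℕ (length ms) * κ

      C≥0 : C ≥0
      C≥0 = *-≥0 (fromℕ-≥0 (length ms)) κ≥0

      -- This is `product-bound` for a (u k - p k) and `b` times the product. The variance of an
      -- indicator is at most its mean, which gives `T * p k`; a product of indicators is its own
      -- square and at most its last factor, which gives `T * p j`.
      scaled : ∀ a b → (a * b + a * b) * D ≤ a * a * (C * (T * p k)) + b * b * (C * (T * p j))
      scaled a b = begin
        (a * b + a * b) * D
          ≈⟨ *-congˡ (+-congˡ (solve 2 (λ p e → :- (p :* e) := :- p :* e) refl (p k) (E (G ms)))) ⟩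
        (a * b + a * b) * (E (λ i → v i * G ms i) + - p k * E (G ms))
          ≈⟨ trans (⟪⟫-* (a * b + a * b) (λ i → v i * G ms i + - p k * G ms i) Subset.⊥) (*-congˡ (⟪⟫-linear
                (λ i → v i * G ms i) (- p k) (G ms) Subset.⊥)) ⟨
        E (λ i → (a * b + a * b) * (v i * G ms i + - p k * G ms i))
          ≈⟨ ⟪⟫-cong Subset.⊥ (λ i _ → solve 5 (λ a b v g p → (a :* b :+ a :* b) :* (v :* g :+ :- p :* g)
               := a :* (v :- p) :* (b :* g) :+ a :* (v :- p) :* (b :* g)) refl a b (v i) (G ms i) (p k)) ⟩
        E (λ i → H i * (b * G ms i) + H i * (b * G ms i))
          ≤⟨ product-bound ms Subset.⊥ k (λ _ v∈⊥ → contradiction v∈⊥ Subset.∉⊥) (All.map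
                (λ l≢k → l≢k , λ _ v∈⊥ → contradiction v∈⊥ Subset.∉⊥) k∉)
               unique (ℕ.≤-trans (ℕ.≤-reflexive (≡.cong (ℕ._+ length ms) (Subset.∣⊥∣≡0 N))) size) u b
                     (λ y → a * (u k y - p k)) H-mean ⟩
        E (λ i → C * (H i * H i + b * G ms i * (b * G ms i)))
          ≈⟨ ⟪⟫-cong Subset.⊥ (λ i _ → trans (solve 5 (λ a b x g C → C :* (a :* x :* (a :* x) :+ b :* g :* (b :* g))
               := a :* a :* C :* (x :* x) :+ b :* b :* C :* (g :* g)) refl a b (v i - p k) (G ms i) C) (+-congˡ
                     (*-congˡ (G-idem ms i)))) ⟩
        E (λ i → a * a * C * ((v i - p k) * (v i - p k)) + b * b * C * G ms i)
          ≈⟨ trans (⟪⟫-linear (λ i → a * a * C * ((v i - p k) * (v i - p k))) (b * b * C) (G ms) Subset.⊥)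
               (+-congʳ (⟪⟫-* (a * a * C) (λ i → (v i - p k) * (v i - p k)) Subset.⊥)) ⟩
        a * a * C * E (λ i → (v i - p k) * (v i - p k)) + b * b * C * E (G ms)
          ≤⟨ +-mono-≤ (*-monoˡ-≤ (*-≥0 (square-≥0 a) C≥0) (≤-trans (variance-≤ v Subset.⊥ (p k) Zp≈)
               (≤-reflexive (trans (⟪⟫-cong Subset.⊥ λ i _ → u-idem i k) (sym (T*p≈E-u k))))))
               (*-monoˡ-≤ (*-≥0 (square-≥0 b) C≥0) (≤-trans (⟪⟫-mono Subset.⊥ λ i → prod-∷ʳ-≤ (u-≥0 i) (u-≤1 i) ls j)
                     (≤-reflexive (sym (T*p≈E-u j))))) ⟩
        a * a * C * (T * p k) + b * b * C * (T * p j)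
          ≈⟨ +-cong (*-assoc (a * a) C (T * p k)) (*-assoc (b * b) C (T * p j)) ⟩
        a * a * (C * (T * p k)) + b * b * (C * (T * p j)) ∎
        where
        open ≤-Reasoning
        v = at k (u k)
        H = at k (λ y → a * (u k y - p k))
        Zp≈ : Z Subset.⊥ * p k ≈ E v
        Zp≈ = trans (*-congʳ Z-⊥) (T*p≈E-u k)
        H-mean : E H ≈ 0#
        H-mean = trans (⟪⟫-* a (λ i → v i - p k) Subset.⊥) (trans (*-congˡ (trans
          (⟪⟫-cong Subset.⊥ (λ i _ → solve 2 (λ x m → x :- m := x :+ :- m :* con (+ 1)) refl (v i) (p k)))
          (trans (⟪⟫-linear v (- p k) (λ _ → 1#) Subset.⊥) (trans (+-congʳ (sym Zp≈))
            (solve 2 (λ z m → z :* m :+ :- m :* z := con (+ 0)) refl (Z Subset.⊥) (p k)))))) (zeroʳ a))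

    -- The free scalars of `scaled` are optimised into a bound on the square of the correlation,
    -- which controls both of its signs.
    decorrelate : E (λ i → at k (u k) i * G (ls ++ j ∷ []) i) - p k * E (G (ls ++ j ∷ [])) ≤± B * (r k * r j)
    decorrelate = square-bound⇒≤± (*-≥0 B≥0 (*-≥0 (r≥0 k) (r≥0 j))) (begin
        D * D
          ≤⟨ amgm⇒square-bound (*-≥0 C≥0 (*-≥0 T≥0 (p≥0 k))) (*-≥0 C≥0 (*-≥0 T≥0 (p≥0 j))) scaled ⟩
        C * (T * p k) * (C * (T * p j))
          ≈⟨ *-cong (*-congˡ (*-congˡ (r*r k))) (*-congˡ (*-congˡ (r*r j))) ⟨
        C * (T * (r k * r k)) * (C * (T * (r j * r j)))
          ≈⟨ solve 4 (λ C T x y → C :* (T :* (x :* x)) :* (C :* (T :* (y :* y)))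
                := C :* T :* (x :* y) :* (C :* T :* (x :* y))) refl C T (r k) (r j) ⟩
        C * T * (r k * r j) * (C * T * (r k * r j))
          ≤⟨ *-monoˡ-≤ (*-≥0 (*-≥0 C≥0 T≥0) rr≥0) CTrr≤ ⟩
        C * T * (r k * r j) * (B * (r k * r j))
          ≤⟨ *-monoʳ-≤ (*-≥0 B≥0 rr≥0) CTrr≤ ⟩
        B * (r k * r j) * (B * (r k * r j)) ∎)
      where
      open ≤-Reasoning
      T≥0 : T ≥0
      T≥0 = <⇒≤ 0<T
      rr≥0 : r k * r j ≥0
      rr≥0 = *-≥0 (r≥0 k) (r≥0 j)
      CTrr≤ : C * T * (r k * r j) ≤ B * (r k * r j)
      CTrr≤ = *-monoʳ-≤ rr≥0 (*-monoʳ-≤ T≥0 (*-monoʳ-≤ κ≥0 (fromℕ-mono-≤ size)))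

  -- The error of treating the coordinates as independent, multiplied by `T`.
  Δ : List (Fin (suc n)) → Carrier
  Δ ls = E (G ls) - T * prod p ls

  Δ-∷ : ∀ k ls → Δ (k ∷ ls) ≈ (E (λ i → at k (u k) i * G ls i) - p k * E (G ls)) + p k * Δ ls
  Δ-∷ k ls = solve 5 (λ x p e T q → x :- T :* (p :* q) := (x :- p :* e) :+ p :* (e :- T :* q)) refl
    (E (λ i → at k (u k) i * G ls i)) (p k) (E (G ls)) T (prod p ls)

  -- Each factor peeled off the front costs one `decorrelate`. Since `j` stays at the end, every
  -- step has `r j` available, while `r k` and `p k` are bounded by 1. A single remaining factor has
  -- no error, whence `length ls` steps.
  Δ-bound : ∀ ls j → Unique (ls ++ j ∷ []) → length (ls ++ j ∷ []) ℕ.≤ n →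
            Δ (ls ++ j ∷ []) ≤± fromℕ (length ls) * (B * r j)
  Δ-bound [] j _ _ = ≤±-cong Δ≈0 (≤-reflexive (sym (zeroˡ _)) , ≤-reflexive (trans (solve 0 (:- con (+ 0)
        := con (+ 0)) refl) (sym (zeroˡ _))))
    where
    Δ≈0 : Δ (j ∷ []) ≈ 0#
    Δ≈0 = trans (+-cong (trans (⟪⟫-cong Subset.⊥ λ i _ → *-identityʳ (at j (u j) i)) (sym (T*p≈E-u j))) (-‿cong
          (*-congˡ (*-identityʳ (p j))))) (-‿inverseʳ (T * p j))
  Δ-bound (k ∷ ls) j (k∉ AllPairs.∷ unique) size = ≤±-cong (Δ-∷ k (ls ++ j ∷ [])) (≤±-trans
    (≤±-+ (decorrelate k j ls (All.map (λ k≢l → k≢l ∘ ≡.sym) k∉) unique size′)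
          (≤±-* (p≥0 k) (Δ-bound ls j unique size′)))
    (begin
      B * (r k * r j) + p k * (fromℕ (length ls) * (B * r j))
        ≤⟨ +-mono-≤ (*-monoˡ-≤ B≥0 (*-monoʳ-≤ (r≥0 j) (r≤1 k))) (*-monoʳ-≤ (*-≥0 (fromℕ-≥0 (length ls))
              (*-≥0 B≥0 (r≥0 j))) (p≤1 k)) ⟩
      B * (1# * r j) + 1# * (fromℕ (length ls) * (B * r j))
        ≈⟨ solve 3 (λ b r m → b :* (con (+ 1) :* r) :+ con (+ 1) :* (m :* (b :* r))
              := (con (+ 1) :+ m) :* (b :* r)) refl B (r j) (fromℕ (length ls)) ⟩
      fromℕ (suc (length ls)) * (B * r j) ∎))
    where
    open ≤-Reasoning
    size′ = ℕ.≤-trans (ℕ.n≤1+n _) size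

  -- The first step pays `r i` itself and the remaining error comes multiplied by `p i`, which is at
  -- most `r i`; so `r i` survives in every term.
  Δ-pair-bound : ∀ i ls j → Unique (i ∷ ls ++ j ∷ []) → length (ls ++ j ∷ []) ℕ.≤ n →
                 Δ (i ∷ ls ++ j ∷ []) ≤± fromℕ (suc (length ls)) * (B * (r i * r j))
  Δ-pair-bound i ls j (i∉ AllPairs.∷ unique) size = ≤±-cong (Δ-∷ i (ls ++ j ∷ [])) (≤±-trans
    (≤±-+ (decorrelate i j ls (All.map (λ i≢l → i≢l ∘ ≡.sym) i∉) unique size)
          (≤±-* (p≥0 i) (Δ-bound ls j unique size)))
    (begin
      B * (r i * r j) + p i * (fromℕ (length ls) * (B * r j))
        ≤⟨ +-mono-≤ ≤-refl (*-monoʳ-≤ (*-≥0 (fromℕ-≥0 (length ls)) (*-≥0 B≥0 (r≥0 j))) (p≤r i)) ⟩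
      B * (r i * r j) + r i * (fromℕ (length ls) * (B * r j))
        ≈⟨ solve 4 (λ b s r m → b :* (s :* r) :+ s :* (m :* (b :* r))
              := (con (+ 1) :+ m) :* (b :* (s :* r))) refl B (r i) (r j) (fromℕ (length ls)) ⟩
      fromℕ (suc (length ls)) * (B * (r i * r j)) ∎))
    where open ≤-Reasoning

  sides : List (Fin (suc n))
  sides = List.allFin (suc n)

  rearrange : ∀ {i j} → i ≢ j → ∃[ ls ] sides ↭ i ∷ ls ++ j ∷ []
  rearrange {i} {j} i≢j with List.∈-∃++ (List.∈-allFin i)
  ... | ys , zs , e with List.∈-∃++ (remaining (↭.∈-resp-↭ sides↭ (List.∈-allFin j)))
    where
    sides↭ : sides ↭ i ∷ ys ++ zs
    sides↭ = ↭.↭-trans (↭.↭-reflexive e) (↭.shift i ys zs)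
    remaining : ∀ {xs} → j List.∈ (i ∷ xs) → j List.∈ xs
    remaining (here j≡i)   = contradiction (≡.sym j≡i) i≢j
    remaining (there j∈xs) = j∈xs
  ...   | as , bs , e′ = as ++ bs , ↭.↭-trans (↭.↭-reflexive e) (↭.↭-trans (↭.shift i ys zs)
          (↭.prep i (↭.↭-trans (↭.↭-reflexive e′) (↭.↭-trans (↭.shift j as bs) (↭.∷↭∷ʳ j (as ++ bs))))))

  -- The error does not depend on the order of the factors, so any two distinct sides can be moved
  -- to the two ends of the list.
  total-bound : ∀ {i j} → i ≢ j → Δ sides ≤± fromℕ n * (B * (r i * r j))
  total-bound {i} {j} i≢j = ≤±-cong Δ≈ (≤±-trans (Δ-pair-bound i ls j unique (ℕ.≤-reflexive size))
    (*-monoʳ-≤ (*-≥0 B≥0 (*-≥0 (r≥0 i) (r≥0 j))) (fromℕ-mono-≤ (ℕ.≤-reflexive (≡.trans (≡.trans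
          (ℕ.+-comm 1 (length ls)) (≡.sym (List.length-++ ls))) size)))))
    where
    ls = proj₁ (rearrange i≢j)
    perm = proj₂ (rearrange i≢j)
    unique : Unique (i ∷ ls ++ j ∷ [])
    unique = SetoidPermutation.Unique-resp-↭ (≡.setoid (Fin (suc n))) (↭.↭⇒↭ₛ perm) (Unique.allFin⁺ (suc n))
    size : length (ls ++ j ∷ []) ≡ n
    size = ℕ.suc-injective (≡.trans (≡.sym (↭.↭-length perm)) (List.length-tabulate (λ k → k)))
    Δ≈ : Δ sides ≈ Δ (i ∷ ls ++ j ∷ [])
    Δ≈ = +-cong (⟪⟫-cong Subset.⊥ λ o _ → prod-↭ (λ l → at l (u l) o) perm) (-‿cong (*-congˡ (prod-↭ p perm)))

  -- As `U k` lies in `S k`, it can meet a top simplex only in the coordinate of side `k`; meeting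
  -- it once thus means containing that coordinate.
  transversalCount≈ : fromℕ (transversalCount X n U) ≈ E (G sides)
  transversalCount≈ = trans (count-tops (λ σ → Fin.all? (λ k → ∣ σ ∩ U k ∣ ℕ.≟ 1))) (trans
    (sum-cong λ i → trans (prod-ind (λ k → ∣ top i ∩ U k ∣ ℕ.≟ 1)) (prod-cong (λ k →
      ind-cong (∣ top i ∩ U k ∣ ℕ.≟ 1) (coord i k Subset.∈? U k) (forth i k) (back i k)) sides))
    (sym (E≈sum (G sides))))
    where
    forth : ∀ i k → ∣ top i ∩ U k ∣ ≡ 1 → coord i k ∈ U k
    forth i k ∣∩∣≡1 with ∣p∣≡1⇒nonempty ∣∩∣≡1
    ... | v , v∈ with Subset.x∈p∩q⁻ (top i) (U k) v∈
    ...   | v∈σ , v∈U = ≡.subst (_∈ U k) (≡.sym (coord-unique i k v∈σ (U⊆S k v∈U))) v∈U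
    back : ∀ i k → coord i k ∈ U k → ∣ top i ∩ U k ∣ ≡ 1
    back i k v∈U = ℕ.≤-antisym
      (ℕ.≤-trans (Subset.p⊆q⇒∣p∣≤∣q∣ λ x∈ → let (x∈σ , x∈U) = Subset.x∈p∩q⁻ (top i) (U k) x∈ in Subset.x∈p∩q⁺ (x∈σ , U⊆S k x∈U))
        (ℕ.≤-reflexive (Partite.transversal partite (top i) (top-sized i) k)))
      (ℕ.≤-trans (ℕ.≤-reflexive (≡.sym (Subset.∣⁅x⁆∣≡1 (coord i k)))) (Subset.p⊆q⇒∣p∣≤∣q∣ (⁅x⁆⊆
            (Subset.x∈p∩q⁺ (coord∈top i k , v∈U)))))

  fromℕ-∏ : ∀ (V : Fin (suc n) → Subset N) → fromℕ ∏∣ V ∣ ≈ prod (λ k → fromℕ (∣ V k ∣)) sides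
  fromℕ-∏ V = fromℕ-product (λ k → ∣ V k ∣) (λ k → k)

  ∏S-nonZero : NonZero ∏∣ S ∣
  ∏S-nonZero = ℕ.≢-nonZero λ s≡0 → ≤-reflexive (fromℕ-cong s≡0)
    (<-respʳ (sym (fromℕ-∏ S)) (prod-pos (λ k → fromℕ-pos′ ∣ S k ∣ {{S-nonZero k}}) sides))

  density : fromℕ ∏∣ U ∣ /ℕ ∏∣ S ∣ ≈ prod p sides
  density = /ℕ-unique ∏∣ S ∣ {{∏S-nonZero}} (trans (*-congʳ (fromℕ-∏ S)) (trans
    (sym (prod-* (λ k → fromℕ (∣ S k ∣)) p sides)) (trans (prod-cong S*p sides) (sym (fromℕ-∏ U)))))

  discrepancy : Carrier
  discrepancy = fromℕ (transversalCount X n U) /ℕ topCount X n - fromℕ ∏∣ U ∣ /ℕ ∏∣ S ∣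

  T*discrepancy : T * discrepancy ≈ Δ sides
  T*discrepancy = trans (solve 3 (λ t x y → t :* (x :- y) := t :* x :- t :* y) refl T _ _)
    (+-cong (trans (/ℕ-*-cancel _ #tops {{ℕ.≢-nonZero λ t≡0 → ≤-reflexive (fromℕ-cong t≡0) 0<T}}) transversalCount≈)
            (-‿cong (*-congˡ density)))

  abs-discrepancy : ∀ {i j} → i ≢ j → abs discrepancy ≤
    fromℕ (n ℕ.* (n ℕ.* n)) * λ′ * √ (fromℕ (∣ U i ∣ ℕ.* ∣ U j ∣) /ℕ (∣ S i ∣ ℕ.* ∣ S j ∣))
  abs-discrepancy {i} {j} i≢j = ≤-trans (abs-≤ (cancel (proj₁ bounded))
        (cancel (≤-trans (≤-reflexive (sym (-‿distribʳ-* T discrepancy))) (proj₂ bounded))))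
      (*-monoˡ-≤ (*-≥0 (fromℕ-≥0 (n ℕ.* (n ℕ.* n))) (<⇒≤ 0<λ′)) rr≤√q)
    where
    n³λ = fromℕ (n ℕ.* (n ℕ.* n)) * λ′
    cancel : ∀ {x} → T * x ≤ T * (n³λ * (r i * r j)) → x ≤ n³λ * (r i * r j)
    cancel = *-cancelˡ-≤ 0<T
    n³≈ : fromℕ (n ℕ.* (n ℕ.* n)) ≈ fromℕ n * (fromℕ n * fromℕ n)
    n³≈ = trans (fromℕ-* n (n ℕ.* n)) (*-congˡ (fromℕ-* n n))
    rhs≈ : fromℕ n * (B * (r i * r j)) ≈ T * (n³λ * (r i * r j))
    rhs≈ = trans (solve 4 (λ m l t x → m :* (m :* (m :* l) :* t :* x)
          := t :* (m :* (m :* m) :* l :* x)) refl (fromℕ n) λ′ T (r i * r j))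
      (*-congˡ (*-congʳ (*-congʳ (sym n³≈))))
    bounded : T * discrepancy ≤± T * (n³λ * (r i * r j))
    bounded = ≤±-trans (≤±-cong T*discrepancy (total-bound i≢j)) (≤-reflexive rhs≈)
    d = ∣ S i ∣ ℕ.* ∣ S j ∣
    q = fromℕ (∣ U i ∣ ℕ.* ∣ U j ∣) /ℕ d
    q≥0 : q ≥0
    q≥0 = /ℕ-≥0 d (fromℕ-≥0 (∣ U i ∣ ℕ.* ∣ U j ∣))
    q≈ : q ≈ p i * p j
    q≈ = /ℕ-unique d {{ℕ.m*n≢0 ∣ S i ∣ ∣ S j ∣ {{S-nonZero i}} {{S-nonZero j}}}} (trans
          (*-congʳ (fromℕ-* ∣ S i ∣ ∣ S j ∣)) (trans
      (solve 4 (λ a b x y → a :* b :* (x :* y) := a :* x :* (b :* y)) refl (fromℕ (∣ S i ∣)) (fromℕ (∣ S j ∣)) (p i) (p j))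
      (trans (*-cong (S*p i) (S*p j)) (sym (fromℕ-* ∣ U i ∣ ∣ U j ∣)))))
    rr≤√q : r i * r j ≤ √ q
    rr≤√q = square-cancel-≤ (√-≥0 q≥0) (≤-reflexive (trans
      (solve 2 (λ x y → x :* y :* (x :* y) := x :* x :* (y :* y)) refl (r i) (r j))
      (trans (*-cong (r*r i) (r*r j)) (trans (sym q≈) (sym (√-*-√ q≥0))))))

-- The constant, the minimum over pairs, and the theorem

module MixingConstant {c ℓ₁ ℓ₂} (ℝ : Reals c ℓ₁ ℓ₂) where
  open OrderedFieldProperties (Reals.orderedField ℝ)

  private
    n<2^n : ∀ n → n ℕ.< 2 ℕ.^ n
    n<2^n zero    = ℕ.s≤s ℕ.z≤n
    n<2^n (suc n) = ℕ.≤-trans (ℕ.+-mono-≤ (ℕ.m^n>0 2 n) (n<2^n n))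
      (ℕ.≤-reflexive (≡.cong (2 ℕ.^ n ℕ.+_) (≡.sym (ℕ.+-identityʳ (2 ℕ.^ n)))))

    difference-≥ : ∀ {a b} m → m ℕ.+ b ℕ.≤ a → fromℕ m ≤ fromℕ a - fromℕ b
    difference-≥ {a} {b} m m+b≤a = x-y≥0⇒y≤x (≤-trans (y≤x⇒x-y≥0 (≤-trans (≤-reflexive
          (sym (fromℕ-+ m b))) (fromℕ-mono-≤ m+b≤a)))
      (≤-reflexive (solve 3 (λ a b m → a :- (m :+ b) := a :- b :- m) refl (fromℕ a) (fromℕ b) (fromℕ m))))

  -- All summands are nonnegative. The first one is n (n + 1)^n (2^n - 1), because n ! / (n - 1)! =
  -- n, and its last two factors are each at least n.
  n³≤mixingConstant : ∀ n .{{_ : NonZero n}} → fromℕ (n ℕ.* (n ℕ.* n)) ≤ mixingConstant ℝ n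
  n³≤mixingConstant n@(suc m) = ≤-trans first (term≤sum {n} {term} term≥0 zero)
    where
    term : Fin n → Carrier
    term i = let k = toℕ i in
      fromℕ (n !)
      * (fromℕ ((suc n ℕ.∸ k) ℕ.^ (n ℕ.∸ k)) /ℕ ((n ℕ.∸ suc k) !))
      * (fromℕ (suc k ℕ.* (suc (suc k)) ℕ.^ (n ℕ.∸ k)) - fromℕ (suc k ℕ.^ suc (n ℕ.∸ k)))
    term≥0 : ∀ i → term i ≥0
    term≥0 i = *-≥0 (*-≥0 (fromℕ-≥0 (n !)) (/ℕ-≥0 ((n ℕ.∸ suc (toℕ i)) !) (fromℕ-≥0 ((suc n ℕ.∸ toℕ i) ℕ.^ (n ℕ.∸ toℕ i)))))
      (difference-≥ 0 (ℕ.*-monoʳ-≤ (suc (toℕ i)) (ℕ.^-monoˡ-≤ (n ℕ.∸ toℕ i) (ℕ.n≤1+n (suc (toℕ i))))))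
    open ≤-Reasoning
    first : fromℕ (n ℕ.* (n ℕ.* n)) ≤ term zero
    first = begin
      fromℕ (n ℕ.* (n ℕ.* n))
        ≈⟨ trans (fromℕ-* n (n ℕ.* n)) (trans (*-congˡ (fromℕ-* n n)) (sym (*-assoc _ _ _))) ⟩
      fromℕ n * fromℕ n * fromℕ n
        ≤⟨ *-monoʳ-≤ (fromℕ-≥0 n) (*-monoˡ-≤ (fromℕ-≥0 n) (fromℕ-mono-≤ (ℕ.≤-trans (ℕ.n≤1+n n)
              (ℕ.m≤m*n (suc n) (suc n ℕ.^ m) {{ℕ.m^n≢0 (suc n) m}})))) ⟩
      fromℕ n * fromℕ (suc n ℕ.^ n) * fromℕ n
        ≤⟨ *-monoˡ-≤ (*-≥0 (fromℕ-≥0 n) (fromℕ-≥0 (suc n ℕ.^ n))) (difference-≥ n (ℕ.≤-trans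
             (ℕ.≤-reflexive (≡.trans (≡.cong (n ℕ.+_) (ℕ.^-zeroˡ (suc n))) (ℕ.+-comm n 1))) (ℕ.≤-trans (n<2^n n)
                   (ℕ.≤-reflexive (≡.sym (ℕ.*-identityˡ (2 ℕ.^ n))))))) ⟩
      fromℕ n * fromℕ (suc n ℕ.^ n) * (fromℕ (1 ℕ.* 2 ℕ.^ n) - fromℕ (1 ℕ.^ suc n))
        ≈⟨ *-congʳ (trans (*-congʳ (fromℕ-* n (m !))) (trans (*-assoc _ _ _)
              (*-congˡ (/ℕ-*-cancel (fromℕ (suc n ℕ.^ n)) (m !) {{m ℕ.!≢0}})))) ⟨
      fromℕ (n !) * (fromℕ (suc n ℕ.^ n) /ℕ (m !)) * (fromℕ (1 ℕ.* 2 ℕ.^ n) - fromℕ (1 ℕ.^ suc n)) ∎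

  ≤-minPairs : ∀ n .{{_ : NonZero n}} (f : Fin (suc n) → Fin (suc n) → Carrier) x →
               (∀ i j → i ≢ j → x ≤ f i j) → x ≤ minPairs ℝ n f
  ≤-minPairs n@(suc _) f x p = ≤-foldr (p zero (suc zero) (λ ()))
    (List.map⁺ (All.map (λ {(i , j)} i<j → p i j (Fin.<⇒≢ i<j))
      (List.all-filter (λ (i , j) → i Fin.<? j) (List.cartesianProduct (List.allFin (suc n)) (List.allFin (suc n))))))
    where
    ≤-foldr : ∀ {y ys} → x ≤ y → All.All (x ≤_) ys → x ≤ List.foldr _⊓_ y ys
    ≤-foldr x≤y All.[]           = x≤y
    ≤-foldr x≤y (x≤z All.∷ x≤zs) = proj₂ (proj₂ (⊓-infimum _ _)) x x≤z (≤-foldr x≤y x≤zs)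

theorem1p2 : ∀ {c ℓ₁ ℓ₂} (ℝ : Reals c ℓ₁ ℓ₂) (let open Reals ℝ)
    (n : ℕ) .{{_ : NonZero n}} {N : ℕ} (X : Complex N) (S : Fin (suc n) → Subset N) →
    Pure X n →
    ConnectedLinks X n →
    Partite X n S →
    PartiteRegular X n S →
    (λ′ : Carrier) → 0# < λ′ → λ′ < 1# →
    LocalSpectralBound ℝ X n λ′ →
    (U : Fin (suc n) → Subset N) → (∀ i → U i ⊆ S i) →
    abs (fromℕ (transversalCount X n U) /ℕ topCount X n - fromℕ ∏∣ U ∣ /ℕ ∏∣ S ∣)
    ≤ mixingConstant ℝ n * λ′
    * minPairs ℝ n (λ i j → √ (fromℕ (∣ U i ∣ ℕ.* ∣ U j ∣) /ℕ (∣ S i ∣ ℕ.* ∣ S j ∣)))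
theorem1p2 ℝ n X S pure connected partite regular λ′ 0<λ′ _ bound U U⊆S =
    *-cancelˡ-≤ 0<y (≤-trans (≤-minPairs n f (y * abs discrepancy) scaled)
      (≤-reflexive (sym (trans (sym (*-assoc y C m)) (trans (*-congʳ (trans (*-comm y C) Cy≈1)) (*-identityˡ m))))))
  where
  open OrderedFieldProperties (Reals.orderedField ℝ)
  open Reals ℝ using (√_; √-≥0)
  open MixingConstant ℝ
  open Telescoping ℝ X n pure connected S partite regular λ′ 0<λ′ bound U U⊆S using (discrepancy; abs-discrepancy)
  f : Fin (suc n) → Fin (suc n) → Carrier
  f i j = √ (fromℕ (∣ U i ∣ ℕ.* ∣ U j ∣) /ℕ (∣ S i ∣ ℕ.* ∣ S j ∣))
  C = mixingConstant ℝ n * λ′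
  m = minPairs ℝ n f
  n³≢0 : NonZero (n ℕ.* (n ℕ.* n))
  n³≢0 = let instance _ = ℕ.m*n≢0 n n in ℕ.m*n≢0 n (n ℕ.* n)
  0<C : 0# < C
  0<C = *-pos (<-≤-trans (fromℕ-pos′ (n ℕ.* (n ℕ.* n)) {{n³≢0}}) (n³≤mixingConstant n)) 0<λ′
  -- Multiplying by the reciprocal of the constant factor isolates the minimum on the right; a fixed
  -- number then has to lie below each `f i j`.
  y = proj₁ (reciprocal-pos 0<C)
  0<y = proj₁ (proj₂ (reciprocal-pos 0<C))
  Cy≈1 = proj₂ (proj₂ (reciprocal-pos 0<C))
  scaled : ∀ i j → i ≢ j → y * abs discrepancy ≤ f i j
  scaled i j i≢j = *-cancelˡ-≤ 0<C (≤-trans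
    (≤-reflexive (trans (sym (*-assoc C y _)) (trans (*-congʳ Cy≈1) (*-identityˡ _))))
    (≤-trans (abs-discrepancy i≢j) (*-monoʳ-≤ (√-≥0 (/ℕ-≥0 (∣ S i ∣ ℕ.* ∣ S j ∣) (fromℕ-≥0 (∣ U i ∣ ℕ.* ∣ U j ∣))))
      (*-monoʳ-≤ (<⇒≤ 0<λ′) (n³≤mixingConstant n)))))
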